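{- For every $\eta>0$ there exist $\nu>0$ and $n_0$ such that for all $n>n_0$, $$\bigl|Forb(n,T_5)\setminus Forb(n,T_5,\eta)\bigr| < 2^{(1-\nu)\frac{2n^3}{27}}.$$
   Context: A 3-graph on $[n]$ is a set of 3-element subsets of $[n]$. $T_5$ is the 3-graph $\{123,124,125,345\}$ on five vertices. $Forb(n,T_5)$ is the set of 3-graphs on vertex set $[n]$ containing no copy of $T_5$. For an ordered partition $P=(X,Y)$ of the vertex set of a 3-graph $\mathcal{H}$, an edge is consistent with $P$ if it has exactly two vertices in $X$, and inconsistent otherwise. $D_{\mathcal{H}}$ denotes the minimum, over all ordered partitions $P$ of the vertex set, of the number of edges of $\mathcal{H}$ inconsistent with $P$. $Forb(n,T_5,\eta)=\{\mathcal{H}\subset\binom{[n]}{3}: T_5\not\subset\mathcal{H},\ D_{\mathcal{H}}\le \eta n^3\}$. -}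

module Defs where

open import Data.Bool using (Bool; true; false; _∧_; _∨_; not; if_then_else_)
open import Data.Nat using (ℕ; zero; suc; _+_; _*_; _⊓_; _<ᵇ_; _≡ᵇ_)
open import Data.Fin using (Fin; toℕ)
open import Data.Product using (_×_; _,_; proj₁; proj₂)
open import Data.List using (List; []; _∷_; map; concatMap; filterᵇ; length; allFin; zip; foldr)
open import Data.Bool.ListAction using (any)
open import Data.Vec using (Vec; []; _∷_; toList; lookup)

-- Vertices of a 3-graph on [n] are Fin n.  A (potential) edge is an
-- increasing triple i < j < k, representing the 3-set {i,j,k}.
Triple : ℕ → Set
Triple n = Fin n × Fin n × Fin n

_=ᶠ_ : ∀ {n} → Fin n → Fin n → Bool
a =ᶠ b = toℕ a ≡ᵇ toℕ b

_<ᶠ_ : ∀ {n} → Fin n → Fin n → Bool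
a <ᶠ b = toℕ a <ᵇ toℕ b

triples : (n : ℕ) → List (Triple n)
triples n =
  concatMap (λ i → concatMap (λ j → map (λ k → (i , j , k))
    (filterᵇ (λ k → j <ᶠ k) (allFin n)))
    (filterᵇ (λ j → i <ᶠ j) (allFin n))) (allFin n)

-- A 3-graph on [n] = a subset of binom([n],3), given by its characteristic
-- vector indexed by the list `triples n`.  Distinct 3-graphs correspond
-- exactly to distinct vectors.
Graph3 : ℕ → Set
Graph3 n = Vec Bool (length (triples n))

edges : ∀ {n} → Graph3 n → List (Triple n)
edges {n} H = map proj₁ (filterᵇ proj₂ (zip (triples n) (toList H)))

distinct3 : ∀ {n} → Fin n → Fin n → Fin n → Bool
distinct3 a b c = not (a =ᶠ b) ∧ not (a =ᶠ c) ∧ not (b =ᶠ c)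

inTriple : ∀ {n} → Fin n → Triple n → Bool
inTriple x (i , j , k) = (x =ᶠ i) ∨ (x =ᶠ j) ∨ (x =ᶠ k)

hasEdge : ∀ {n} → Graph3 n → Fin n → Fin n → Fin n → Bool
hasEdge {n} H a b c =
  distinct3 a b c ∧ any (λ t → inTriple a t ∧ inTriple b t ∧ inTriple c t) (edges {n} H)

containsT5 : ∀ {n} → Graph3 n → Bool
containsT5 {n} H =
  any (λ v1 → any (λ v2 → any (λ v3 → any (λ v4 → any (λ v5 →
      distinct3 v1 v2 v3 ∧ distinct3 v1 v4 v5 ∧ distinct3 v2 v4 v5
      ∧ not (v3 =ᶠ v4) ∧ not (v3 =ᶠ v5)
      ∧ hasEdge {n} H v1 v2 v3 ∧ hasEdge {n} H v1 v2 v4 ∧ hasEdge {n} H v1 v2 v5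
      ∧ hasEdge {n} H v3 v4 v5)
    (allFin n)) (allFin n)) (allFin n)) (allFin n)) (allFin n)

allVecs : (m : ℕ) → List (Vec Bool m)
allVecs zero = [] ∷ []
allVecs (suc m) = concatMap (λ v → (false ∷ v) ∷ (true ∷ v) ∷ []) (allVecs m)

-- An ordered partition (X,Y) of [n] is given by the characteristic vector
-- of X (Y is its complement).
count2 : Bool → Bool → Bool → ℕ
count2 x y z = (if x then 1 else 0) + (if y then 1 else 0) + (if z then 1 else 0)

consistent : ∀ {n} → Vec Bool n → Triple n → Bool
consistent X (i , j , k) = count2 (lookup X i) (lookup X j) (lookup X k) ≡ᵇ 2

inconsistentCount : ∀ {n} → Graph3 n → Vec Bool n → ℕ
inconsistentCount {n} H X = length (filterᵇ (λ e → not (consistent X e)) (edges {n} H))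

-- D_H = min over all ordered partitions of the number of inconsistent edges.
-- (The fold starts at |H|, which is an upper bound for every term, so this is
-- exactly the minimum.)
D : ∀ {n} → Graph3 n → ℕ
D {n} H = foldr (λ X m → inconsistentCount {n} H X ⊓ m) (length (edges {n} H)) (allVecs n)

-- |Forb(n,T5) \ Forb(n,T5,η)| with η = a/b:  T5-free H with D_H > (a/b) n^3,
-- i.e. not (b * D_H ≤ a * n^3).
badCount : (n a b : ℕ) → ℕ
badCount n a b = length (filterᵇ
  (λ H → not (containsT5 {n} H) ∧ (a * (n * n * n) <ᵇ b * D {n} H))
  (allVecs (length (triples n))))

{-# OPTIONS --safe #-}
module Submission where

-- Containers combined with stability.
--
-- Stability: let C have few copies of T₅.  Deleting vertices of low degree
-- leaves a vertex set W with minimum degree about 4|W|²/9 (in ordered pairs).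
-- Let I = N(p) for a pair p of maximum codegree among the pairs that lie in few
-- copies of T₅.  Then I spans few edges and almost all codegrees are at most
-- |I|; a flag-algebra style inequality on five 2-coloured vertices shows that
-- almost every edge has exactly two vertices in I.  By AM-GM, C has at most
-- 2n³/27 + o(n³) edges, and near equality it is almost consistent with (I , Iᶜ).
--
-- Containers: let H ⊆ C be T₅-free while C has many copies of T₅.  In a copy of
-- T₅ require the four edges, one after the other, to lie in H instead of C: the
-- number of copies drops from εn⁵ to 0, hence by a large factor in some step.
-- Averaging over the two vertices u, v outside the edge changed in that step,
-- the set A of the edges of C which complete a copy at u, v has at least n³/G
-- elements while H ∩ A is tiny compared with A.  As A depends only on C and the
-- O(n²) edges of H at u or v, recording these and H ∩ A replaces C by
-- (C ∖ A) ∪ (H ∩ A) at a cost of few bits compared with |A|.  Iterating, all H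
-- are covered by 2^(small n³) sets C with few copies of T₅.

-- T₅ has the edges 123, 124, 125, 345, so a 3-graph is T₅-free exactly when every pair has an
-- independent neighbourhood. This makes N(p) the natural candidate for the class X, and the
-- maximality of p bounds the other codegrees by |I|. In the extremal example |X| = 2n/3; pairs
-- between X and Y have codegree about 2n/3, pairs inside X only n/3. All counts run over ordered
-- tuples: an edge counts six times, and 2n³/27 edges become 4n³/9. Copies of T₅ are counted, never
-- removed; defects in degree and codegree travel as explicit error terms with denominators cleared,
-- which keeps everything in ℕ. Deleting vertices calls for a density bound on subsets, so the
-- argument runs twice: once for that bound, once for the structure. The containers are never
-- listed. A recursion bounds the number of bad H inside C by 2^(L + |C|/Q), and each step pays for
-- its record by the drop of |C|/Q. A set C with few copies of T₅ contains a bad H only if its size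
-- misses 2n³/27 by a fixed proportion; this is the source of ν.

open import Defs
open import Agda.Builtin.Strict using (primForce; primForceLemma)
open import Data.Bool using (Bool; true; false; _∧_; _∨_; not; T)
open import Data.Bool.ListAction using (any)
open import Data.Empty using (⊥; ⊥-elim)
open import Data.Fin using (Fin; toℕ)
open import Data.Fin.Properties using (toℕ-injective)
open import Data.List using (List; []; _∷_; _++_; map; concatMap; filterᵇ; length; allFin; cartesianProduct; foldr; zip)
open import Data.List.Membership.Propositional using (_∈_; find)
open import Data.List.Membership.Propositional.Properties using (∈-allFin; ∈-cartesianProduct⁺; ∈-concatMap⁺; ∈-concatMap⁻; ∈-map⁻)
open import Data.List.Properties using (length-tabulate; map-tabulate)
open import Data.List.Relation.Unary.Any as Any using (here; there)
open import Data.Nat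
open import Data.Nat.DivMod
open import Data.Nat.Divisibility using (n∣m*n)
open import Data.Nat.Properties
open import Data.Nat.Tactic.RingSolver using (solve-∀)
open import Data.Product using (Σ; _×_; _,_; proj₁; proj₂)
open import Data.Sum using (_⊎_; inj₁; inj₂)
open import Data.Vec using (Vec; []; _∷_; tabulate; toList; zipWith)
open import Data.Vec.Properties using (lookup∘tabulate)
open import Function using (id)
open import Relation.Binary using (tri<; tri≈; tri>)
open import Relation.Binary.PropositionalEquality
open import Relation.Nullary using (¬_; Dec; yes; no; _×-dec_)

-- Finite sums

𝟙 : Bool → ℕ
𝟙 true  = 1
𝟙 false = 0

𝟙≤1 : ∀ b → 𝟙 b ≤ 1
𝟙≤1 true  = ≤-refl
𝟙≤1 false = z≤n

𝟙-∧ : ∀ a b → 𝟙 (a ∧ b) ≡ 𝟙 a * 𝟙 b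
𝟙-∧ true  b = sym (+-identityʳ (𝟙 b))
𝟙-∧ false b = refl

module _ {a} {A : Set a} where

  ∑ : List A → (A → ℕ) → ℕ
  ∑ []       f = 0
  ∑ (x ∷ xs) f = f x + ∑ xs f

  ∑-cong : ∀ xs {f g : A → ℕ} → (∀ x → f x ≡ g x) → ∑ xs f ≡ ∑ xs g
  ∑-cong []       e = refl
  ∑-cong (x ∷ xs) e = cong₂ _+_ (e x) (∑-cong xs e)

  ∑-mono∈ : ∀ xs {f g : A → ℕ} → (∀ x → x ∈ xs → f x ≤ g x) → ∑ xs f ≤ ∑ xs g
  ∑-mono∈ []       e = z≤n
  ∑-mono∈ (x ∷ xs) e = +-mono-≤ (e x (here refl)) (∑-mono∈ xs λ y i → e y (there i))

  ∑-mono : ∀ xs {f g : A → ℕ} → (∀ x → f x ≤ g x) → ∑ xs f ≤ ∑ xs g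
  ∑-mono xs e = ∑-mono∈ xs λ x _ → e x

  ∑-+ : ∀ xs (f g : A → ℕ) → ∑ xs (λ x → f x + g x) ≡ ∑ xs f + ∑ xs g
  ∑-+ []       f g = refl
  ∑-+ (x ∷ xs) f g = trans (cong (f x + g x +_) (∑-+ xs f g)) (lem (f x) (g x) (∑ xs f) (∑ xs g))
    where
    lem : ∀ a b c d → a + b + (c + d) ≡ a + c + (b + d)
    lem = solve-∀

  ∑-*ˡ : ∀ xs c (f : A → ℕ) → ∑ xs (λ x → c * f x) ≡ c * ∑ xs f
  ∑-*ˡ []       c f = sym (*-zeroʳ c)
  ∑-*ˡ (x ∷ xs) c f = trans (cong (c * f x +_) (∑-*ˡ xs c f)) (sym (*-distribˡ-+ c (f x) (∑ xs f)))

  ∑-*ʳ : ∀ xs c (f : A → ℕ) → ∑ xs (λ x → f x * c) ≡ ∑ xs f * c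
  ∑-*ʳ xs c f = trans (∑-cong xs λ x → *-comm (f x) c) (trans (∑-*ˡ xs c f) (*-comm c (∑ xs f)))

  ∑-const : ∀ xs c → ∑ xs (λ _ → c) ≡ length xs * c
  ∑-const []       c = refl
  ∑-const (x ∷ xs) c = cong (c +_) (∑-const xs c)

  ∑-zero : ∀ xs → ∑ xs (λ _ → 0) ≡ 0
  ∑-zero xs = trans (∑-const xs 0) (*-zeroʳ (length xs))

  ∑-≤const : ∀ xs {f : A → ℕ} c → (∀ x → f x ≤ c) → ∑ xs f ≤ length xs * c
  ∑-≤const xs c e = ≤-trans (∑-mono xs e) (≤-reflexive (∑-const xs c))

  ∑-++ : ∀ xs ys (f : A → ℕ) → ∑ (xs ++ ys) f ≡ ∑ xs f + ∑ ys f
  ∑-++ []       ys f = refl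
  ∑-++ (x ∷ xs) ys f = trans (cong (f x +_) (∑-++ xs ys f)) (sym (+-assoc (f x) (∑ xs f) (∑ ys f)))

  ∑-filter : ∀ xs p (f : A → ℕ) → ∑ (filterᵇ p xs) f ≡ ∑ xs (λ x → 𝟙 (p x) * f x)
  ∑-filter []       p f = refl
  ∑-filter (x ∷ xs) p f with p x
  ... | true  = cong₂ _+_ (sym (+-identityʳ (f x))) (∑-filter xs p f)
  ... | false = ∑-filter xs p f

  ∑-∈ : ∀ {xs} {x} (f : A → ℕ) → x ∈ xs → f x ≤ ∑ xs f
  ∑-∈ {x ∷ xs} f (here refl) = m≤m+n (f x) (∑ xs f)
  ∑-∈ {y ∷ xs} f (there i)   = ≤-trans (∑-∈ f i) (m≤n+m (∑ xs f) (f y))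

  length-∑ : ∀ (xs : List A) → length xs ≡ ∑ xs (λ _ → 1)
  length-∑ xs = trans (sym (*-identityʳ (length xs))) (sym (∑-const xs 1))

module _ {a b} {A : Set a} {B : Set b} where

  ∑-map : ∀ xs (g : A → B) (f : B → ℕ) → ∑ (map g xs) f ≡ ∑ xs (λ x → f (g x))
  ∑-map []       g f = refl
  ∑-map (x ∷ xs) g f = cong (f (g x) +_) (∑-map xs g f)

  ∑-concatMap : ∀ xs (g : A → List B) (f : B → ℕ) → ∑ (concatMap g xs) f ≡ ∑ xs (λ x → ∑ (g x) f)
  ∑-concatMap []       g f = refl
  ∑-concatMap (x ∷ xs) g f = trans (∑-++ (g x) (concatMap g xs) f) (cong (∑ (g x) f +_) (∑-concatMap xs g f))

  ∑-swap : ∀ xs ys (f : A → B → ℕ) → ∑ xs (λ x → ∑ ys (f x)) ≡ ∑ ys (λ y → ∑ xs (λ x → f x y))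
  ∑-swap []       ys f = sym (∑-zero ys)
  ∑-swap (x ∷ xs) ys f = trans (cong (∑ ys (f x) +_) (∑-swap xs ys f)) (sym (∑-+ ys (f x) _))

∑-* : ∀ {a b} {A : Set a} {B : Set b} xs ys (f : A → ℕ) (g : B → ℕ) →
  ∑ xs f * ∑ ys g ≡ ∑ xs (λ x → ∑ ys (λ y → f x * g y))
∑-* xs ys f g = trans (sym (∑-*ʳ xs (∑ ys g) f)) (∑-cong xs λ x → sym (∑-*ˡ ys (f x) g))

-- The five-vertex certificate

Conf : Set
Conf = Vec Bool 15

pattern conf a b c d e abc abd abe acd ace ade bcd bce bde cde =
  a ∷ b ∷ c ∷ d ∷ e ∷ abc ∷ abd ∷ abe ∷ acd ∷ ace ∷ ade ∷ bcd ∷ bce ∷ bde ∷ cde ∷ []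

-- The multipliers below were found by linear programming. With I the colour
-- class `true`, they combine the inequalities Σ codW · (|I| − d(a,b)) ≥ 0 and
-- Σ degW · (9 deg(a) − 4n²) ≥ 0 with the squares given by sqF and linkF, where
-- d(a,b) is a codegree and a pair (p , q) stands for the coefficient p − q.
codW : (a b c d abc abd acd bcd : Bool) → ℕ
codW false false false false false false true  true  = 8
codW false false false false true  false true  true  = 16
codW false false false false true  true  true  true  = 7
codW true  false false false false false true  false = 397
codW true  false false false true  false true  false = 515
codW true  false false false true  true  true  false = 196
codW false false true  false true  false true  false = 286
codW true  false true  false true  false false false = 336
codW true  false true  false true  false true  false = 452
codW true  false true  false true  true  false false = 242
codW true  false true  false true  true  true  false = 113
codW true  false true  false false false false true  = 359
codW true  false true  false true  false false true  = 568
codW true  false true  false false true  false true  = 227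
codW true  false true  false true  true  false true  = 323
codW false false true  true  false false true  false = 31
codW false false true  true  true  false true  false = 709
codW false false true  true  true  false true  true  = 273
codW true  true  true  false false false true  false = 78
codW true  false true  true  false false false false = 100
codW true  false true  true  true  false false false = 393
codW true  false true  true  true  true  false false = 99
codW true  false true  true  false false false true  = 476
codW true  false true  true  true  false false true  = 1384
codW true  false true  true  true  true  false true  = 458
codW _     _     _     _     _     _     _     _     = 0

degW : (a b c abc : Bool) → ℕ
degW true  true  true  false = 40
degW false true  true  true  = 40
degW false false false true  = 1
degW true  false false true  = 39
degW true  true  false false = 54
degW _     _     _     _     = 0

sqW : (a b c abc : Bool) → ℕ
sqW true true  false false = 29
sqW true true  false true  = 40
sqW true false false true  = 428
sqW _    _     _     _     = 0

sqF : (b abc : Bool) (d abd acd bcd : Bool) → ℕ × ℕ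
sqF true  false false false false true  = 0 , 1
sqF true  false false false true  false = 0 , 1
sqF true  false true  false false false = 0 , 2
sqF true  false true  false true  true  = 2 , 0
sqF true  true  false false false false = 1 , 0
sqF true  true  false false true  true  = 1 , 0
sqF true  true  false true  false false = 0 , 2
sqF true  true  true  false false true  = 1 , 0
sqF true  true  true  false true  false = 1 , 0
sqF true  true  true  false true  true  = 1 , 0
sqF false true  true  false true  false = 0 , 1
sqF false true  true  true  false false = 1 , 0
sqF _     _     _     _     _     _     = 0 , 0

linkF : (b c abc : Bool) → ℕ × ℕ
linkF true  true  false = 2 , 0
linkF true  false false = 1 , 0
linkF false true  false = 1 , 0
linkF true  false true  = 0 , 2
linkF false true  true  = 0 , 2
linkF _     _     _     = 0 , 0

-- With pairs read as differences, (p - q)(p′ - q′) is `dot` minus `cross`; that a square is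
-- nonnegative then says that `cross` totals at most `dot`.
dot cross : ℕ × ℕ → ℕ × ℕ → ℕ
dot   (p , q) (p′ , q′) = p * p′ + q * q′
cross (p , q) (p′ , q′) = p * q′ + q * p′

minority : Bool → Bool → Bool → Bool
minority true  true  c = false
minority true  false c = not c
minority false true  c = not c
minority false false c = true

-- Matching L and R weights become the two sides of one inequality after summation over the free
-- vertices: `𝟙 e` sums to |I| and `𝟙 abe` to the codegree of a, b; `9 * 𝟙 ade` sums to nine times
-- the degree of a, and `4` to 4n². The squares in `sq` are indexed by d for fixed a, b, c, those in
-- `link` by pairs for fixed a.
codL codR degL degR sqL sqR linkL linkR t5C iiiC badC : Conf → ℕ
codL (conf a b c d e abc abd abe acd ace ade bcd bce bde cde) = codW a b c d abc abd acd bcd * 𝟙 e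
codR (conf a b c d e abc abd abe acd ace ade bcd bce bde cde) = codW a b c d abc abd acd bcd * 𝟙 abe
degL (conf a b c d e abc abd abe acd ace ade bcd bce bde cde) = degW a b c abc * (9 * 𝟙 ade)
degR (conf a b c d e abc abd abe acd ace ade bcd bce bde cde) = degW a b c abc * 4
sqL  (conf a b c d e abc abd abe acd ace ade bcd bce bde cde) =
  sqW a b c abc * dot (sqF b abc d abd acd bcd) (sqF b abc e abe ace bce)
sqR  (conf a b c d e abc abd abe acd ace ade bcd bce bde cde) =
  sqW a b c abc * cross (sqF b abc d abd acd bcd) (sqF b abc e abe ace bce)
linkL (conf a b c d e abc abd abe acd ace ade bcd bce bde cde) = 𝟙 a * 40 * dot (linkF b c abc) (linkF d e ade)
linkR (conf a b c d e abc abd abe acd ace ade bcd bce bde cde) = 𝟙 a * 40 * cross (linkF b c abc) (linkF d e ade)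
t5C  (conf a b c d e abc abd abe acd ace ade bcd bce bde cde) = 𝟙 abc * 𝟙 abd * 𝟙 abe * 𝟙 cde
iiiC (conf a b c d e abc abd abe acd ace ade bcd bce bde cde) = 𝟙 abc * 𝟙 (a ∧ b ∧ c)
badC (conf a b c d e abc abd abe acd ace ade bcd bce bde cde) = 𝟙 abc * 𝟙 (minority a b c)

opaque
  -- A configuration with a copy of T₅ or an edge inside the colour class pays `penalty` in at least
  -- 12 of its 120 orderings, and 12 · 10⁶ exceeds 120 times the maximum of `large`; the other
  -- configurations carry the real content. `opaque` keeps the numerals from unfolding in later
  -- conversion checks.
  scale penalty : ℕ
  scale   = 20
  penalty = 1000000

large small : Conf → ℕ
large v = badC v + scale * (codL v + (degL v + (sqL v + linkL v)))
small v = penalty * (t5C v + iiiC v) + scale * (codR v + (degR v + (sqR v + linkR v)))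

data Tree : ℕ → Set where
  leaf : ℕ → Tree 0
  node : ∀ {n} → Tree n → Tree n → Tree (suc n)

opaque
  tab : ∀ {n} → (Vec Bool n → ℕ) → Tree n
  tab {zero}  f = leaf (f [])
  tab {suc n} f = node (tab (λ v → f (false ∷ v))) (tab (λ v → f (true ∷ v)))

look : ∀ {n} → Tree n → Vec Bool n → ℕ
look (leaf x)   []          = x
look (node l r) (false ∷ v) = look l v
look (node l r) (true ∷ v)  = look r v

opaque
  unfolding tab
  look-tab : ∀ {n} (f : Vec Bool n → ℕ) v → look (tab f) v ≡ f v
  look-tab f []          = refl
  look-tab f (false ∷ v) = look-tab (λ v → f (false ∷ v)) v
  look-tab f (true ∷ v)  = look-tab (λ v → f (true ∷ v)) v

_≤ᵗ_ : ∀ {n} → Tree n → Tree n → Bool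
leaf x   ≤ᵗ leaf y     = x ≤ᵇ y
node l r ≤ᵗ node l′ r′ = (l ≤ᵗ l′) ∧ (r ≤ᵗ r′)

∧-true : ∀ {a b} → a ∧ b ≡ true → a ≡ true × b ≡ true
∧-true {true} {true} refl = refl , refl

≤ᵗ-look : ∀ {n} (s t : Tree n) → s ≤ᵗ t ≡ true → ∀ v → look s v ≤ look t v
≤ᵗ-look (leaf x)   (leaf y)     e []          = ≤ᵇ⇒≤ x y (subst T (sym e) _)
≤ᵗ-look (node l r) (node l′ r′) e (false ∷ v) = ≤ᵗ-look l l′ (proj₁ (∧-true e)) v
≤ᵗ-look (node l r) (node l′ r′) e (true ∷ v)  = ≤ᵗ-look r r′ (proj₂ (∧-true {l ≤ᵗ l′} e)) v

s₁ s₂ s₃ s₄ : Conf → Conf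
s₁ (conf a b c d e abc abd abe acd ace ade bcd bce bde cde) = conf b a c d e abc abd abe bcd bce bde acd ace ade cde
s₂ (conf a b c d e abc abd abe acd ace ade bcd bce bde cde) = conf a c b d e abc acd ace abd abe ade bcd bce cde bde
s₃ (conf a b c d e abc abd abe acd ace ade bcd bce bde cde) = conf a b d c e abd abc abe acd ade ace bcd bde bce cde
s₄ (conf a b c d e abc abd abe acd ace ade bcd bce bde cde) = conf a b c e d abc abe abd ace acd ade bce bcd bde cde

-- The symmetric group S₅ is the product of the coset representatives
-- {1,s₁}·{1,s₂,s₂s₁}·{1,s₃,s₃s₂,s₃s₂s₁}·…, so averaging over it takes four
-- stages; tabulating after each stage keeps the computation linear in 2¹⁵.
sym₁ sym₂ sym₃ sym₄ : (Conf → ℕ) → Conf → ℕ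
sym₁ f v = f v + f (s₁ v)
sym₂ f v = f v + (f (s₂ v) + f (s₂ (s₁ v)))
sym₃ f v = f v + (f (s₃ v) + (f (s₃ (s₂ v)) + f (s₃ (s₂ (s₁ v)))))
sym₄ f v = f v + (f (s₄ v) + (f (s₄ (s₃ v)) + (f (s₄ (s₃ (s₂ v))) + f (s₄ (s₃ (s₂ (s₁ v)))))))

-- Forces every entry before the next stage reads the table.
opaque
  withTable : ∀ {n} {B : Set} → Tree n → (Tree n → B) → B
  withTable (leaf x)   k = primForce x λ y → k (leaf y)
  withTable (node l r) k = withTable l λ l′ → withTable r λ r′ → k (node l′ r′)

  withTable-≡ : ∀ {n} {B : Set} (t : Tree n) (k : Tree n → B) → withTable t k ≡ k t
  withTable-≡ (leaf x)   k = primForceLemma x (λ y → k (leaf y))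
  withTable-≡ (node l r) k = trans (withTable-≡ l _) (withTable-≡ r _)

opaque
  stage : ((Conf → ℕ) → Conf → ℕ) → Tree 15 → Tree 15
  stage s t = tab (s (look t))

  look-stage : ∀ s t v → look (stage s t) v ≡ s (look t) v
  look-stage s t v = look-tab (s (look t)) v

symᵗ : Tree 15 → Tree 15
symᵗ t = stage sym₄ (stage sym₃ (stage sym₂ (stage sym₁ t)))

withSym : {B : Set} → (Conf → ℕ) → (Tree 15 → B) → B
withSym f k = withTable (tab f) λ t₀ → withTable (stage sym₁ t₀) λ t₁ → withTable (stage sym₂ t₁) λ t₂ →
  withTable (stage sym₃ t₂) λ t₃ → withTable (stage sym₄ t₃) k

withSym-≡ : ∀ {B : Set} f (k : Tree 15 → B) → withSym f k ≡ k (symᵗ (tab f))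
withSym-≡ f k = trans (withTable-≡ (tab f) _) (trans (withTable-≡ (stage sym₁ (tab f)) _)
  (trans (withTable-≡ (stage sym₂ (stage sym₁ (tab f))) _)
  (trans (withTable-≡ (stage sym₃ (stage sym₂ (stage sym₁ (tab f)))) _) (withTable-≡ (symᵗ (tab f)) k))))

symmetrise : (Conf → ℕ) → Conf → ℕ
symmetrise f = sym₄ (sym₃ (sym₂ (sym₁ f)))

opaque
  unfolding tab withTable stage scale
  -- The type checker computes both symmetrised tables on all 2¹⁵ configurations and compares them
  -- here; outside such blocks the tables stay sealed.
  evaluation : withSym large (λ s → withSym small λ t → s ≤ᵗ t) ≡ true
  evaluation = refl

certificate : symᵗ (tab large) ≤ᵗ symᵗ (tab small) ≡ true
certificate = trans (sym (trans (withSym-≡ large _) (withSym-≡ small _))) evaluation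

sym₁-cong : ∀ {f g} → (∀ v → f v ≡ g v) → ∀ v → sym₁ f v ≡ sym₁ g v
sym₁-cong e v = cong₂ _+_ (e _) (e _)
sym₂-cong : ∀ {f g} → (∀ v → f v ≡ g v) → ∀ v → sym₂ f v ≡ sym₂ g v
sym₂-cong e v = cong₂ _+_ (e _) (cong₂ _+_ (e _) (e _))
sym₃-cong : ∀ {f g} → (∀ v → f v ≡ g v) → ∀ v → sym₃ f v ≡ sym₃ g v
sym₃-cong e v = cong₂ _+_ (e _) (cong₂ _+_ (e _) (cong₂ _+_ (e _) (e _)))
sym₄-cong : ∀ {f g} → (∀ v → f v ≡ g v) → ∀ v → sym₄ f v ≡ sym₄ g v
sym₄-cong e v = cong₂ _+_ (e _) (cong₂ _+_ (e _) (cong₂ _+_ (e _) (cong₂ _+_ (e _) (e _))))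

look-symᵗ : ∀ f v → look (symᵗ (tab f)) v ≡ symmetrise f v
look-symᵗ f v = trans (look-stage sym₄ _ v) (sym₄-cong (λ v → trans (look-stage sym₃ _ v)
  (sym₃-cong (λ v → trans (look-stage sym₂ _ v) (sym₂-cong (λ v → trans (look-stage sym₁ _ v)
  (sym₁-cong (look-tab f) v)) v)) v)) v)

symmetrise-≤ : ∀ v → symmetrise large v ≤ symmetrise small v
symmetrise-≤ v = subst₂ _≤_ (look-symᵗ large v) (look-symᵗ small v)
  (≤ᵗ-look (symᵗ (tab large)) (symᵗ (tab small)) certificate v)

opaque
  unfolding tab

  codMax degMax : ℕ
  codMax = 1384
  degMax = 54

  -- Checked by evaluating a table of all 256 arguments, in place of a long case split along the
  -- overlapping clauses of `codW`.
  codW≤ : ∀ a b c d e f g k → codW a b c d e f g k ≤ codMax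
  codW≤ a b c d e f g k = subst (_≤ 1384) (look-tab F v)
    (≤-trans (≤ᵗ-look (tab F) (tab (λ _ → 1384)) refl v) (≤-reflexive (look-tab (λ _ → 1384) v)))
    where
    F : Vec Bool 8 → ℕ
    F (a ∷ b ∷ c ∷ d ∷ e ∷ f ∷ g ∷ k ∷ []) = codW a b c d e f g k
    v : Vec Bool 8
    v = a ∷ b ∷ c ∷ d ∷ e ∷ f ∷ g ∷ k ∷ []

  degW≤ : ∀ a b c d → degW a b c d ≤ degMax
  degW≤ a b c d = subst (_≤ 54) (look-tab F v)
    (≤-trans (≤ᵗ-look (tab F) (tab (λ _ → 54)) refl v) (≤-reflexive (look-tab (λ _ → 54) v)))
    where
    F : Vec Bool 4 → ℕ
    F (a ∷ b ∷ c ∷ d ∷ []) = degW a b c d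
    v : Vec Bool 4
    v = a ∷ b ∷ c ∷ d ∷ []

2pq≤p²+q² : ∀ p q → p * q + q * p ≤ p * p + q * q
2pq≤p²+q² p q with ≤-total p q
... | inj₁ p≤q = subst (λ q → p * q + q * p ≤ p * p + q * q) (m+[n∸m]≡n p≤q) (lem p (q ∸ p))
  where
  eq : ∀ p k → p * p + (p + k) * (p + k) ≡ p * (p + k) + (p + k) * p + k * k
  eq = solve-∀
  lem : ∀ p k → p * (p + k) + (p + k) * p ≤ p * p + (p + k) * (p + k)
  lem p k = ≤-trans (m≤m+n _ (k * k)) (≤-reflexive (sym (eq p k)))
... | inj₂ q≤p = subst (λ p → p * q + q * p ≤ p * p + q * q) (m+[n∸m]≡n q≤p) (lem q (p ∸ q))
  where
  eq : ∀ q k → (q + k) * (q + k) + q * q ≡ (q + k) * q + q * (q + k) + k * k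
  eq = solve-∀
  lem : ∀ q k → (q + k) * q + q * (q + k) ≤ (q + k) * (q + k) + q * q
  lem q k = ≤-trans (m≤m+n _ (k * k)) (≤-reflexive (sym (eq q k)))

-- Iterated sums and nonnegativity of squares

module _ {a} {A : Set a} where

  ∑² : List A → (A → A → ℕ) → ℕ
  ∑² xs f = ∑ xs λ a → ∑ xs (f a)

  ∑³ : List A → (A → A → A → ℕ) → ℕ
  ∑³ xs f = ∑ xs λ a → ∑² xs (f a)

  ∑⁴ : List A → (A → A → A → A → ℕ) → ℕ
  ∑⁴ xs f = ∑ xs λ a → ∑³ xs (f a)

  ∑⁵ : List A → (A → A → A → A → A → ℕ) → ℕ
  ∑⁵ xs f = ∑ xs λ a → ∑⁴ xs (f a)

  ∑²-mono∈ : ∀ xs {f g : A → A → ℕ} → (∀ a b → a ∈ xs → b ∈ xs → f a b ≤ g a b) → ∑² xs f ≤ ∑² xs g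
  ∑²-mono∈ xs e = ∑-mono∈ xs λ a i → ∑-mono∈ xs λ b j → e a b i j

  ∑²-mono : ∀ xs {f g : A → A → ℕ} → (∀ a b → f a b ≤ g a b) → ∑² xs f ≤ ∑² xs g
  ∑²-mono xs e = ∑-mono xs λ a → ∑-mono xs (e a)

  ∑³-mono : ∀ xs {f g : A → A → A → ℕ} → (∀ a b c → f a b c ≤ g a b c) → ∑³ xs f ≤ ∑³ xs g
  ∑³-mono xs e = ∑-mono xs λ a → ∑²-mono xs (e a)

  ∑⁴-mono : ∀ xs {f g : A → A → A → A → ℕ} → (∀ a b c d → f a b c d ≤ g a b c d) → ∑⁴ xs f ≤ ∑⁴ xs g
  ∑⁴-mono xs e = ∑-mono xs λ a → ∑³-mono xs (e a)

  ∑⁵-mono : ∀ xs {f g : A → A → A → A → A → ℕ} → (∀ a b c d e → f a b c d e ≤ g a b c d e) → ∑⁵ xs f ≤ ∑⁵ xs g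
  ∑⁵-mono xs e = ∑-mono xs λ a → ∑⁴-mono xs (e a)

  ∑²-cong : ∀ xs {f g : A → A → ℕ} → (∀ a b → f a b ≡ g a b) → ∑² xs f ≡ ∑² xs g
  ∑²-cong xs e = ∑-cong xs λ a → ∑-cong xs (e a)

  ∑³-cong : ∀ xs {f g : A → A → A → ℕ} → (∀ a b c → f a b c ≡ g a b c) → ∑³ xs f ≡ ∑³ xs g
  ∑³-cong xs e = ∑-cong xs λ a → ∑²-cong xs (e a)

  ∑⁵-cong : ∀ xs {f g : A → A → A → A → A → ℕ} → (∀ a b c d e → f a b c d e ≡ g a b c d e) → ∑⁵ xs f ≡ ∑⁵ xs g
  ∑⁵-cong xs e = ∑-cong xs λ a → ∑-cong xs λ b → ∑³-cong xs (e a b)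

  ∑²-+ : ∀ xs (f g : A → A → ℕ) → ∑² xs (λ a b → f a b + g a b) ≡ ∑² xs f + ∑² xs g
  ∑²-+ xs f g = trans (∑-cong xs λ a → ∑-+ xs (f a) (g a)) (∑-+ xs _ _)

  ∑³-+ : ∀ xs (f g : A → A → A → ℕ) → ∑³ xs (λ a b c → f a b c + g a b c) ≡ ∑³ xs f + ∑³ xs g
  ∑³-+ xs f g = trans (∑-cong xs λ a → ∑²-+ xs (f a) (g a)) (∑-+ xs _ _)

  ∑⁴-+ : ∀ xs (f g : A → A → A → A → ℕ) → ∑⁴ xs (λ a b c d → f a b c d + g a b c d) ≡ ∑⁴ xs f + ∑⁴ xs g
  ∑⁴-+ xs f g = trans (∑-cong xs λ a → ∑³-+ xs (f a) (g a)) (∑-+ xs _ _)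

  ∑⁵-+ : ∀ xs (f g : A → A → A → A → A → ℕ) →
    ∑⁵ xs (λ a b c d e → f a b c d e + g a b c d e) ≡ ∑⁵ xs f + ∑⁵ xs g
  ∑⁵-+ xs f g = trans (∑-cong xs λ a → ∑⁴-+ xs (f a) (g a)) (∑-+ xs _ _)

  ∑²-*ˡ : ∀ xs k (f : A → A → ℕ) → ∑² xs (λ a b → k * f a b) ≡ k * ∑² xs f
  ∑²-*ˡ xs k f = trans (∑-cong xs λ a → ∑-*ˡ xs k (f a)) (∑-*ˡ xs k _)

  ∑³-*ˡ : ∀ xs k (f : A → A → A → ℕ) → ∑³ xs (λ a b c → k * f a b c) ≡ k * ∑³ xs f
  ∑³-*ˡ xs k f = trans (∑-cong xs λ a → ∑²-*ˡ xs k (f a)) (∑-*ˡ xs k _)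

  ∑⁴-*ˡ : ∀ xs k (f : A → A → A → A → ℕ) → ∑⁴ xs (λ a b c d → k * f a b c d) ≡ k * ∑⁴ xs f
  ∑⁴-*ˡ xs k f = trans (∑-cong xs λ a → ∑³-*ˡ xs k (f a)) (∑-*ˡ xs k _)

  ∑⁵-*ˡ : ∀ xs k (f : A → A → A → A → A → ℕ) → ∑⁵ xs (λ a b c d e → k * f a b c d e) ≡ k * ∑⁵ xs f
  ∑⁵-*ˡ xs k f = trans (∑-cong xs λ a → ∑⁴-*ˡ xs k (f a)) (∑-*ˡ xs k _)

  ∑²-const : ∀ xs k → ∑² xs (λ _ _ → k) ≡ length xs * length xs * k
  ∑²-const xs k = trans (∑-cong xs λ _ → ∑-const xs k) (trans (∑-const xs _) (sym (*-assoc (length xs) _ k)))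

  ∑³-const : ∀ xs k → ∑³ xs (λ _ _ _ → k) ≡ length xs * length xs * length xs * k
  ∑³-const xs k = trans (∑-cong xs λ _ → ∑²-const xs k) (trans (∑-const xs _) (lem (length xs) k))
    where
    lem : ∀ n k → n * (n * n * k) ≡ n * n * n * k
    lem = solve-∀

∑³-product : ∀ {A : Set} xs (f g k : A → ℕ) → ∑³ xs (λ a b c → f a * (g b * k c)) ≡ ∑ xs f * (∑ xs g * ∑ xs k)
∑³-product xs f g k = trans (∑-cong xs λ a → trans (∑²-*ˡ xs (f a) _) (cong (f a *_) (sym (∑-* xs xs g k)))) (∑-*ʳ xs _ f)

-- Squares of integer linear forms P − Q are expanded with both sides moved so
-- that no subtraction occurs.
module _ {a} {A : Set a} (F : A → ℕ × ℕ) where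

  private
    p q : A → ℕ
    p x = proj₁ (F x)
    q x = proj₂ (F x)

  square-≥0 : ∀ xs → ∑ xs (λ x → ∑ xs λ y → cross (F x) (F y)) ≤ ∑ xs (λ x → ∑ xs λ y → dot (F x) (F y))
  square-≥0 xs = subst₂ _≤_ (expand q p) (expand p q) (2pq≤p²+q² (∑ xs p) (∑ xs q))
    where
    expand : ∀ u v → ∑ xs p * ∑ xs u + ∑ xs q * ∑ xs v ≡ ∑ xs (λ x → ∑ xs λ y → p x * u y + q x * v y)
    expand u v = trans (cong₂ _+_ (∑-* xs xs p u) (∑-* xs xs q v)) (sym (∑²-+ xs _ _))

∑-pairs : ∀ {a} {A : Set a} (xs : List A) (f : A × A → ℕ) →
  ∑ (concatMap (λ x → map (x ,_) xs) xs) f ≡ ∑² xs (λ a b → f (a , b))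
∑-pairs xs f = trans (∑-concatMap xs _ f) (∑-cong xs λ x → ∑-map xs (x ,_) f)

conf-≡ : ∀ {a b c d e abc abd abe acd ace ade bcd bce bde cde abc′ abd′ abe′ acd′ ace′ ade′ bcd′ bce′ bde′ cde′} →
  abc ≡ abc′ → abd ≡ abd′ → abe ≡ abe′ → acd ≡ acd′ → ace ≡ ace′ → ade ≡ ade′ →
  bcd ≡ bcd′ → bce ≡ bce′ → bde ≡ bde′ → cde ≡ cde′ →
  _≡_ {A = Conf} (conf a b c d e abc abd abe acd ace ade bcd bce bde cde)
                 (conf a b c d e abc′ abd′ abe′ acd′ ace′ ade′ bcd′ bce′ bde′ cde′)
conf-≡ refl refl refl refl refl refl refl refl refl refl = refl

-- Summing the certificate over a 2-coloured 3-graph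

module Colouring {V : Set} (h : V → V → V → Bool)
  (h-swap₁ : ∀ a b c → h a b c ≡ h b a c) (h-swap₂ : ∀ a b c → h a b c ≡ h a c b)
  (x : V → Bool) (vs : List V) where

  code : V → V → V → V → V → Conf
  code a b c d e = conf (x a) (x b) (x c) (x d) (x e)
    (h a b c) (h a b d) (h a b e) (h a c d) (h a c e) (h a d e) (h b c d) (h b c e) (h b d e) (h c d e)

  total : (Conf → ℕ) → ℕ
  total f = ∑⁵ vs λ a b c d e → f (code a b c d e)

  private
    total-s₁ : ∀ f → total (λ v → f (s₁ v)) ≡ total f
    total-s₁ f = trans (∑⁵-cong vs λ a b c d e → cong f
      (conf-≡ (h-swap₁ a b c) (h-swap₁ a b d) (h-swap₁ a b e) refl refl refl refl refl refl refl)) (∑-swap vs vs _)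

    total-s₂ : ∀ f → total (λ v → f (s₂ v)) ≡ total f
    total-s₂ f = trans (∑⁵-cong vs λ a b c d e → cong f
      (conf-≡ (h-swap₂ a b c) refl refl refl refl refl (h-swap₁ b c d) (h-swap₁ b c e) refl refl))
      (∑-cong vs λ a → ∑-swap vs vs _)

    total-s₃ : ∀ f → total (λ v → f (s₃ v)) ≡ total f
    total-s₃ f = trans (∑⁵-cong vs λ a b c d e → cong f
      (conf-≡ refl refl refl (h-swap₂ a c d) refl refl (h-swap₂ b c d) refl refl (h-swap₁ c d e)))
      (∑-cong vs λ a → ∑-cong vs λ b → ∑-swap vs vs _)

    total-s₄ : ∀ f → total (λ v → f (s₄ v)) ≡ total f
    total-s₄ f = trans (∑⁵-cong vs λ a b c d e → cong f
      (conf-≡ refl refl refl refl refl (h-swap₂ a d e) refl refl (h-swap₂ b d e) (h-swap₂ c d e)))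
      (∑³-cong vs λ a b c → ∑-swap vs vs _)

  total-+ : ∀ f g → total (λ v → f v + g v) ≡ total f + total g
  total-+ f g = ∑⁵-+ vs _ _

  total-* : ∀ k f → total (λ v → k * f v) ≡ k * total f
  total-* k f = ∑⁵-*ˡ vs k _

  private
    _⊕_ : (Conf → ℕ) → (Conf → ℕ) → Conf → ℕ
    (f ⊕ g) v = f v + g v

    infixr 5 _⊕_
    infixl 9 _∘₁ _∘₂ _∘₃ _∘₄
    _∘₁ _∘₂ _∘₃ _∘₄ : (Conf → ℕ) → Conf → ℕ
    (f ∘₁) v = f (s₁ v)
    (f ∘₂) v = f (s₂ v)
    (f ∘₃) v = f (s₃ v)
    (f ∘₄) v = f (s₄ v)

    total-sym₁ : ∀ f → total (sym₁ f) ≡ 2 * total f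
    total-sym₁ f = trans (total-+ f (f ∘₁)) (cong (total f +_) (trans (total-s₁ f) (sym (+-identityʳ _))))

    total-sym₂ : ∀ f → total (sym₂ f) ≡ 3 * total f
    total-sym₂ f = trans (total-+ f (f ∘₂ ⊕ f ∘₂ ∘₁)) (cong (total f +_)
      (trans (total-+ (f ∘₂) (f ∘₂ ∘₁)) (cong₂ _+_ (total-s₂ f)
      (trans (total-s₁ (f ∘₂)) (trans (total-s₂ f) (sym (+-identityʳ _)))))))

    total-sym₃ : ∀ f → total (sym₃ f) ≡ 4 * total f
    total-sym₃ f = trans (total-+ f (f ∘₃ ⊕ (f ∘₃ ∘₂ ⊕ f ∘₃ ∘₂ ∘₁))) (cong (total f +_)
      (trans (total-+ (f ∘₃) (f ∘₃ ∘₂ ⊕ f ∘₃ ∘₂ ∘₁)) (cong₂ _+_ (total-s₃ f)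
      (trans (total-+ (f ∘₃ ∘₂) (f ∘₃ ∘₂ ∘₁)) (cong₂ _+_ (trans (total-s₂ (f ∘₃)) (total-s₃ f))
      (trans (total-s₁ (f ∘₃ ∘₂)) (trans (total-s₂ (f ∘₃)) (trans (total-s₃ f) (sym (+-identityʳ _))))))))))

    total-sym₄ : ∀ f → total (sym₄ f) ≡ 5 * total f
    total-sym₄ f = trans (total-+ f (f ∘₄ ⊕ (f ∘₄ ∘₃ ⊕ (f ∘₄ ∘₃ ∘₂ ⊕ f ∘₄ ∘₃ ∘₂ ∘₁)))) (cong (total f +_)
      (trans (total-+ (f ∘₄) (f ∘₄ ∘₃ ⊕ (f ∘₄ ∘₃ ∘₂ ⊕ f ∘₄ ∘₃ ∘₂ ∘₁))) (cong₂ _+_ (total-s₄ f)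
      (trans (total-+ (f ∘₄ ∘₃) (f ∘₄ ∘₃ ∘₂ ⊕ f ∘₄ ∘₃ ∘₂ ∘₁)) (cong₂ _+_ (trans (total-s₃ (f ∘₄)) (total-s₄ f))
      (trans (total-+ (f ∘₄ ∘₃ ∘₂) (f ∘₄ ∘₃ ∘₂ ∘₁)) (cong₂ _+_
        (trans (total-s₂ (f ∘₄ ∘₃)) (trans (total-s₃ (f ∘₄)) (total-s₄ f)))
        (trans (total-s₁ (f ∘₄ ∘₃ ∘₂)) (trans (total-s₂ (f ∘₄ ∘₃)) (trans (total-s₃ (f ∘₄))
        (trans (total-s₄ f) (sym (+-identityʳ _)))))))))))))

    total-symmetrise : ∀ f → total (symmetrise f) ≡ 120 * total f
    total-symmetrise f = trans (total-sym₄ (sym₃ (sym₂ (sym₁ f)))) (trans (cong (5 *_) (trans (total-sym₃ (sym₂ (sym₁ f)))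
      (cong (4 *_) (trans (total-sym₂ (sym₁ f)) (cong (3 *_) (total-sym₁ f)))))) (lem (total f)))
      where
      lem : ∀ t → 5 * (4 * (3 * (2 * t))) ≡ 120 * t
      lem = solve-∀

  -- Each of the 120 relabellings leaves a total unchanged, because h is symmetric and the sums
  -- commute; the pointwise certificate therefore gives 120 times this inequality.
  total-large≤small : total large ≤ total small
  total-large≤small = *-cancelˡ-≤ 120 (subst₂ _≤_ (total-symmetrise large) (total-symmetrise small)
    (∑⁵-mono vs λ a b c d e → symmetrise-≤ (code a b c d e)))

  private
    N = length vs

  edgesIn : (V → V → V → Bool) → ℕ
  edgesIn P = ∑³ vs λ a b c → 𝟙 (h a b c) * 𝟙 (P a b c)

  bad iii t5 : ℕ
  bad = edgesIn λ a b c → minority (x a) (x b) (x c)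
  iii = edgesIn λ a b c → x a ∧ x b ∧ x c
  t5  = ∑⁵ vs λ a b c d e → 𝟙 (h a b c) * 𝟙 (h a b d) * 𝟙 (h a b e) * 𝟙 (h c d e)

  private
    pad : ∀ (f : V → V → V → ℕ) → ∑⁵ vs (λ a b c _ _ → f a b c) ≡ N * N * ∑³ vs f
    pad f = trans (∑³-cong vs λ a b c → ∑²-const vs (f a b c)) (∑³-*ˡ vs (N * N) f)

    sqR≤sqL : total sqR ≤ total sqL
    sqR≤sqL = ∑³-mono vs λ a b c → subst₂ _≤_ (sym (∑²-*ˡ vs (w a b c) _)) (sym (∑²-*ˡ vs (w a b c) _))
      (*-monoʳ-≤ (w a b c) (square-≥0 (λ d → sqF (x b) (h a b c) (x d) (h a b d) (h a c d) (h b c d)) vs))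
      where
      w : V → V → V → ℕ
      w a b c = sqW (x a) (x b) (x c) (h a b c)

    -- The linear form lives on the link of a, so the square is taken over the list of all pairs of
    -- vertices.
    linkR≤linkL : total linkR ≤ total linkL
    linkR≤linkL = ∑-mono vs λ a → subst₂ _≤_ (eq a cross) (eq a dot) (*-monoʳ-≤ (𝟙 (x a) * 40)
      (square-≥0 (λ bc → F a (proj₁ bc) (proj₂ bc)) (concatMap (λ y → map (y ,_) vs) vs)))
      where
      F : V → V → V → ℕ × ℕ
      F a b c = linkF (x b) (x c) (h a b c)
      pairs = concatMap (λ y → map (y ,_) vs) vs
      eq : ∀ a (_·_ : ℕ × ℕ → ℕ × ℕ → ℕ) →
        𝟙 (x a) * 40 * ∑² pairs (λ u v → F a (proj₁ u) (proj₂ u) · F a (proj₁ v) (proj₂ v))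
        ≡ ∑⁴ vs (λ b c d e → 𝟙 (x a) * 40 * (F a b c · F a d e))
      eq a _·_ = trans (cong (𝟙 (x a) * 40 *_) (trans (∑-pairs vs _) (∑²-cong vs λ b c → ∑-pairs vs _)))
        (sym (∑⁴-*ˡ vs (𝟙 (x a) * 40) _))

  -- δ/D is the tolerated degree deficit, and β marks the pairs whose codegree may exceed |I|; both
  -- end up as error terms.
  module _ (D δ : ℕ) (β : V → V → ℕ)
    (deg≥ : ∀ a → a ∈ vs → D * (4 * (N * N)) ≤ D * (9 * ∑² vs (λ d e → 𝟙 (h a d e))) + δ)
    (cod≤ : ∀ a b → a ∈ vs → b ∈ vs → ∑ vs (λ e → 𝟙 (h a b e)) ≤ ∑ vs (λ e → 𝟙 (x e)) + N * β a b) where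

    private
      B = ∑² vs β

      codR≤codL : total codR ≤ total codL + codMax * (N * N * N * B)
      codR≤codL = ≤-trans (∑²-mono∈ vs step) (≤-reflexive (trans (∑²-+ vs _ _) (cong (total codL +_) end)))
        where
        w : V → V → V → V → ℕ
        w a b c d = codW (x a) (x b) (x c) (x d) (h a b c) (h a b d) (h a c d) (h b c d)
        step : ∀ a b → a ∈ vs → b ∈ vs → ∑³ vs (λ c d e → w a b c d * 𝟙 (h a b e))
          ≤ ∑³ vs (λ c d e → w a b c d * 𝟙 (x e)) + ∑² vs (λ _ _ → codMax * (N * β a b))
        step a b i j = ≤-trans (∑²-mono vs λ c d → inner c d) (≤-reflexive (∑²-+ vs _ _))
          where
          inner : ∀ c d → ∑ vs (λ e → w a b c d * 𝟙 (h a b e)) ≤ ∑ vs (λ e → w a b c d * 𝟙 (x e)) + codMax * (N * β a b)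
          inner c d = begin
            ∑ vs (λ e → w a b c d * 𝟙 (h a b e))             ≡⟨ ∑-*ˡ vs (w a b c d) _ ⟩
            w a b c d * ∑ vs (λ e → 𝟙 (h a b e))             ≤⟨ *-monoʳ-≤ (w a b c d) (cod≤ a b i j) ⟩
            w a b c d * (∑ vs (λ e → 𝟙 (x e)) + N * β a b)   ≡⟨ *-distribˡ-+ (w a b c d) _ _ ⟩
            w a b c d * ∑ vs (λ e → 𝟙 (x e)) + w a b c d * (N * β a b)
              ≤⟨ +-mono-≤ (≤-reflexive (sym (∑-*ˡ vs (w a b c d) _)))
                   (*-monoˡ-≤ (N * β a b) (codW≤ (x a) (x b) (x c) (x d) (h a b c) (h a b d) (h a c d) (h b c d))) ⟩
            ∑ vs (λ e → w a b c d * 𝟙 (x e)) + codMax * (N * β a b) ∎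
            where open ≤-Reasoning
        end : ∑⁴ vs (λ a b _ _ → codMax * (N * β a b)) ≡ codMax * (N * N * N * B)
        end = trans (∑²-cong vs λ a b → trans (∑²-const vs _) (lem N (β a b) codMax))
          (trans (∑²-*ˡ vs (codMax * (N * N * N)) β) (*-assoc codMax (N * N * N) B))
          where
          lem : ∀ n b k → n * n * (k * (n * b)) ≡ k * (n * n * n) * b
          lem = solve-∀

      degR≤degL : D * total degR ≤ D * total degL + degMax * (N * N * N * δ)
      degR≤degL = begin
        D * total degR                                        ≡⟨ trans (sym (∑³-*ˡ vs D _)) (∑³-cong vs λ a b c → lhs a b c) ⟩
        ∑³ vs (λ a b c → w a b c * (D * (4 * (N * N))))       ≤⟨ ∑-mono∈ vs (λ a i → ∑²-mono vs λ b c → step a b c i) ⟩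
        ∑³ vs (λ a b c → D * ∑² vs (λ d e → w a b c * (9 * 𝟙 (h a d e))) + degMax * δ)
          ≡⟨ trans (∑³-+ vs _ _) (cong₂ _+_ (∑³-*ˡ vs D _) (trans (∑³-const vs (degMax * δ)) (lem N δ degMax))) ⟩
        D * total degL + degMax * (N * N * N * δ)                 ∎
        where
        open ≤-Reasoning
        w : V → V → V → ℕ
        w a b c = degW (x a) (x b) (x c) (h a b c)
        lem : ∀ n d k → n * n * n * (k * d) ≡ k * (n * n * n * d)
        lem = solve-∀
        comm₁ : ∀ D n w → D * (n * n * (w * 4)) ≡ w * (D * (4 * (n * n)))
        comm₁ = solve-∀
        lhs : ∀ a b c → D * ∑² vs (λ d e → w a b c * 4) ≡ w a b c * (D * (4 * (N * N)))
        lhs a b c = trans (cong (D *_) (∑²-const vs _)) (comm₁ D N (w a b c))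
        comm₂ : ∀ w D s → w * (D * (9 * s)) ≡ D * (w * (9 * s))
        comm₂ = solve-∀
        step : ∀ a b c → a ∈ vs → w a b c * (D * (4 * (N * N)))
          ≤ D * ∑² vs (λ d e → w a b c * (9 * 𝟙 (h a d e))) + degMax * δ
        step a b c i = begin
          w a b c * (D * (4 * (N * N)))     ≤⟨ *-monoʳ-≤ (w a b c) (deg≥ a i) ⟩
          w a b c * (D * (9 * deg) + δ)     ≡⟨ *-distribˡ-+ (w a b c) _ δ ⟩
          w a b c * (D * (9 * deg)) + w a b c * δ
            ≤⟨ +-mono-≤ (≤-reflexive (trans (comm₂ (w a b c) D deg) (cong (D *_) (sym
                 (trans (∑²-*ˡ vs (w a b c) _) (cong (w a b c *_) (∑²-*ˡ vs 9 _)))))))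
                 (*-monoˡ-≤ δ (degW≤ (x a) (x b) (x c) (h a b c))) ⟩
          D * ∑² vs (λ d e → w a b c * (9 * 𝟙 (h a d e))) + degMax * δ ∎
          where deg = ∑² vs (λ d e → 𝟙 (h a d e))

    -- The certificate combined with the four inequalities between R and L totals. The L totals are
    -- added to both sides and cancelled, which replaces subtraction.
    bad-bound : D * (N * N * bad) ≤
      D * (penalty * (t5 + N * N * iii)) + scale * (D * (codMax * (N * N * N * B)) + degMax * (N * N * N * δ))
    bad-bound = +-cancelʳ-≤ (scale * (D * (cL + (dL + (sL + lL))))) _ _ (begin
      D * (N * N * bad) + scale * (D * (cL + (dL + (sL + lL))))
        ≡⟨ cong (λ z → D * z + scale * (D * (cL + (dL + (sL + lL))))) (sym (pad _)) ⟩
      D * total badC + scale * (D * (cL + (dL + (sL + lL))))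
        ≡⟨ lem₁ D (total badC) (cL + (dL + (sL + lL))) scale ⟩
      D * (total badC + scale * (cL + (dL + (sL + lL))))
        ≡⟨ cong (D *_) (sym (trans (total-+ badC (λ v → scale * (codL v + (degL v + (sqL v + linkL v))))) (cong (total badC +_) (split codL degL sqL linkL)))) ⟩
      D * total large ≤⟨ *-monoʳ-≤ D total-large≤small ⟩
      D * total small
        ≡⟨ cong (D *_) (trans (total-+ (λ v → penalty * (t5C v + iiiC v)) (λ v → scale * (codR v + (degR v + (sqR v + linkR v))))) (cong₂ _+_
             (trans (total-* penalty (λ v → t5C v + iiiC v)) (cong (penalty *_) (trans (total-+ t5C iiiC) (cong (t5 +_) (pad _)))))
             (split codR degR sqR linkR))) ⟩
      D * (penalty * (t5 + N * N * iii) + scale * (cR + (dR + (sR + lR))))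
        ≡⟨ lem₂ D (penalty * (t5 + N * N * iii)) cR dR sR lR scale ⟩
      D * (penalty * (t5 + N * N * iii)) + scale * (D * cR + (D * dR + (D * sR + D * lR)))
        ≤⟨ +-monoʳ-≤ (D * (penalty * (t5 + N * N * iii))) (*-monoʳ-≤ scale (+-mono-≤ (*-monoʳ-≤ D codR≤codL)
             (+-mono-≤ degR≤degL (+-mono-≤ (*-monoʳ-≤ D sqR≤sqL) (*-monoʳ-≤ D linkR≤linkL))))) ⟩
      D * (penalty * (t5 + N * N * iii)) + scale * (D * (cL + codMax * (N * N * N * B))
        + (D * dL + degMax * (N * N * N * δ) + (D * sL + D * lL)))
        ≡⟨ lem₃ (D * (penalty * (t5 + N * N * iii))) D cL dL sL lL (codMax * (N * N * N * B)) (degMax * (N * N * N * δ)) scale ⟩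
      D * (penalty * (t5 + N * N * iii)) + scale * (D * (codMax * (N * N * N * B)) + degMax * (N * N * N * δ))
        + scale * (D * (cL + (dL + (sL + lL)))) ∎)
      where
      open ≤-Reasoning
      cL = total codL
      dL = total degL
      sL = total sqL
      lL = total linkL
      cR = total codR
      dR = total degR
      sR = total sqR
      lR = total linkR
      lem₁ : ∀ D b s m → D * b + m * (D * s) ≡ D * (b + m * s)
      lem₁ = solve-∀
      lem₂ : ∀ D k c d s l m → D * (k + m * (c + (d + (s + l)))) ≡ D * k + m * (D * c + (D * d + (D * s + D * l)))
      lem₂ = solve-∀
      lem₃ : ∀ k D c d s l u v m → k + m * (D * (c + u) + (D * d + v + (D * s + D * l)))
        ≡ k + m * (D * u + v) + m * (D * (c + (d + (s + l))))
      lem₃ = solve-∀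
      split : ∀ f₁ f₂ f₃ f₄ → total (λ v → scale * (f₁ v + (f₂ v + (f₃ v + f₄ v))))
        ≡ scale * (total f₁ + (total f₂ + (total f₃ + total f₄)))
      split f₁ f₂ f₃ f₄ = trans (total-* scale (λ v → f₁ v + (f₂ v + (f₃ v + f₄ v)))) (cong (scale *_) (trans (total-+ f₁ (λ v → f₂ v + (f₃ v + f₄ v))) (cong (total f₁ +_)
        (trans (total-+ f₂ (λ v → f₃ v + f₄ v)) (cong (total f₂ +_) (total-+ f₃ f₄))))))

-- Subsets of large minimum degree

module _ {A : Set} where

  -- The inclusion is recorded by its effect on sums, with the deleted elements as `remainder`;
  -- every estimate below compares a sum over W with one over U.
  record _⊑_ (W U : List A) : Set where
    constructor mk⊑
    field
      remainder : List A
      decompose : ∀ f → ∑ U f ≡ ∑ W f + ∑ remainder f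
  open _⊑_ public

  ⊑-refl : ∀ {U} → U ⊑ U
  ⊑-refl = mk⊑ [] λ f → sym (+-identityʳ _)

  ⊑-trans : ∀ {W U T} → W ⊑ U → U ⊑ T → W ⊑ T
  ⊑-trans {W} (mk⊑ R e) (mk⊑ S d) = mk⊑ (R ++ S) λ f → trans (d f) (trans (cong (_+ ∑ S f) (e f))
    (trans (+-assoc (∑ W f) _ _) (cong (∑ W f +_) (sym (∑-++ R S f)))))

  ⊑-remove : ∀ xs v ys → (xs ++ ys) ⊑ (xs ++ v ∷ ys)
  ⊑-remove xs v ys = mk⊑ (v ∷ []) λ f → trans (∑-++ xs (v ∷ ys) f)
    (trans (lem (∑ xs f) (f v) (∑ ys f)) (cong (_+ (f v + 0)) (sym (∑-++ xs ys f))))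
    where
    lem : ∀ a b c → a + (b + c) ≡ a + c + (b + 0)
    lem = solve-∀

  module _ {W U : List A} (W⊑U : W ⊑ U) where

    ⊑-∑ : ∀ f → ∑ W f ≤ ∑ U f
    ⊑-∑ f = ≤-trans (m≤m+n _ _) (≤-reflexive (sym (decompose W⊑U f)))

    ⊑-length : length W ≤ length U
    ⊑-length = subst₂ _≤_ (sym (length-∑ W)) (sym (length-∑ U)) (⊑-∑ λ _ → 1)

    ⊑-∑² : ∀ f → ∑² W f ≤ ∑² U f
    ⊑-∑² f = ≤-trans (∑-mono W λ a → ⊑-∑ (f a)) (⊑-∑ _)

    ⊑-∑³ : ∀ f → ∑³ W f ≤ ∑³ U f
    ⊑-∑³ f = ≤-trans (∑-mono W λ a → ⊑-∑² (f a)) (⊑-∑ _)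

    ⊑-∑⁴ : ∀ f → ∑⁴ W f ≤ ∑⁴ U f
    ⊑-∑⁴ f = ≤-trans (∑-mono W λ a → ⊑-∑³ (f a)) (⊑-∑ _)

    ⊑-∑⁵ : ∀ f → ∑⁵ W f ≤ ∑⁵ U f
    ⊑-∑⁵ f = ≤-trans (∑-mono W λ a → ⊑-∑⁴ (f a)) (⊑-∑ _)

    -- A triple outside W has one of its three entries among the k deleted elements; the sums over U
    -- are split one coordinate at a time.
    ⊑-∑³-rest : ∀ f → (∀ a b c → f a b c ≤ 1) → ∀ k → length U ≡ length W + k →
      ∑³ U f ≤ ∑³ W f + 3 * (k * (length U * length U))
    ⊑-∑³-rest f f≤1 k eq = begin
      ∑³ U f ≡⟨ e _ ⟩
      ∑ W (λ a → ∑² U (f a)) + ∑ R (λ a → ∑² U (f a))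
        ≤⟨ +-monoʳ-≤ _ (≤-trans (∑-≤const R (u * u) λ a → ∑²≤ (f a) (f≤1 a)) (≤-reflexive (cong (_* (u * u)) lenR))) ⟩
      ∑ W (λ a → ∑² U (f a)) + k * (u * u)
        ≤⟨ +-monoˡ-≤ _ (≤-trans (∑-mono W λ a → ≤-trans (≤-reflexive (e _)) (+-monoʳ-≤ _
             (≤-trans (∑-≤const R u λ b → ∑≤ (f a b) (f≤1 a b)) (≤-reflexive (cong (_* u) lenR)))))
             (≤-trans (≤-reflexive (∑-+ W _ _)) (+-monoʳ-≤ _ (≤-trans (≤-reflexive (∑-const W _)) (*-monoˡ-≤ (k * u) ⊑-length))))) ⟩
      ∑ W (λ a → ∑ W λ b → ∑ U (f a b)) + u * (k * u) + k * (u * u)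
        ≤⟨ +-monoˡ-≤ _ (+-monoˡ-≤ _ (≤-trans (∑²-mono W λ a b → ≤-trans (≤-reflexive (e _)) (+-monoʳ-≤ _
             (≤-trans (∑-≤const R 1 λ c → f≤1 a b c) (≤-reflexive (trans (*-identityʳ _) lenR)))))
             (≤-trans (≤-reflexive (∑²-+ W _ _)) (+-monoʳ-≤ _ (≤-trans (≤-reflexive (∑²-const W k)) (*-monoˡ-≤ k (*-mono-≤ ⊑-length ⊑-length))))))) ⟩
      ∑³ W f + u * u * k + u * (k * u) + k * (u * u) ≡⟨ lem (∑³ W f) u k ⟩
      ∑³ W f + 3 * (k * (u * u)) ∎
      where
      open ≤-Reasoning
      R = remainder W⊑U
      e = decompose W⊑U
      u = length U
      lenR : length R ≡ k
      lenR = +-cancelˡ-≡ (length W) _ _ (trans (trans (cong₂ _+_ (length-∑ W) (length-∑ R))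
        (trans (sym (e λ _ → 1)) (sym (length-∑ U)))) eq)
      ∑≤ : (g : A → ℕ) → (∀ a → g a ≤ 1) → ∑ U g ≤ u
      ∑≤ g l = ≤-trans (∑-≤const U 1 l) (≤-reflexive (*-identityʳ u))
      ∑²≤ : (g : A → A → ℕ) → (∀ a b → g a b ≤ 1) → ∑² U g ≤ u * u
      ∑²≤ g l = ∑-≤const U u λ a → ∑≤ (g a) (l a)
      lem : ∀ s u k → s + u * u * k + u * (k * u) + k * (u * u) ≡ s + 3 * (k * (u * u))
      lem = solve-∀

  splitOrAll : ∀ {P : A → Set} → (∀ v → P v ⊎ ¬ P v) → ∀ xs →
    (∀ v → v ∈ xs → P v) ⊎ (Σ (List A) λ ys → Σ A λ v → Σ (List A) λ zs → xs ≡ ys ++ v ∷ zs × ¬ P v)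
  splitOrAll dec [] = inj₁ λ _ ()
  splitOrAll dec (x ∷ xs) with dec x
  ... | inj₂ no! = inj₂ ([] , x , xs , refl , no!)
  ... | inj₁ px with splitOrAll dec xs
  ...   | inj₁ all = inj₁ λ { v (here refl) → px ; v (there i) → all v i }
  ...   | inj₂ (ys , v , zs , eq , no!) = inj₂ (x ∷ ys , v , zs , cong (x ∷_) eq , no!)

  argmax : (f : A → ℕ) {P : A → Set} → (∀ v → P v ⊎ ¬ P v) → ∀ xs →
    (∀ v → v ∈ xs → ¬ P v) ⊎ (Σ A λ p → P p × (∀ v → v ∈ xs → P v → f v ≤ f p))
  argmax f dec [] = inj₁ λ _ ()
  argmax f {P} dec (x ∷ xs) with dec x | argmax f dec xs
  ... | inj₂ no! | inj₁ none = inj₁ λ { v (here refl) → no! ; v (there i) → none v i }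
  ... | inj₂ no! | inj₂ (p , pp , mx) = inj₂ (p , pp , λ { v (here refl) pv → ⊥-elim (no! pv) ; v (there i) → mx v i })
  ... | inj₁ px | inj₁ none = inj₂ (x , px , λ { v (here refl) _ → ≤-refl ; v (there i) pv → ⊥-elim (none v i pv) })
  ... | inj₁ px | inj₂ (p , pp , mx) with ≤-total (f x) (f p)
  ...   | inj₁ le = inj₂ (p , pp , λ { v (here refl) _ → le ; v (there i) → mx v i })
  ...   | inj₂ ge = inj₂ (x , px , λ { v (here refl) _ → ≤-refl ; v (there i) pv → ≤-trans (mx v i pv) ge })

-- 4(α + β)³ - 27α²β = (α - 2β)²(4α + β), which is AM-GM for α/2, α/2, β. The cases fix the sign of
-- α - 2β; the second is multiplied by 8 to avoid halves.
27α²β≤4[α+β]³ : ∀ α β → 27 * (α * α * β) ≤ 4 * ((α + β) * (α + β) * (α + β))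
27α²β≤4[α+β]³ α β with ≤-total (2 * β) α
... | inj₁ le = subst (λ α → 27 * (α * α * β) ≤ 4 * ((α + β) * (α + β) * (α + β))) (m+[n∸m]≡n le)
  (≤-trans (m≤m+n (27 * ((2 * β + k) * (2 * β + k) * β)) (k * k * (4 * (2 * β + k) + β))) (≤-reflexive (lem β k)))
  where
  k = α ∸ 2 * β
  lem : ∀ β k → 27 * ((2 * β + k) * (2 * β + k) * β) + k * k * (4 * (2 * β + k) + β)
    ≡ 4 * ((2 * β + k + β) * (2 * β + k + β) * (2 * β + k + β))
  lem = solve-∀
... | inj₂ ge = *-cancelˡ-≤ 8 (subst₂ _≤_ (lem₁ α β) (lem₂ α β)
  (subst (λ z → 108 * (α * α * z) ≤ 4 * ((2 * α + z) * (2 * α + z) * (2 * α + z))) (m+[n∸m]≡n ge)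
  (≤-trans (m≤m+n (108 * (α * α * (α + k))) (36 * (α * k * k) + 4 * (k * k * k))) (≤-reflexive (lem α k)))))
  where
  k = 2 * β ∸ α
  lem : ∀ α k → 108 * (α * α * (α + k)) + (36 * (α * k * k) + 4 * (k * k * k))
    ≡ 4 * ((2 * α + (α + k)) * (2 * α + (α + k)) * (2 * α + (α + k)))
  lem = solve-∀
  lem₁ : ∀ α β → 108 * (α * α * (2 * β)) ≡ 8 * (27 * (α * α * β))
  lem₁ = solve-∀
  lem₂ : ∀ α β → 4 * ((2 * α + 2 * β) * (2 * α + 2 * β) * (2 * α + 2 * β)) ≡ 8 * (4 * ((α + β) * (α + β) * (α + β)))
  lem₂ = solve-∀

module Dense {V : Set} (h : V → V → V → Bool)
  (h-swap₁ : ∀ a b c → h a b c ≡ h b a c) (h-swap₂ : ∀ a b c → h a b c ≡ h a c b) where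

  E : List V → ℕ
  E vs = ∑³ vs λ a b c → 𝟙 (h a b c)

  deg : List V → V → ℕ
  deg vs v = ∑² vs λ d e → 𝟙 (h v d e)

  private
    h₁₂ : ∀ a b c → h a b c ≡ h b c a
    h₁₂ a b c = trans (h-swap₁ a b c) (h-swap₂ b a c)

  -- The vertex v can stand in three positions, and by symmetry each accounts for at most `deg`
  -- ordered triples.
  E-remove : ∀ xs v ys → E (xs ++ v ∷ ys) ≤ E (xs ++ ys) + 3 * deg (xs ++ v ∷ ys) v
  E-remove xs v ys = begin
    E U ≡⟨ e _ ⟩
    ∑ W (λ a → ∑² U (g a)) + (d + 0)
      ≤⟨ +-monoˡ-≤ (d + 0) (begin
        ∑ W (λ a → ∑² U (g a)) ≡⟨ trans (∑-cong W λ a → e (λ b → ∑ U (g a b))) (∑-+ W _ _) ⟩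
        ∑ W (λ a → ∑ W λ b → ∑ U (g a b)) + ∑ W (λ a → ∑ U (g a v) + 0)
          ≤⟨ +-mono-≤ (begin
              ∑² W (λ a b → ∑ U (g a b)) ≡⟨ trans (∑²-cong W λ a b → e (g a b)) (∑²-+ W _ _) ⟩
              E W + ∑² W (λ a b → g a b v + 0) ≤⟨ +-monoʳ-≤ (E W) (≤-trans (⊑-∑² W⊑U _)
                 (≤-reflexive (∑²-cong U λ a b → trans (+-identityʳ _) (cong 𝟙 (sym (h₁₂ v a b)))))) ⟩
              E W + d ∎)
            (≤-trans (⊑-∑ W⊑U _) (≤-reflexive (∑-cong U λ a → trans (+-identityʳ _) (∑-cong U λ c → cong 𝟙 (h-swap₁ a v c))))) ⟩
        E W + d + d ∎) ⟩
    E W + d + d + (d + 0) ≡⟨ lem (E W) d ⟩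
    E W + 3 * d ∎
    where
    open ≤-Reasoning
    U = xs ++ v ∷ ys
    W = xs ++ ys
    W⊑U = ⊑-remove xs v ys
    e = decompose W⊑U
    d = deg U v
    g : V → V → V → ℕ
    g a b c = 𝟙 (h a b c)
    lem : ∀ s d → s + d + d + (d + 0) ≡ s + 3 * d
    lem = solve-∀

  cube : ℕ → ℕ
  cube n = n * n * n

  -- `E≥` says that B·E - A·|·|³ does not decrease from U to W, up to the error 3An|U|. Indeed,
  -- deleting a vertex of degree below Au²/B costs less than 3Au² in B·E, and the cube term gives
  -- back A(u³ - (u - 1)³), almost as much.
  record Dense-sub (A B n : ℕ) (U : List V) : Set where
    field
      W    : List V
      W⊑U  : W ⊑ U
      deg≥ : ∀ v → v ∈ W → A * (length W * length W) ≤ B * deg W v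
      E≥   : B * E U + A * cube (length W) ≤ B * E W + A * cube (length U) + 3 * (A * (n * length U))

  dense-sub : ∀ A B n fuel U → length U ≤ fuel → length U ≤ n → Dense-sub A B n U
  dense-sub A B n fuel U l≤f l≤n with splitOrAll dec U
    where
    dec : ∀ v → (A * (length U * length U) ≤ B * deg U v) ⊎ ¬ (A * (length U * length U) ≤ B * deg U v)
    dec v with A * (length U * length U) ≤? B * deg U v
    ... | yes p = inj₁ p
    ... | no p  = inj₂ p
  ... | inj₁ all = record { W = U ; W⊑U = ⊑-refl ; deg≥ = all ; E≥ = m≤m+n _ _ }
  dense-sub A B n zero .(xs ++ v ∷ ys) l≤f l≤n | inj₂ (xs , v , ys , refl , low) =
    ⊥-elim (lem xs l≤f)
    where
    lem : ∀ xs → ¬ (length (xs ++ v ∷ ys) ≤ 0)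
    lem []       ()
    lem (_ ∷ xs) ()
  dense-sub A B n (suc fuel) .(xs ++ v ∷ ys) l≤f l≤n | inj₂ (xs , v , ys , refl , low) =
    record { W = D.W ; W⊑U = ⊑-trans D.W⊑U (⊑-remove xs v ys) ; deg≥ = D.deg≥ ; E≥ = bound }
    where
    U U′ : List V
    U  = xs ++ v ∷ ys
    U′ = xs ++ ys
    u = length U′
    len : length U ≡ suc u
    len = go xs
      where
      go : ∀ xs → length (xs ++ v ∷ ys) ≡ suc (length (xs ++ ys))
      go []       = refl
      go (_ ∷ xs) = cong suc (go xs)
    module D = Dense-sub (dense-sub A B n fuel U′ (s≤s⁻¹ (subst (_≤ suc fuel) len l≤f))
      (≤-trans (n≤1+n u) (subst (_≤ n) len l≤n)))
    w³ = cube (length D.W)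
    lem₁ : ∀ B e d → B * (e + 3 * d) ≡ B * e + 3 * (B * d)
    lem₁ = solve-∀
    lem₂ : ∀ A n x u m → x + A * (u * u * u) + 3 * (A * (n * u)) + 3 * (A * (suc u * suc u)) + A * (3 * m + 1)
      ≡ x + A * (suc u * suc u * suc u) + 3 * (A * (n * u)) + 3 * (A * (suc u + m))
    lem₂ = solve-∀
    lem₃ : ∀ A n x u → x + A * (suc u * suc u * suc u) + 3 * (A * (n * u)) + 3 * (A * n)
      ≡ x + A * (suc u * suc u * suc u) + 3 * (A * (n * suc u))
    lem₃ = solve-∀
    su≤n = subst (_≤ n) len l≤n
    bound : B * E U + A * w³ ≤ B * E D.W + A * cube (length U) + 3 * (A * (n * length U))
    bound = subst (λ l → B * E U + A * w³ ≤ B * E D.W + A * cube l + 3 * (A * (n * l))) (sym len) (begin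
      B * E U + A * w³ ≤⟨ +-monoˡ-≤ (A * w³) (*-monoʳ-≤ B (E-remove xs v ys)) ⟩
      B * (E U′ + 3 * deg U v) + A * w³ ≡⟨ cong (_+ A * w³) (lem₁ B (E U′) (deg U v)) ⟩
      B * E U′ + 3 * (B * deg U v) + A * w³
        ≤⟨ +-monoˡ-≤ (A * w³) (+-monoʳ-≤ (B * E U′) (*-monoʳ-≤ 3 (subst (λ l → B * deg U v ≤ A * (l * l)) len (<⇒≤ (≰⇒> low))))) ⟩
      B * E U′ + 3 * (A * (suc u * suc u)) + A * w³
        ≡⟨ trans (+-assoc (B * E U′) _ _) (trans (cong (B * E U′ +_) (+-comm (3 * (A * (suc u * suc u))) _)) (sym (+-assoc (B * E U′) _ _))) ⟩
      B * E U′ + A * w³ + 3 * (A * (suc u * suc u)) ≤⟨ +-monoˡ-≤ _ D.E≥ ⟩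
      B * E D.W + A * cube u + 3 * (A * (n * u)) + 3 * (A * (suc u * suc u)) ≤⟨ m≤m+n _ _ ⟩
      -- u³ + 3(u + 1)² exceeds (u + 1)³ by 3u + 2; the added slack rounds this excess up to 3n, the
      -- error allowed per deleted vertex.
      B * E D.W + A * cube u + 3 * (A * (n * u)) + 3 * (A * (suc u * suc u)) + A * (3 * (n ∸ suc u) + 1)
        ≡⟨ lem₂ A n (B * E D.W) u (n ∸ suc u) ⟩
      B * E D.W + A * cube (suc u) + 3 * (A * (n * u)) + 3 * (A * (suc u + (n ∸ suc u)))
        ≡⟨ cong (λ z → B * E D.W + A * cube (suc u) + 3 * (A * (n * u)) + 3 * (A * z)) (m+[n∸m]≡n su≤n) ⟩
      B * E D.W + A * cube (suc u) + 3 * (A * (n * u)) + 3 * (A * n) ≡⟨ lem₃ A n (B * E D.W) u ⟩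
      B * E D.W + A * cube (suc u) + 3 * (A * (n * suc u)) ∎)
      where open ≤-Reasoning

-- Stability

inconsistent : Bool → Bool → Bool → Bool
inconsistent a b c = not (count2 a b c ≡ᵇ 2)

𝟙-inconsistent : ∀ a b c → 𝟙 (inconsistent a b c) ≡ 𝟙 (a ∧ b ∧ c) + 𝟙 (minority a b c)
𝟙-inconsistent true  true  true  = refl
𝟙-inconsistent true  true  false = refl
𝟙-inconsistent true  false true  = refl
𝟙-inconsistent true  false false = refl
𝟙-inconsistent false true  true  = refl
𝟙-inconsistent false true  false = refl
𝟙-inconsistent false false true  = refl
𝟙-inconsistent false false false = refl

-- Error coefficients from `bad-bound`: `errP` gathers the copies of T₅, the edges inside I and the
-- exceptional codegrees; `errQ` is for the degree deficit.
errP errQ : ℕ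
errP = penalty + penalty + scale * codMax
errQ = scale * degMax

module Robust {V : Set} (h : V → V → V → Bool)
  (h-swap₁ : ∀ a b c → h a b c ≡ h b a c) (h-swap₂ : ∀ a b c → h a b c ≡ h a c b)
  (vs : List V) where

  open Dense h h-swap₁ h-swap₂
  open Colouring h h-swap₁ h-swap₂ using (bad-bound; t5; iii; bad; edgesIn)

  private
    n  = length vs
    n³ = n * n * n
    n⁵ = n * n * (n * n * n)

  t5At : V → V → ℕ
  t5At a b = ∑³ vs λ c d e → 𝟙 (h a b c) * 𝟙 (h a b d) * 𝟙 (h a b e) * 𝟙 (h c d e)

  T5 : ℕ
  T5 = ∑⁵ vs λ a b c d e → 𝟙 (h a b c) * 𝟙 (h a b d) * 𝟙 (h a b e) * 𝟙 (h c d e)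

  -- An edge lies inside I, has at most one vertex in I, or has exactly two. With class sizes α and
  -- β the last kind gives at most 3α²β ordered triples, and AM-GM bounds 27α²β by 4(α + β)³.
  E-split : ∀ x W → 9 * E W ≤ 4 * cube (length W) + 9 * (iii x W + bad x W)
  E-split x W = begin
    9 * E W ≤⟨ *-monoʳ-≤ 9 (∑³-mono W λ a b c → pointwise (h a b c) (x a) (x b) (x c)) ⟩
    9 * ∑³ W (λ a b c → 𝟙 (h a b c) * 𝟙 (x a ∧ x b ∧ x c) + 𝟙 (h a b c) * 𝟙 (minority (x a) (x b) (x c))
      + (p a * (p b * q c) + (p a * (q b * p c) + q a * (p b * p c))))
      ≡⟨ cong (9 *_) (trans (∑³-+ W _ _) (cong₂ _+_ (∑³-+ W _ _) (trans (∑³-+ W _ _) (cong₂ _+_ (∑³-product W p p q)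
           (trans (∑³-+ W _ _) (cong₂ _+_ (∑³-product W p q p) (∑³-product W q p p))))))) ⟩
    9 * (iii x W + bad x W + (α * (α * β) + (α * (β * α) + β * (α * α))))
      ≡⟨ lem (iii x W + bad x W) α β ⟩
    27 * (α * α * β) + 9 * (iii x W + bad x W) ≤⟨ +-monoˡ-≤ _ (27α²β≤4[α+β]³ α β) ⟩
    4 * cube (α + β) + 9 * (iii x W + bad x W) ≡⟨ cong (λ z → 4 * cube z + 9 * (iii x W + bad x W)) α+β ⟩
    4 * cube (length W) + 9 * (iii x W + bad x W) ∎
    where
    open ≤-Reasoning
    p q : V → ℕ
    p a = 𝟙 (x a)
    q a = 𝟙 (not (x a))
    α = ∑ W p
    β = ∑ W q
    p+q : ∀ b → 𝟙 b + 𝟙 (not b) ≡ 1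
    p+q true  = refl
    p+q false = refl
    α+β : α + β ≡ length W
    α+β = trans (sym (∑-+ W p q)) (trans (∑-cong W λ a → p+q (x a)) (sym (length-∑ W)))
    lem : ∀ s a b → 9 * (s + (a * (a * b) + (a * (b * a) + b * (a * a)))) ≡ 27 * (a * a * b) + 9 * s
    lem = solve-∀
    pointwise : ∀ e a b c → 𝟙 e ≤ 𝟙 e * 𝟙 (a ∧ b ∧ c) + 𝟙 e * 𝟙 (minority a b c)
      + (𝟙 a * (𝟙 b * 𝟙 (not c)) + (𝟙 a * (𝟙 (not b) * 𝟙 c) + 𝟙 (not a) * (𝟙 b * 𝟙 c)))
    pointwise false a     b     c     = z≤n
    pointwise true  true  true  true  = ≤-refl
    pointwise true  true  true  false = ≤-refl
    pointwise true  true  false true  = ≤-refl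
    pointwise true  true  false false = ≤-refl
    pointwise true  false true  true  = ≤-refl
    pointwise true  false true  false = ≤-refl
    pointwise true  false false true  = ≤-refl
    pointwise true  false false false = ≤-refl

  module _ (Θ : ℕ) .{{_ : NonZero Θ}} .{{_ : NonZero n}} (few : Θ * Θ * T5 ≤ n⁵) where

    private
      instance
        n³≢0 : NonZero n³
        n³≢0 = m*n≢0 (n * n) n {{m*n≢0 n n}}

    -- The colour class is the neighbourhood N(p) of a pair p of maximum codegree
    -- among the pairs lying in few copies of T₅; pairs lying in many are counted by β.
    core : ∀ {W} → W ⊑ vs → ∀ D δ →
      (∀ a → a ∈ W → D * (4 * (length W * length W)) ≤ D * (9 * deg W a) + δ) →
      (Θ * (length W * length W) ≤ n * n) ⊎
      (Σ (V → Bool) λ x → Θ * iii x W ≤ n³ ×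
        Θ * (D * (length W * length W * bad x W)) ≤ D * (errP * n⁵) + Θ * (errQ * (cube (length W) * δ)))
    core {W} W⊑vs D δ deg≥ with argmax (λ p → ∑ W λ e → 𝟙 (h (proj₁ p) (proj₂ p) e)) good? (cartesianProduct W W)
      where
      good? : ∀ p → (Θ * t5At (proj₁ p) (proj₂ p) ≤ n³) ⊎ ¬ (Θ * t5At (proj₁ p) (proj₂ p) ≤ n³)
      good? p with Θ * t5At (proj₁ p) (proj₂ p) ≤? n³
      ... | yes l = inj₁ l
      ... | no l  = inj₂ l
    -- If every pair of W lies in more than n³/Θ copies, summing over the w² pairs and comparing
    -- with `few` forces W to be small.
    ... | inj₁ none = inj₁ (*-cancelʳ-≤ _ _ n³ (begin
      Θ * (w * w) * n³            ≡⟨ *-assoc Θ _ _ ⟩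
      Θ * (w * w * n³)            ≡⟨ cong (Θ *_) (sym (∑²-const W n³)) ⟩
      Θ * ∑² W (λ _ _ → n³)       ≤⟨ *-monoʳ-≤ Θ (∑²-mono∈ W λ a b i j → <⇒≤ (≰⇒> (none (a , b) (∈-cartesianProduct⁺ i j)))) ⟩
      Θ * ∑² W (λ a b → Θ * t5At a b) ≡⟨ cong (Θ *_) (∑²-*ˡ W Θ t5At) ⟩
      Θ * (Θ * ∑² W t5At)         ≤⟨ *-monoʳ-≤ Θ (*-monoʳ-≤ Θ (⊑-∑² W⊑vs t5At)) ⟩
      Θ * (Θ * T5)                ≡⟨ sym (*-assoc Θ Θ T5) ⟩
      Θ * Θ * T5                  ≤⟨ few ⟩
      n * n * n³                  ∎))
      where
      open ≤-Reasoning
      w = length W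
    ... | inj₂ ((p₁ , p₂) , good , max) = inj₂ (x , Θiii , final)
      where
      open ≤-Reasoning
      w = length W
      w≤n = ⊑-length W⊑vs
      x : V → Bool
      x = h p₁ p₂
      β : V → V → ℕ
      β a b = 𝟙 (n³ <ᵇ Θ * t5At a b)
      B = ∑² W β
      cod≤ : ∀ a b → a ∈ W → b ∈ W → ∑ W (λ e → 𝟙 (h a b e)) ≤ ∑ W (λ e → 𝟙 (x e)) + w * β a b
      cod≤ a b i j with n³ <ᵇ Θ * t5At a b in eq
      ... | true  = ≤-trans (∑-≤const W 1 λ e → 𝟙≤1 _) (m≤n+m _ _)
      ... | false = ≤-trans (max (a , b) (∈-cartesianProduct⁺ i j)
                      (≮⇒≥ λ l → subst T eq (<⇒<ᵇ l))) (m≤m+n _ _)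
      -- An edge inside N(p) forms a copy of T₅ together with p.
      iii≤ : iii x W ≤ t5At p₁ p₂
      iii≤ = ≤-trans (∑³-mono W λ a b c → le (h a b c) (x a) (x b) (x c)) (⊑-∑³ W⊑vs _)
        where
        le : ∀ e a b c → 𝟙 e * 𝟙 (a ∧ b ∧ c) ≤ 𝟙 a * 𝟙 b * 𝟙 c * 𝟙 e
        le false a     b     c     = z≤n
        le true  true  true  true  = ≤-refl
        le true  true  true  false = ≤-refl
        le true  true  false c     = ≤-refl
        le true  false b     c     = ≤-refl
      Θiii : Θ * iii x W ≤ n³
      Θiii = ≤-trans (*-monoʳ-≤ Θ iii≤) good
      n³β≤ : ∀ a b → n³ * β a b ≤ Θ * t5At a b
      n³β≤ a b with n³ <ᵇ Θ * t5At a b in eq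
      ... | true  = ≤-trans (≤-reflexive (*-identityʳ n³)) (<⇒≤ (<ᵇ⇒< n³ _ (subst T (sym eq) _)))
      ... | false = ≤-trans (≤-reflexive (*-zeroʳ n³)) z≤n
      -- Markov's inequality: an exceptional pair lies in more than n³/Θ copies, and there are at
      -- most n⁵/Θ² copies in all.
      ΘB : Θ * B ≤ n * n
      ΘB = *-cancelˡ-≤ n³ (begin
        n³ * (Θ * B)          ≡⟨ comm n³ Θ B ⟩
        Θ * (n³ * B)          ≡⟨ cong (Θ *_) (sym (∑²-*ˡ W n³ β)) ⟩
        Θ * ∑² W (λ a b → n³ * β a b) ≤⟨ *-monoʳ-≤ Θ (∑²-mono W n³β≤) ⟩
        Θ * ∑² W (λ a b → Θ * t5At a b) ≡⟨ cong (Θ *_) (∑²-*ˡ W Θ t5At) ⟩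
        Θ * (Θ * ∑² W t5At)   ≤⟨ *-monoʳ-≤ Θ (*-monoʳ-≤ Θ (⊑-∑² W⊑vs t5At)) ⟩
        Θ * (Θ * T5)          ≡⟨ sym (*-assoc Θ Θ T5) ⟩
        Θ * Θ * T5            ≤⟨ few ⟩
        n * n * n³            ≡⟨ *-comm (n * n) n³ ⟩
        n³ * (n * n)          ∎)
        where
        comm : ∀ a b c → a * (b * c) ≡ b * (a * c)
        comm = solve-∀
      Θt5 : Θ * t5 x W ≤ n⁵
      Θt5 = ≤-trans (*-monoʳ-≤ Θ (≤-trans (⊑-∑⁵ W⊑vs _) (m≤n*m T5 Θ))) (≤-trans (≤-reflexive (sym (*-assoc Θ Θ T5))) few)
      rearrange : ∀ Θ D k t w i s c B d δ →
        Θ * (D * (k * (t + w * w * i)) + s * (D * (c * (w * w * w * B)) + d * (w * w * w * δ)))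
        ≡ D * (k * (Θ * t) + k * (w * w * (Θ * i)) + s * c * (w * w * w * (Θ * B))) + Θ * (s * d * (w * w * w * δ))
      rearrange = solve-∀
      collect : ∀ n k c → k * (n * n * (n * n * n)) + k * (n * n * (n * n * n)) + c * (n * n * n * (n * n))
        ≡ (k + k + c) * (n * n * (n * n * n))
      collect = solve-∀
      final : Θ * (D * (w * w * bad x W)) ≤ D * (errP * n⁵) + Θ * (errQ * (cube w * δ))
      final = begin
        Θ * (D * (w * w * bad x W)) ≤⟨ *-monoʳ-≤ Θ (bad-bound x W D δ β deg≥ cod≤) ⟩
        Θ * (D * (penalty * (t5 x W + w * w * iii x W)) + scale * (D * (codMax * (w * w * w * B)) + degMax * (w * w * w * δ)))
          ≡⟨ rearrange Θ D penalty (t5 x W) w (iii x W) scale codMax B degMax δ ⟩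
        D * (penalty * (Θ * t5 x W) + penalty * (w * w * (Θ * iii x W)) + scale * codMax * (w * w * w * (Θ * B)))
          + Θ * (errQ * (cube w * δ))
          ≤⟨ +-monoˡ-≤ _ (*-monoʳ-≤ D (+-mono-≤ (+-mono-≤ (*-monoʳ-≤ penalty Θt5)
               (*-monoʳ-≤ penalty (*-mono-≤ (*-mono-≤ w≤n w≤n) Θiii)))
               (*-monoʳ-≤ (scale * codMax) (*-mono-≤ (*-mono-≤ (*-mono-≤ w≤n w≤n) w≤n) ΘB)))) ⟩
        D * (penalty * n⁵ + penalty * n⁵ + scale * codMax * (n³ * (n * n))) + Θ * (errQ * (cube w * δ))
          ≡⟨ cong (λ z → D * z + Θ * (errQ * (cube w * δ))) (collect n penalty (scale * codMax)) ⟩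
        D * (errP * n⁵) + Θ * (errQ * (cube w * δ)) ∎

    -- An approximate Turán bound for every subset W₀: pass to the part W of minimum degree 4|W|²/9,
    -- then combine `core` with `E-split`. The factor 2 divides the allowance n³ between the error
    -- of the deletion and the edges that are not consistent.
    density : ∀ τ .{{_ : NonZero τ}} → 18 * τ * (1 + 18 * τ * errP) ≤ Θ → 24 * τ ≤ n → ∀ {W₀} → W₀ ⊑ vs →
      τ * (9 * E W₀) ≤ τ * (4 * cube (length W₀)) + n³
    density τ Θ≥ n≥ {W₀} W₀⊑vs = *-cancelˡ-≤ 2 (+-cancelʳ-≤ (2 * (τ * (4 * w³))) _ _ (begin
      2 * (τ * (9 * E W₀)) + 2 * (τ * (4 * w³)) ≡⟨ lem₁ τ (9 * E W₀) (4 * w³) ⟩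
      2 * τ * (9 * E W₀ + 4 * w³)               ≤⟨ *-monoʳ-≤ (2 * τ) E≥ ⟩
      2 * τ * (9 * E W + 4 * u³ + 3 * (4 * (n * length W₀)))
        ≤⟨ *-monoʳ-≤ (2 * τ) (+-monoʳ-≤ (9 * E W + 4 * u³) (*-monoʳ-≤ 3 (*-monoʳ-≤ 4 (*-monoʳ-≤ n (⊑-length W₀⊑vs))))) ⟩
      2 * τ * (9 * E W + 4 * u³ + 3 * (4 * (n * n))) ≡⟨ lem₂ τ (9 * E W) (4 * u³) n ⟩
      2 * τ * (9 * E W) + 2 * τ * (4 * u³) + 24 * τ * (n * n)
        ≤⟨ +-mono-≤ (+-monoˡ-≤ (2 * τ * (4 * u³)) sparse) (*-monoˡ-≤ (n * n) n≥) ⟩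
      2 * τ * (4 * w³) + n³ + 2 * τ * (4 * u³) + n * (n * n) ≡⟨ lem₃ τ (4 * w³) (4 * u³) n ⟩
      2 * (τ * (4 * u³) + n³) + 2 * (τ * (4 * w³)) ∎))
      where
      open ≤-Reasoning
      open Dense-sub (dense-sub 4 9 n (length W₀) W₀ ≤-refl (⊑-length W₀⊑vs))
      u³ = cube (length W₀)
      w  = length W
      w³ = cube w
      lem₁ : ∀ t a b → 2 * (t * a) + 2 * (t * b) ≡ 2 * t * (a + b)
      lem₁ = solve-∀
      lem₂ : ∀ t a b n → 2 * t * (a + b + 3 * (4 * (n * n))) ≡ 2 * t * a + 2 * t * b + 24 * t * (n * n)
      lem₂ = solve-∀
      lem₃ : ∀ t a b n → 2 * t * a + n * n * n + 2 * t * b + n * (n * n) ≡ 2 * (t * b + n * n * n) + 2 * (t * a)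
      lem₃ = solve-∀
      W⊑vs = ⊑-trans W⊑U W₀⊑vs
      E≤w³ : E W ≤ w³
      E≤w³ = ≤-trans (∑³-mono W λ a b c → 𝟙≤1 (h a b c)) (≤-reflexive (trans (∑³-const W 1) (*-identityʳ w³)))
      sparse : 2 * τ * (9 * E W) ≤ 2 * τ * (4 * w³) + n³
      -- A small W satisfies the bound trivially. Otherwise w² > n²/(18τ), which rules out the first
      -- alternative of `core` and lets an error of order n⁵ be divided by w².
      sparse with 18 * τ * w³ ≤? n³
      ... | yes small = ≤-trans (≤-trans (≤-reflexive (eq τ (E W))) (≤-trans (*-monoʳ-≤ (18 * τ) E≤w³) small)) (m≤n+m _ _)
        where
        eq : ∀ t e → 2 * t * (9 * e) ≡ 18 * t * e
        eq = solve-∀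
      ... | no big = close (core W⊑vs 1 0 λ a i → subst₂ _≤_ (sym (*-identityˡ _))
                       (trans (sym (*-identityˡ _)) (sym (+-identityʳ _))) (deg≥ a i))
        where
        n²<18τw² : n * n < 18 * τ * (w * w)
        n²<18τw² = *-cancelˡ-< n _ _ (<-≤-trans (subst (_< 18 * τ * w³) (*-assoc n n n) (≰⇒> big))
          (≤-trans (≤-reflexive (eq τ w)) (*-monoˡ-≤ (18 * τ * (w * w)) (⊑-length W⊑vs))))
          where
          eq : ∀ t w → 18 * t * (w * w * w) ≡ w * (18 * t * (w * w))
          eq = solve-∀
        instance
          w²≢0 : NonZero (w * w)
          w²≢0 = ≢-nonZero λ z → n≮0 (subst (n * n <_) (trans (cong (18 * τ *_) z) (*-zeroʳ (18 * τ))) n²<18τw²)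
        close : (Θ * (w * w) ≤ n * n) ⊎ (Σ (V → Bool) λ x → Θ * iii x W ≤ n³ ×
          Θ * (1 * (w * w * bad x W)) ≤ 1 * (errP * n⁵) + Θ * (errQ * (w³ * 0))) → _
        close (inj₁ no-pair) = ⊥-elim (<⇒≱ n²<18τw² (≤-trans (*-monoˡ-≤ (w * w)
          (≤-trans (m≤m*n (18 * τ) (1 + 18 * τ * errP)) Θ≥)) no-pair))
        close (inj₂ (x , Θiii , Θbad)) = begin
          2 * τ * (9 * E W)                                          ≤⟨ *-monoʳ-≤ (2 * τ) (E-split x W) ⟩
          2 * τ * (4 * w³ + 9 * (iii x W + bad x W))                 ≡⟨ eq₁ τ (4 * w³) (iii x W + bad x W) ⟩
          2 * τ * (4 * w³) + 18 * τ * (iii x W + bad x W)            ≤⟨ +-monoʳ-≤ _ (*-cancelˡ-≤ Θ rest≤) ⟩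
          2 * τ * (4 * w³) + n³ ∎
          where
          eq₁ : ∀ t a s → 2 * t * (a + 9 * s) ≡ 2 * t * a + 18 * t * s
          eq₁ = solve-∀
          eq₂ : ∀ Θ s b → Θ * (1 * (s * b)) ≡ s * (Θ * b)
          eq₂ = solve-∀
          eq₃ : ∀ P n Θ Q w → 1 * (P * (n * n * (n * n * n))) + Θ * (Q * (w * w * w * 0)) ≡ n * n * (P * (n * n * n))
          eq₃ = solve-∀
          eq₄ : ∀ t s P n → 18 * t * s * (P * (n * n * n)) ≡ s * (18 * t * P * (n * n * n))
          eq₄ = solve-∀
          Θbad′ : Θ * bad x W ≤ 18 * τ * errP * n³
          Θbad′ = *-cancelˡ-≤ (w * w) (begin
            w * w * (Θ * bad x W)             ≡⟨ sym (eq₂ Θ (w * w) (bad x W)) ⟩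
            Θ * (1 * (w * w * bad x W))       ≤⟨ Θbad ⟩
            1 * (errP * n⁵) + Θ * (errQ * (w³ * 0)) ≡⟨ eq₃ errP n Θ errQ w ⟩
            n * n * (errP * n³)               ≤⟨ *-monoˡ-≤ (errP * n³) (<⇒≤ n²<18τw²) ⟩
            18 * τ * (w * w) * (errP * n³)    ≡⟨ eq₄ τ (w * w) errP n ⟩
            w * w * (18 * τ * errP * n³)      ∎)
          eq₅ : ∀ Θ t a b → Θ * (18 * t * (a + b)) ≡ 18 * t * (Θ * a + Θ * b)
          eq₅ = solve-∀
          eq₆ : ∀ t P m → 18 * t * (m + 18 * t * P * m) ≡ 18 * t * (1 + 18 * t * P) * m
          eq₆ = solve-∀
          rest≤ : Θ * (18 * τ * (iii x W + bad x W)) ≤ Θ * n³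
          rest≤ = begin
            Θ * (18 * τ * (iii x W + bad x W))     ≡⟨ eq₅ Θ τ (iii x W) (bad x W) ⟩
            18 * τ * (Θ * iii x W + Θ * bad x W)   ≤⟨ *-monoʳ-≤ (18 * τ) (+-mono-≤ Θiii Θbad′) ⟩
            18 * τ * (n³ + 18 * τ * errP * n³)     ≡⟨ eq₆ τ errP n³ ⟩
            18 * τ * (1 + 18 * τ * errP) * n³      ≤⟨ *-monoˡ-≤ n³ Θ≥ ⟩
            Θ * n³ ∎

  inconsistentEdges : (V → Bool) → List V → ℕ
  inconsistentEdges x W = ∑³ W λ a b c → 𝟙 (h a b c) * 𝟙 (inconsistent (x a) (x b) (x c))

  inconsistent-split : ∀ x W → inconsistentEdges x W ≡ iii x W + bad x W
  inconsistent-split x W = trans (∑³-cong W λ a b c → trans (cong (𝟙 (h a b c) *_) (𝟙-inconsistent (x a) (x b) (x c)))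
    (*-distribˡ-+ (𝟙 (h a b c)) _ _)) (∑³-+ W _ _)

  -- The degree threshold for W is taken slightly below 4/9. Since `density` also bounds E W from
  -- above, a nearly extremal vertex set then loses at most n/(12b) vertices, and the colouring
  -- found by `core` on W serves for all vertices.
  stable : ∀ b D Θ .{{_ : NonZero b}} .{{_ : NonZero D}} .{{_ : NonZero n}} → let τ = D * (36 * b) in
    4 * b * (1 + errQ) ≤ D → 18 * τ * (1 + 18 * τ * errP) ≤ Θ → 4 * (D * errP) ≤ Θ → 4 * b ≤ Θ → 5 ≤ Θ →
    24 * τ ≤ n → Θ * Θ * T5 ≤ n⁵ → τ * (4 * n³) ≤ τ * (9 * E vs) + n³ →
    Σ (V → Bool) λ x → b * inconsistentEdges x vs ≤ n³
  stable b D Θ {{_}} {{D≢0}} D≥ Θ≥₁ Θ≥₂ Θ≥₃ Θ≥₄ n≥ few dense = close (core Θ {{Θ≢0}} few W⊑U D (w * w) deg≥′)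
    where
    open ≤-Reasoning
    M = 36 * b
    τ = D * M
    Θ≢0 : NonZero Θ
    Θ≢0 = >-nonZero (≤-trans (s≤s z≤n) Θ≥₄)
    M≢0 : NonZero M
    M≢0 = m*n≢0 36 b
    -- The threshold (4D - 1)/(9D) is 4/9 - 1/(9D): deletions then push 9E - 4|·|³ up, while `core`
    -- sees a deficit of only w²/D.
    A = pred (4 * D)
    1+A : 1 + A ≡ 4 * D
    1+A = suc-pred (4 * D) {{m*n≢0 4 D}}
    open Dense-sub (dense-sub A (9 * D) n n vs ≤-refl ≤-refl)
    w  = length W
    w³ = cube w
    k  = n ∸ w
    w≤n = ⊑-length W⊑U
    w+k : w + k ≡ n
    w+k = m+[n∸m]≡n w≤n
    deg≥′ : ∀ a → a ∈ W → D * (4 * (w * w)) ≤ D * (9 * deg W a) + w * w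
    deg≥′ a i = begin
      D * (4 * (w * w))            ≡⟨ eq₁ D (w * w) ⟩
      4 * D * (w * w)              ≡⟨ cong (_* (w * w)) (sym 1+A) ⟩
      w * w + A * (w * w)          ≤⟨ +-monoʳ-≤ (w * w) (deg≥ a i) ⟩
      w * w + 9 * D * deg W a      ≡⟨ eq₂ D (deg W a) (w * w) ⟩
      D * (9 * deg W a) + w * w    ∎
      where
      eq₁ : ∀ D s → D * (4 * s) ≡ 4 * D * s
      eq₁ = solve-∀
      eq₂ : ∀ D d s → s + 9 * D * d ≡ D * (9 * d) + s
      eq₂ = solve-∀
    -- The gain (n³ - w³)/D from the deletions is at most the sum of three errors, n³/τ each, coming
    -- from `dense`, `density` and `dense-sub`; here τ = DM.
    w-large : M * n³ ≤ M * w³ + 3 * n³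
    w-large = +-cancelʳ-≤ (M * A * n³ + M * A * w³) _ _ (begin
      M * n³ + (M * A * n³ + M * A * w³)       ≡⟨ eq₁ M A n³ w³ ⟩
      M * (1 + A) * n³ + M * A * w³            ≡⟨ cong (λ z → M * z * n³ + M * A * w³) 1+A ⟩
      M * (4 * D) * n³ + M * A * w³            ≡⟨ eq₂ M D n³ (M * A * w³) ⟩
      τ * (4 * n³) + M * A * w³                ≤⟨ +-monoˡ-≤ (M * A * w³) dense ⟩
      τ * (9 * E vs) + n³ + M * A * w³         ≡⟨ eq₃ M D (E vs) n³ A w³ ⟩
      M * (9 * D * E vs + A * w³) + n³         ≤⟨ +-monoˡ-≤ n³ (*-monoʳ-≤ M E≥) ⟩
      M * (9 * D * E W + A * n³ + 3 * (A * (n * n))) + n³ ≡⟨ eq₄ M D (E W) A n³ n ⟩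
      τ * (9 * E W) + M * A * n³ + (3 * (M * (A * (n * n))) + n³)
        ≤⟨ +-monoˡ-≤ _ (+-monoˡ-≤ (M * A * n³) (density Θ {{Θ≢0}} few τ {{m*n≢0 D M {{D≢0}} {{M≢0}}}} Θ≥₁ n≥ W⊑U)) ⟩
      τ * (4 * w³) + n³ + M * A * n³ + (3 * (M * (A * (n * n))) + n³)
        ≤⟨ +-monoʳ-≤ (τ * (4 * w³) + n³ + M * A * n³) (+-monoˡ-≤ n³ err) ⟩
      τ * (4 * w³) + n³ + M * A * n³ + (n³ + n³)  ≡⟨ eq₅ M D w³ n³ A ⟩
      M * (4 * D) * w³ + M * A * n³ + 3 * n³   ≡⟨ cong (λ z → M * z * w³ + M * A * n³ + 3 * n³) (sym 1+A) ⟩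
      M * (1 + A) * w³ + M * A * n³ + 3 * n³   ≡⟨ eq₆ M A w³ n³ ⟩
      M * w³ + 3 * n³ + (M * A * n³ + M * A * w³) ∎)
      where
      eq₁ : ∀ M A n w → M * n + (M * A * n + M * A * w) ≡ M * (1 + A) * n + M * A * w
      eq₁ = solve-∀
      eq₂ : ∀ M D n z → M * (4 * D) * n + z ≡ D * M * (4 * n) + z
      eq₂ = solve-∀
      eq₃ : ∀ M D e n A w → D * M * (9 * e) + n + M * A * w ≡ M * (9 * D * e + A * w) + n
      eq₃ = solve-∀
      eq₄ : ∀ M D e A c n → M * (9 * D * e + A * c + 3 * (A * (n * n))) + c ≡ D * M * (9 * e) + M * A * c + (3 * (M * (A * (n * n))) + c)
      eq₄ = solve-∀
      eq₅ : ∀ M D w n A → D * M * (4 * w) + n + M * A * n + (n + n) ≡ M * (4 * D) * w + M * A * n + 3 * n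
      eq₅ = solve-∀
      eq₆ : ∀ M A w n → M * (1 + A) * w + M * A * n + 3 * n ≡ M * w + 3 * n + (M * A * n + M * A * w)
      eq₆ = solve-∀
      eq₇ : ∀ M D s → 3 * (M * (4 * D * s)) ≡ 12 * (D * M) * s
      eq₇ = solve-∀
      eq₈ : ∀ n → n * (n * n) ≡ n * n * n
      eq₈ = solve-∀
      err : 3 * (M * (A * (n * n))) ≤ n³
      err = begin
        3 * (M * (A * (n * n)))      ≤⟨ *-monoʳ-≤ 3 (*-monoʳ-≤ M (*-monoˡ-≤ (n * n) (≤-trans (n≤1+n A) (≤-reflexive 1+A)))) ⟩
        3 * (M * (4 * D * (n * n)))  ≡⟨ eq₇ M D (n * n) ⟩
        12 * τ * (n * n)             ≤⟨ *-monoˡ-≤ (n * n) (≤-trans (*-monoˡ-≤ τ {12} {24} (m≤m+n 12 12)) n≥) ⟩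
        n * (n * n)                  ≡⟨ eq₈ n ⟩
        n³ ∎
    -- Follows from n³ - w³ ≥ kn², since w ≤ n.
    Mk≤3n : M * k ≤ 3 * n
    Mk≤3n = *-cancelʳ-≤ _ _ (n * n) {{m*n≢0 n n}} (+-cancelˡ-≤ (M * w³) _ _ (begin
      M * w³ + M * k * (n * n)             ≤⟨ +-monoˡ-≤ _ (*-monoʳ-≤ M (≤-trans (≤-reflexive (eq w)) (*-monoʳ-≤ w (*-mono-≤ w≤n w≤n)))) ⟩
      M * (w * (n * n)) + M * k * (n * n)  ≡⟨ eq₁ M w k (n * n) ⟩
      M * ((w + k) * (n * n))              ≡⟨ cong (λ z → M * (z * (n * n))) w+k ⟩
      M * (n * (n * n))                    ≡⟨ cong (M *_) (sym (eq n)) ⟩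
      M * n³                               ≤⟨ w-large ⟩
      M * w³ + 3 * n³                      ≡⟨ eq₂ (M * w³) n ⟩
      M * w³ + 3 * n * (n * n)             ∎))
      where
      eq : ∀ n → n * n * n ≡ n * (n * n)
      eq = solve-∀
      eq₁ : ∀ M w k s → M * (w * s) + M * k * s ≡ M * ((w + k) * s)
      eq₁ = solve-∀
      eq₂ : ∀ a n → a + 3 * (n * n * n) ≡ a + 3 * n * (n * n)
      eq₂ = solve-∀
    12bk≤n : 12 * (b * k) ≤ n
    12bk≤n = *-cancelˡ-≤ 3 (≤-trans (≤-reflexive (eq b k)) Mk≤3n)
      where
      eq : ∀ b k → 3 * (12 * (b * k)) ≡ 36 * b * k
      eq = solve-∀
    n≤2w : n ≤ 2 * w
    n≤2w = +-cancelʳ-≤ n _ _ (begin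
      n + n                ≡⟨ cong (λ z → z + z) (sym w+k) ⟩
      w + k + (w + k)      ≡⟨ eq w k ⟩
      2 * w + 2 * k        ≤⟨ +-monoʳ-≤ (2 * w) (≤-trans (*-mono-≤ {2} {12} (m≤m+n 2 10) (m≤n*m k b)) 12bk≤n) ⟩
      2 * w + n ∎)
      where
      eq : ∀ w k → w + k + (w + k) ≡ 2 * w + 2 * k
      eq = solve-∀
    n²≤4w² : n * n ≤ 4 * (w * w)
    n²≤4w² = ≤-trans (*-mono-≤ n≤2w n≤2w) (≤-reflexive (eq w))
      where
      eq : ∀ w → 2 * w * (2 * w) ≡ 4 * (w * w)
      eq = solve-∀
    0<w : 0 < w
    0<w = *-cancelˡ-< 2 0 w (<-≤-trans (>-nonZero⁻¹ n) n≤2w)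
    instance
      w²≢0 : NonZero (w * w)
      w²≢0 = m*n≢0 w w {{>-nonZero 0<w}} {{>-nonZero 0<w}}
    close : (Θ * (w * w) ≤ n * n) ⊎ (Σ (V → Bool) λ x → Θ * iii x W ≤ n³ ×
      Θ * (D * (w * w * bad x W)) ≤ D * (errP * n⁵) + Θ * (errQ * (w³ * (w * w)))) →
      Σ (V → Bool) λ x → b * inconsistentEdges x vs ≤ n³
    -- W contains at least half of the vertices, so Θ ≥ 5 excludes this alternative.
    close (inj₁ no-pair) = ⊥-elim (<⇒≱ (*-monoˡ-< (w * w) {4} {5} ≤-refl)
      (≤-trans (*-monoˡ-≤ (w * w) Θ≥₄) (≤-trans no-pair n²≤4w²)))
    close (inj₂ (x , Θiii , Θbad)) = x , *-cancelˡ-≤ 4 (begin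
      4 * (b * inconsistentEdges x vs)
        ≤⟨ *-monoʳ-≤ 4 (*-monoʳ-≤ b (⊑-∑³-rest W⊑U _ (λ a c d → *-mono-≤ (𝟙≤1 (h a c d)) (𝟙≤1 _)) k (sym w+k))) ⟩
      4 * (b * (inconsistentEdges x W + 3 * (k * (n * n))))
        ≡⟨ cong (λ z → 4 * (b * (z + 3 * (k * (n * n))))) (inconsistent-split x W) ⟩
      4 * (b * (iii x W + bad x W + 3 * (k * (n * n)))) ≡⟨ eq₁ b (iii x W) (bad x W) k (n * n) ⟩
      4 * b * iii x W + 4 * b * bad x W + 12 * (b * k) * (n * n)
        ≤⟨ +-mono-≤ (+-mono-≤ (≤-trans (*-monoˡ-≤ (iii x W) Θ≥₃) Θiii) 4bbad) (*-monoˡ-≤ (n * n) 12bk≤n) ⟩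
      n³ + n³ + n * (n * n) ≤⟨ m≤m+n _ n³ ⟩
      n³ + n³ + n * (n * n) + n³ ≡⟨ eq₂ n ⟩
      4 * n³ ∎)
      where
      eq₁ : ∀ b i d k s → 4 * (b * (i + d + 3 * (k * s))) ≡ 4 * b * i + 4 * b * d + 12 * (b * k) * s
      eq₁ = solve-∀
      eq₂ : ∀ n → n * n * n + n * n * n + n * (n * n) + n * n * n ≡ 4 * (n * n * n)
      eq₂ = solve-∀
      eq₃ : ∀ Θ D s b → s * (Θ * (D * b)) ≡ Θ * (D * (s * b))
      eq₃ = solve-∀
      eq₄ : ∀ D P s m Θ Q → D * (P * (4 * s * m)) + Θ * (Q * (m * s)) ≡ s * (4 * (D * P) * m + Θ * (Q * m))
      eq₄ = solve-∀
      eq₅ : ∀ Θ Q m → Θ * m + Θ * (Q * m) ≡ Θ * ((1 + Q) * m)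
      eq₅ = solve-∀
      eq₆ : ∀ b Q d → (1 + Q) * (4 * b * d) ≡ 4 * b * (1 + Q) * d
      eq₆ = solve-∀
      -- n² ≤ 4w² lets w² cancel and Θ absorbs `errP`; the remaining `errQ` is compensated by D in
      -- the next step.
      Dbad : D * bad x W ≤ (1 + errQ) * n³
      Dbad = *-cancelˡ-≤ Θ {{Θ≢0}} (*-cancelˡ-≤ (w * w) (begin
        w * w * (Θ * (D * bad x W))              ≡⟨ eq₃ Θ D (w * w) (bad x W) ⟩
        Θ * (D * (w * w * bad x W))              ≤⟨ Θbad ⟩
        D * (errP * n⁵) + Θ * (errQ * (w³ * (w * w)))
          ≤⟨ +-mono-≤ (*-monoʳ-≤ D (*-monoʳ-≤ errP (*-monoˡ-≤ n³ n²≤4w²)))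
               (*-monoʳ-≤ Θ (*-monoʳ-≤ errQ (*-monoˡ-≤ (w * w) (*-mono-≤ (*-mono-≤ w≤n w≤n) w≤n)))) ⟩
        D * (errP * (4 * (w * w) * n³)) + Θ * (errQ * (n³ * (w * w))) ≡⟨ eq₄ D errP (w * w) n³ Θ errQ ⟩
        w * w * (4 * (D * errP) * n³ + Θ * (errQ * n³))
          ≤⟨ *-monoʳ-≤ (w * w) (+-monoˡ-≤ _ (*-monoˡ-≤ n³ Θ≥₂)) ⟩
        w * w * (Θ * n³ + Θ * (errQ * n³))       ≡⟨ cong (w * w *_) (eq₅ Θ errQ n³) ⟩
        w * w * (Θ * ((1 + errQ) * n³))          ∎))
      4bbad : 4 * b * bad x W ≤ n³
      4bbad = *-cancelˡ-≤ (1 + errQ) (begin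
        (1 + errQ) * (4 * b * bad x W)   ≡⟨ eq₆ b errQ (bad x W) ⟩
        4 * b * (1 + errQ) * bad x W     ≤⟨ *-monoˡ-≤ (bad x W) D≥ ⟩
        D * bad x W                      ≤⟨ Dbad ⟩
        (1 + errQ) * n³                  ∎)

-- Ordered triples and hyperedges

T→≡ : ∀ {b} → T b → b ≡ true
T→≡ {true} _ = refl

≡→T : ∀ {b} → b ≡ true → T b
≡→T refl = _

length-filter : ∀ {A : Set} (p : A → Bool) xs → length (filterᵇ p xs) ≡ ∑ xs λ x → 𝟙 (p x)
length-filter p xs = trans (length-∑ (filterᵇ p xs)) (trans (∑-filter xs p _) (∑-cong xs λ x → *-identityʳ _))

∈-filterᵇ : ∀ {A : Set} (p : A → Bool) {x} xs → x ∈ filterᵇ p xs → p x ≡ true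
∈-filterᵇ p (y ∷ xs) i with p y in eq
∈-filterᵇ p (y ∷ xs) (here refl) | true = eq
∈-filterᵇ p (y ∷ xs) (there i)   | true = ∈-filterᵇ p xs i
... | false = ∈-filterᵇ p xs i

any-≤∑ : ∀ {A : Set} (p : A → Bool) xs → 𝟙 (any p xs) ≤ ∑ xs λ x → 𝟙 (p x)
any-≤∑ p [] = z≤n
any-≤∑ p (x ∷ xs) with p x
... | true  = s≤s z≤n
... | false = any-≤∑ p xs

any-true : ∀ {A : Set} (p : A → Bool) {x} xs → x ∈ xs → p x ≡ true → any p xs ≡ true
any-true p (x ∷ xs) (here refl) e rewrite e = refl
any-true p (y ∷ xs) (there i) e with p y
... | true  = refl
... | false = any-true p xs i e

any-≡∑ : ∀ {A : Set} (p : A → Bool) xs → ∑ xs (λ x → 𝟙 (p x)) ≤ 1 → 𝟙 (any p xs) ≡ ∑ xs λ x → 𝟙 (p x)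
any-≡∑ p xs le with any p xs in eq
... | true  = ≤-antisym (≤-trans (≤-reflexive (cong 𝟙 (sym eq))) (any-≤∑ p xs)) le
... | false = sym (trans (∑-cong∈ xs λ x i → 𝟙≡0 x i) (∑-zero xs))
  where
  𝟙≡0 : ∀ x → x ∈ xs → 𝟙 (p x) ≡ 0
  𝟙≡0 x i with p x in e
  ... | true  with () ← trans (sym eq) (any-true p xs i e)
  ... | false = refl
  ∑-cong∈ : ∀ xs {f g} → (∀ x → x ∈ xs → f x ≡ g x) → ∑ xs f ≡ ∑ xs g
  ∑-cong∈ xs e = ≤-antisym (∑-mono∈ xs λ x i → ≤-reflexive (e x i)) (∑-mono∈ xs λ x i → ≤-reflexive (sym (e x i)))

𝟙-injective : ∀ {a b} → 𝟙 a ≡ 𝟙 b → a ≡ b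
𝟙-injective {true}  {true}  _ = refl
𝟙-injective {false} {false} _ = refl

𝟙-∨ : ∀ a b → 𝟙 (a ∨ b) ≤ 𝟙 a + 𝟙 b
𝟙-∨ true  b = s≤s z≤n
𝟙-∨ false b = ≤-refl

count : ∀ {m} → Vec Bool m → ℕ
count []      = 0
count (b ∷ v) = 𝟙 b + count v

_⊆ᵇ_ : ∀ {m} → Vec Bool m → Vec Bool m → Bool
[]      ⊆ᵇ []      = true
(a ∷ v) ⊆ᵇ (b ∷ w) = (not a ∨ b) ∧ (v ⊆ᵇ w)

_∩_ : ∀ {m} → Vec Bool m → Vec Bool m → Vec Bool m
_∩_ = zipWith _∧_

module _ {A : Set} where

  -- Edge sums read directly off the bit vector, so that 3-graphs can be compared and changed bit by
  -- bit over a fixed list of triples.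
  sumOn : (ts : List A) → Vec Bool (length ts) → (A → ℕ) → ℕ
  sumOn []       []      f = 0
  sumOn (t ∷ ts) (b ∷ v) f = 𝟙 b * f t + sumOn ts v f

  mask : (ts : List A) → (A → Bool) → Vec Bool (length ts)
  mask []       P = []
  mask (t ∷ ts) P = P t ∷ mask ts P

  ∑-edges : ∀ ts (v : Vec Bool (length ts)) f → ∑ (map proj₁ (filterᵇ proj₂ (zip ts (toList v)))) f ≡ sumOn ts v f
  ∑-edges []       []          f = refl
  ∑-edges (t ∷ ts) (true ∷ v)  f = cong₂ _+_ (sym (+-identityʳ (f t))) (∑-edges ts v f)
  ∑-edges (t ∷ ts) (false ∷ v) f = ∑-edges ts v f

  sumOn-mono∈ : ∀ ts v {f g} → (∀ t → t ∈ ts → f t ≤ g t) → sumOn ts v f ≤ sumOn ts v g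
  sumOn-mono∈ []       []      e = z≤n
  sumOn-mono∈ (t ∷ ts) (b ∷ v) e = +-mono-≤ (*-monoʳ-≤ (𝟙 b) (e t (here refl))) (sumOn-mono∈ ts v λ t i → e t (there i))

  sumOn-cong∈ : ∀ ts v {f g} → (∀ t → t ∈ ts → f t ≡ g t) → sumOn ts v f ≡ sumOn ts v g
  sumOn-cong∈ ts v e = ≤-antisym (sumOn-mono∈ ts v λ t i → ≤-reflexive (e t i)) (sumOn-mono∈ ts v λ t i → ≤-reflexive (sym (e t i)))

  sumOn-cong : ∀ ts v {f g} → (∀ t → f t ≡ g t) → sumOn ts v f ≡ sumOn ts v g
  sumOn-cong ts v e = sumOn-cong∈ ts v λ t _ → e t

  sumOn≤∑ : ∀ ts v f → sumOn ts v f ≤ ∑ ts f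
  sumOn≤∑ []       []      f = z≤n
  sumOn≤∑ (t ∷ ts) (b ∷ v) f = +-mono-≤ (≤-trans (*-monoˡ-≤ (f t) (𝟙≤1 b)) (≤-reflexive (*-identityˡ (f t)))) (sumOn≤∑ ts v f)

  sumOn-⊆ : ∀ ts v w f → v ⊆ᵇ w ≡ true → sumOn ts v f ≤ sumOn ts w f
  sumOn-⊆ []       []          []          f e = z≤n
  sumOn-⊆ (t ∷ ts) (true ∷ v)  (true ∷ w)  f e = +-monoʳ-≤ _ (sumOn-⊆ ts v w f e)
  sumOn-⊆ (t ∷ ts) (false ∷ v) (b ∷ w)     f e = ≤-trans (sumOn-⊆ ts v w f e) (m≤n+m _ (𝟙 b * f t))

  sumOn-* : ∀ ts v k f → sumOn ts v (λ t → k * f t) ≡ k * sumOn ts v f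
  sumOn-* []       []      k f = sym (*-zeroʳ k)
  sumOn-* (t ∷ ts) (b ∷ v) k f = trans (cong (𝟙 b * (k * f t) +_) (sumOn-* ts v k f)) (lem (𝟙 b) k (f t) (sumOn ts v f))
    where
    lem : ∀ b k f s → b * (k * f) + k * s ≡ k * (b * f + s)
    lem = solve-∀

  sumOn-∑ : ∀ {B : Set} ts v (xs : List B) (f : B → A → ℕ) → ∑ xs (λ x → sumOn ts v (f x)) ≡ sumOn ts v (λ t → ∑ xs λ x → f x t)
  sumOn-∑ []       []      xs f = ∑-zero xs
  sumOn-∑ (t ∷ ts) (b ∷ v) xs f = trans (∑-+ xs _ _) (cong₂ _+_ (∑-*ˡ xs (𝟙 b) _) (sumOn-∑ ts v xs f))

  sumOn-∩-mask : ∀ ts v P f → sumOn ts (v ∩ mask ts P) f ≡ sumOn ts v (λ t → 𝟙 (P t) * f t)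
  sumOn-∩-mask []       []      P f = refl
  sumOn-∩-mask (t ∷ ts) (b ∷ v) P f = cong₂ _+_ (trans (cong (_* f t) (𝟙-∧ b (P t))) (*-assoc (𝟙 b) _ _)) (sumOn-∩-mask ts v P f)

  count-sumOn : ∀ ts (v : Vec Bool (length ts)) → count v ≡ sumOn ts v (λ _ → 1)
  count-sumOn []       []      = refl
  count-sumOn (t ∷ ts) (b ∷ v) = cong₂ _+_ (sym (*-identityʳ (𝟙 b))) (count-sumOn ts v)

  count-mask : ∀ ts P → count (mask ts P) ≡ ∑ ts (λ t → 𝟙 (P t))
  count-mask []       P = refl
  count-mask (t ∷ ts) P = cong (𝟙 (P t) +_) (count-mask ts P)

=ᶠ-refl : ∀ {n} (a : Fin n) → a =ᶠ a ≡ true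
=ᶠ-refl a = T→≡ (≡⇒≡ᵇ (toℕ a) (toℕ a) refl)

=ᶠ⇒≡ : ∀ {n} (a b : Fin n) → a =ᶠ b ≡ true → a ≡ b
=ᶠ⇒≡ a b e = toℕ-injective (≡ᵇ⇒≡ (toℕ a) (toℕ b) (≡→T e))

≢⇒=ᶠ : ∀ {n} {a b : Fin n} → a ≢ b → a =ᶠ b ≡ false
≢⇒=ᶠ {a = a} {b} ne with a =ᶠ b in e
... | true  = ⊥-elim (ne (=ᶠ⇒≡ a b e))
... | false = refl

=ᶠ-sym : ∀ {n} (a b : Fin n) → a =ᶠ b ≡ b =ᶠ a
=ᶠ-sym a b with b =ᶠ a in e
... | true  = trans (cong (a =ᶠ_) (=ᶠ⇒≡ b a e)) (=ᶠ-refl a)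
... | false = ≢⇒=ᶠ {a = a} {b} λ { refl → case (trans (sym (=ᶠ-refl a)) e) }
  where
  case : true ≡ false → ⊥
  case ()

length-allFin : ∀ n → length (allFin n) ≡ n
length-allFin n = length-tabulate {n = n} id

-- Stated for arbitrary m in ℕ, so that the induction can strip `suc` from both n and m.
∑-Fin-≡ᵇ : ∀ n m → ∑ (allFin n) (λ a → 𝟙 (toℕ a ≡ᵇ m)) ≤ 1
∑-Fin-≡ᵇ zero    m = z≤n
∑-Fin-≡ᵇ (suc n) m = subst (λ l → 𝟙 (0 ≡ᵇ m) + ∑ l (λ a → 𝟙 (toℕ a ≡ᵇ m)) ≤ 1) (map-tabulate {n = n} id Fin.suc)
  (≤-trans (≤-reflexive (cong (𝟙 (0 ≡ᵇ m) +_) (∑-map (allFin n) Fin.suc _))) (go m))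
  where
  go : ∀ m → 𝟙 (0 ≡ᵇ m) + ∑ (allFin n) (λ a → 𝟙 (suc (toℕ a) ≡ᵇ m)) ≤ 1
  go zero    = ≤-reflexive (cong suc (∑-zero (allFin n)))
  go (suc m) = ∑-Fin-≡ᵇ n m

∑-≤two : ∀ {n} (f : Fin n → ℕ) {i j} → i ≢ j → f i + f j ≤ ∑ (allFin n) f
∑-≤two {n} f {i} {j} i≢j = begin
  f i + f j ≤⟨ +-mono-≤ (pick i) (pick j) ⟩
  ∑ (allFin n) (λ a → 𝟙 (a =ᶠ i) * f a) + ∑ (allFin n) (λ a → 𝟙 (a =ᶠ j) * f a) ≡⟨ sym (∑-+ (allFin n) _ _) ⟩
  ∑ (allFin n) (λ a → 𝟙 (a =ᶠ i) * f a + 𝟙 (a =ᶠ j) * f a) ≤⟨ ∑-mono (allFin n) one ⟩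
  ∑ (allFin n) f ∎
  where
  open ≤-Reasoning
  pick : ∀ i → f i ≤ ∑ (allFin n) (λ a → 𝟙 (a =ᶠ i) * f a)
  pick i = ≤-trans (≤-reflexive (trans (sym (*-identityˡ (f i))) (cong (λ b → 𝟙 b * f i) (sym (=ᶠ-refl i)))))
    (∑-∈ (λ a → 𝟙 (a =ᶠ i) * f a) (∈-allFin i))
  one : ∀ a → 𝟙 (a =ᶠ i) * f a + 𝟙 (a =ᶠ j) * f a ≤ f a
  one a with a =ᶠ i in e₁ | a =ᶠ j in e₂
  ... | true  | true  = ⊥-elim (i≢j (trans (sym (=ᶠ⇒≡ a i e₁)) (=ᶠ⇒≡ a j e₂)))
  ... | true  | false = ≤-reflexive (trans (+-identityʳ _) (+-identityʳ _))
  ... | false | true  = ≤-reflexive (+-identityʳ _)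
  ... | false | false = z≤n

∑-≤three : ∀ {n} (f : Fin n → ℕ) {i j k} → i ≢ j → i ≢ k → j ≢ k → f i + (f j + f k) ≤ ∑ (allFin n) f
∑-≤three {n} f {i} {j} {k} i≢j i≢k j≢k = begin
  f i + (f j + f k)    ≡⟨ cong₂ _+_ (sym (here′ i)) (cong₂ _+_ (sym (there′ i≢j)) (sym (there′ i≢k))) ⟩
  g₁ i + (g₂ j + g₂ k) ≤⟨ +-mono-≤ (∑-∈ g₁ (∈-allFin i)) (∑-≤two g₂ j≢k) ⟩
  ∑ (allFin n) g₁ + ∑ (allFin n) g₂ ≡⟨ sym (∑-+ (allFin n) g₁ g₂) ⟩
  ∑ (allFin n) (λ a → g₁ a + g₂ a) ≡⟨ ∑-cong (allFin n) both ⟩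
  ∑ (allFin n) f ∎
  where
  open ≤-Reasoning
  g₁ g₂ : Fin n → ℕ
  g₁ a = 𝟙 (a =ᶠ i) * f a
  g₂ a = 𝟙 (not (a =ᶠ i)) * f a
  here′ : ∀ i → 𝟙 (i =ᶠ i) * f i ≡ f i
  here′ i rewrite =ᶠ-refl i = +-identityʳ (f i)
  there′ : ∀ {j} → i ≢ j → g₂ j ≡ f j
  there′ {j} ne rewrite ≢⇒=ᶠ (≢-sym ne) = +-identityʳ (f j)
  both : ∀ a → g₁ a + g₂ a ≡ f a
  both a with a =ᶠ i
  ... | true  = trans (+-identityʳ _) (+-identityʳ _)
  ... | false = +-identityʳ (f a)

Sorted : ∀ {n} → Triple n → Set
Sorted (i , j , k) = toℕ i < toℕ j × toℕ j < toℕ k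

∈-triples : ∀ {n} {t : Triple n} → t ∈ triples n → Sorted t
∈-triples {n} t∈ with find (∈-concatMap⁻ _ {xs = allFin n} t∈)
... | i , _ , t∈′ with find (∈-concatMap⁻ _ {xs = filterᵇ (λ j → i <ᶠ j) (allFin n)} t∈′)
... | j , j∈ , t∈″ with ∈-map⁻ _ t∈″
... | k , k∈ , refl = <ᵇ⇒< _ _ (≡→T (∈-filterᵇ _ (allFin n) j∈)) , <ᵇ⇒< _ _ (≡→T (∈-filterᵇ _ (allFin n) k∈))

∑-triples : ∀ {n} f → ∑ (triples n) f ≡ ∑³ (allFin n) (λ i j k → 𝟙 (i <ᶠ j) * (𝟙 (j <ᶠ k) * f (i , j , k)))
∑-triples {n} f = trans (∑-concatMap (allFin n) _ f) (∑-cong (allFin n) λ i →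
  trans (∑-concatMap (filterᵇ (λ j → i <ᶠ j) (allFin n)) _ f) (trans (∑-filter (allFin n) _ _) (∑-cong (allFin n) λ j →
  trans (cong (𝟙 (i <ᶠ j) *_) (trans (∑-map (filterᵇ (λ k → j <ᶠ k) (allFin n)) _ f) (∑-filter (allFin n) _ _)))
  (sym (∑-*ˡ (allFin n) (𝟙 (i <ᶠ j)) _)))))

∑-triples≤ : ∀ {n} f → ∑ (triples n) f ≤ ∑³ (allFin n) (λ i j k → f (i , j , k))
∑-triples≤ {n} f = ≤-trans (≤-reflexive (∑-triples f)) (∑³-mono (allFin n) λ i j k →
  ≤-trans (*-mono-≤ (𝟙≤1 (i <ᶠ j)) (*-monoˡ-≤ (f (i , j , k)) (𝟙≤1 (j <ᶠ k)))) (≤-reflexive (lem (f (i , j , k)))))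
  where
  lem : ∀ x → 1 * (1 * x) ≡ x
  lem = solve-∀

incident : ∀ {n} → Fin n → Fin n → Fin n → Triple n → Bool
incident a b c t = distinct3 a b c ∧ inTriple a t ∧ inTriple b t ∧ inTriple c t

∨-true : ∀ {a b} → a ∨ b ≡ true → a ≡ true ⊎ b ≡ true
∨-true {true}  _ = inj₁ refl
∨-true {false} e = inj₂ e

inTriple⇒ : ∀ {n} (a i j k : Fin n) → inTriple a (i , j , k) ≡ true → a ≡ i ⊎ a ≡ j ⊎ a ≡ k
inTriple⇒ a i j k e with ∨-true {a =ᶠ i} e
... | inj₁ p = inj₁ (=ᶠ⇒≡ a i p)
... | inj₂ e′ with ∨-true {a =ᶠ j} e′
...   | inj₁ p = inj₂ (inj₁ (=ᶠ⇒≡ a j p))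
...   | inj₂ p = inj₂ (inj₂ (=ᶠ⇒≡ a k p))

distinct3⇒ : ∀ {n} (a b c : Fin n) → distinct3 a b c ≡ true → a ≢ b × a ≢ c × b ≢ c
distinct3⇒ a b c e with a =ᶠ b in p | a =ᶠ c in q | b =ᶠ c in r
... | false | false | false = (λ { refl → absurd (trans (sym p) (=ᶠ-refl a)) }) ,
  (λ { refl → absurd (trans (sym q) (=ᶠ-refl a)) }) , (λ { refl → absurd (trans (sym r) (=ᶠ-refl b)) })
  where
  absurd : false ≡ true → ⊥
  absurd ()

⇒distinct3 : ∀ {n} {a b c : Fin n} → a ≢ b → a ≢ c → b ≢ c → distinct3 a b c ≡ true
⇒distinct3 p q r rewrite ≢⇒=ᶠ p | ≢⇒=ᶠ q | ≢⇒=ᶠ r = refl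

incident-swap₁ : ∀ {n} (a b c : Fin n) t → incident a b c t ≡ incident b a c t
incident-swap₁ a b c t rewrite =ᶠ-sym a b = ∧-swap (not (b =ᶠ a)) (not (a =ᶠ c)) (not (b =ᶠ c)) (inTriple a t) (inTriple b t) (inTriple c t)
  where
  ∧-swap : ∀ p q r x y z → (p ∧ q ∧ r) ∧ x ∧ y ∧ z ≡ (p ∧ r ∧ q) ∧ y ∧ x ∧ z
  ∧-swap false q     r     x     y     z = refl
  ∧-swap true  false false x     y     z = refl
  ∧-swap true  false true  x     y     z = refl
  ∧-swap true  true  false x     y     z = refl
  ∧-swap true  true  true  false false z = refl
  ∧-swap true  true  true  false true  z = refl
  ∧-swap true  true  true  true  false z = refl
  ∧-swap true  true  true  true  true  z = refl

incident-swap₂ : ∀ {n} (a b c : Fin n) t → incident a b c t ≡ incident a c b t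
incident-swap₂ a b c t rewrite =ᶠ-sym b c = ∧-swap (not (a =ᶠ b)) (not (a =ᶠ c)) (not (c =ᶠ b)) (inTriple a t) (inTriple b t) (inTriple c t)
  where
  ∧-swap : ∀ p q r x y z → (p ∧ q ∧ r) ∧ x ∧ y ∧ z ≡ (q ∧ p ∧ r) ∧ x ∧ z ∧ y
  ∧-swap false false r     x     y     z     = refl
  ∧-swap false true  r     x     y     z     = refl
  ∧-swap true  false r     x     y     z     = refl
  ∧-swap true  true  false x     y     z     = refl
  ∧-swap true  true  true  false y     z     = refl
  ∧-swap true  true  true  true  false false = refl
  ∧-swap true  true  true  true  false true  = refl
  ∧-swap true  true  true  true  true  false = refl
  ∧-swap true  true  true  true  true  true  = refl

incident-sorted : ∀ {n} (a b c i j k : Fin n) → toℕ a < toℕ b → toℕ b < toℕ c → toℕ i < toℕ j → toℕ j < toℕ k →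
  a ≡ i ⊎ a ≡ j ⊎ a ≡ k → b ≡ i ⊎ b ≡ j ⊎ b ≡ k → c ≡ i ⊎ c ≡ j ⊎ c ≡ k → a ≡ i × b ≡ j × c ≡ k
incident-sorted a b c i j k a<b b<c i<j j<k a∈ b∈ c∈ = a≡i , b≡j , c≡k
  where
  i≤ : ∀ {a} → a ≡ i ⊎ a ≡ j ⊎ a ≡ k → toℕ i ≤ toℕ a
  i≤ (inj₁ refl)        = ≤-refl
  i≤ (inj₂ (inj₁ refl)) = <⇒≤ i<j
  i≤ (inj₂ (inj₂ refl)) = <⇒≤ (<-trans i<j j<k)
  i<b : toℕ i < toℕ b
  i<b = ≤-<-trans (i≤ a∈) a<b
  elim : ∀ {x} {R : Set} → (x ≡ i → R) → (x ≡ j → R) → (x ≡ k → R) → x ≡ i ⊎ x ≡ j ⊎ x ≡ k → R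
  elim f g h (inj₁ e)        = f e
  elim f g h (inj₂ (inj₁ e)) = g e
  elim f g h (inj₂ (inj₂ e)) = h e
  b≢i : b ≢ i
  b≢i refl = <-irrefl refl i<b
  j≤b : toℕ j ≤ toℕ b
  j≤b = elim (λ e → ⊥-elim (b≢i e)) (λ { refl → ≤-refl }) (λ { refl → <⇒≤ j<k }) b∈
  c≡k : c ≡ k
  c≡k = elim (λ { refl → ⊥-elim (<-asym b<c i<b) }) (λ { refl → ⊥-elim (<⇒≱ b<c j≤b) }) id c∈
  b≡j : b ≡ j
  b≡j = elim (λ e → ⊥-elim (b≢i e)) id (λ e → ⊥-elim (<-irrefl (cong toℕ (trans e (sym c≡k))) b<c)) b∈
  a≡i : a ≡ i
  a≡i = elim id (λ e → ⊥-elim (<-irrefl (cong toℕ (trans e (sym b≡j))) a<b))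
    (λ e → ⊥-elim (<-irrefl (cong toℕ (trans e (sym c≡k))) (<-trans a<b b<c))) a∈

incident≤1-sorted : ∀ {n} (a b c : Fin n) → toℕ a < toℕ b → toℕ b < toℕ c → ∑ (triples n) (λ t → 𝟙 (incident a b c t)) ≤ 1
incident≤1-sorted {n} a b c a<b b<c = begin
  ∑ (triples n) (λ t → 𝟙 (incident a b c t)) ≤⟨ ∑-mono∈ (triples n) (λ t i → le t (∈-triples i)) ⟩
  ∑ (triples n) is ≤⟨ ∑-triples≤ is ⟩
  ∑³ (allFin n) (λ i j k → 𝟙 (i =ᶠ a) * (𝟙 (j =ᶠ b) * 𝟙 (k =ᶠ c))) ≡⟨ ∑³-product (allFin n) (λ i → 𝟙 (i =ᶠ a)) (λ j → 𝟙 (j =ᶠ b)) (λ k → 𝟙 (k =ᶠ c)) ⟩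
  ∑ (allFin n) (λ i → 𝟙 (i =ᶠ a)) * (∑ (allFin n) (λ j → 𝟙 (j =ᶠ b)) * ∑ (allFin n) (λ k → 𝟙 (k =ᶠ c)))
    ≤⟨ *-mono-≤ (∑-Fin-≡ᵇ n (toℕ a)) (*-mono-≤ (∑-Fin-≡ᵇ n (toℕ b)) (∑-Fin-≡ᵇ n (toℕ c))) ⟩
  1 ∎
  where
  open ≤-Reasoning
  is : Triple n → ℕ
  is (i , j , k) = 𝟙 (i =ᶠ a) * (𝟙 (j =ᶠ b) * 𝟙 (k =ᶠ c))
  le : ∀ t → Sorted t → 𝟙 (incident a b c t) ≤ is t
  le t@(i , j , k) (i<j , j<k) with incident a b c t in e
  ... | false = z≤n
  ... | true with ∧-true {distinct3 a b c} e
  ...   | _ , e₁ with ∧-true {inTriple a t} e₁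
  ...     | a∈ , e₂ with ∧-true {inTriple b t} e₂
  ...       | b∈ , c∈ with incident-sorted a b c i j k a<b b<c i<j j<k (inTriple⇒ a i j k a∈) (inTriple⇒ b i j k b∈) (inTriple⇒ c i j k c∈)
  ...         | refl , refl , refl rewrite =ᶠ-refl i | =ᶠ-refl j | =ᶠ-refl k = ≤-refl

-- Transpositions reduce to increasing a, b, c, where an incident sorted triple must be (a , b , c)
-- itself.
incident≤1 : ∀ {n} (a b c : Fin n) → ∑ (triples n) (λ t → 𝟙 (incident a b c t)) ≤ 1
incident≤1 {n} a b c with distinct3 a b c in d
... | false = ≤-trans (≤-reflexive (∑-zero (triples n))) z≤n
... | true  = subst (λ z → ∑ (triples n) (λ t → 𝟙 (z ∧ inTriple a t ∧ inTriple b t ∧ inTriple c t)) ≤ 1) d (sort a b c (distinct3⇒ a b c d))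
  where
  U : Fin n → Fin n → Fin n → Set
  U a b c = ∑ (triples n) (λ t → 𝟙 (incident a b c t)) ≤ 1
  sw₁ : ∀ a b c → U a b c → U b a c
  sw₁ a b c = subst (_≤ 1) (∑-cong (triples n) λ t → cong 𝟙 (incident-swap₁ a b c t))
  sw₂ : ∀ a b c → U a b c → U a c b
  sw₂ a b c = subst (_≤ 1) (∑-cong (triples n) λ t → cong 𝟙 (incident-swap₂ a b c t))
  sort : ∀ a b c → a ≢ b × a ≢ c × b ≢ c → U a b c
  sort a b c (ab , ac , bc) with <-cmp (toℕ a) (toℕ b) | <-cmp (toℕ b) (toℕ c) | <-cmp (toℕ a) (toℕ c)
  ... | tri≈ _ e _ | _ | _ = ⊥-elim (ab (toℕ-injective e))
  ... | _ | tri≈ _ e _ | _ = ⊥-elim (bc (toℕ-injective e))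
  ... | _ | _ | tri≈ _ e _ = ⊥-elim (ac (toℕ-injective e))
  ... | tri< p _ _ | tri< q _ _ | _          = incident≤1-sorted a b c p q
  ... | tri< p _ _ | tri> _ _ q | tri< r _ _ = sw₂ a c b (incident≤1-sorted a c b r q)
  ... | tri< p _ _ | tri> _ _ q | tri> _ _ r = sw₂ a c b (sw₁ c a b (incident≤1-sorted c a b r p))
  ... | tri> _ _ p | tri< q _ _ | tri< r _ _ = sw₁ b a c (incident≤1-sorted b a c p r)
  ... | tri> _ _ p | tri< q _ _ | tri> _ _ r = sw₁ b a c (sw₂ b c a (incident≤1-sorted b c a q r))
  ... | tri> _ _ p | tri> _ _ q | _          = sw₁ b a c (sw₂ b c a (sw₁ c b a (incident≤1-sorted c b a q p)))

-- At most one listed triple is incident with a, b, c, so the existential in `hasEdge` equals a sum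
-- over bits.
hasEdge-sum : ∀ {n} (H : Graph3 n) a b c → 𝟙 (hasEdge {n} H a b c) ≡ sumOn (triples n) H (λ t → 𝟙 (incident a b c t))
hasEdge-sum {n} H a b c = trans (trans (cong 𝟙 (distrib (edges {n} H))) (any-≡∑ (incident a b c) (edges {n} H)
    (≤-trans (≤-reflexive (∑-edges (triples n) H _)) (≤-trans (sumOn≤∑ (triples n) H _) (incident≤1 a b c)))))
  (∑-edges (triples n) H _)
  where
  distrib : ∀ ts → distinct3 a b c ∧ any (λ t → inTriple a t ∧ inTriple b t ∧ inTriple c t) ts ≡ any (incident a b c) ts
  distrib ts with distinct3 a b c
  ... | true  = refl
  distrib []       | false = refl
  distrib (t ∷ ts) | false = distrib-false ts
    where
    distrib-false : ∀ (ts : List (Triple n)) → false ≡ any (λ _ → false) ts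
    distrib-false []       = refl
    distrib-false (_ ∷ ts) = distrib-false ts

hasEdge-swap₁ : ∀ {n} (H : Graph3 n) a b c → hasEdge {n} H a b c ≡ hasEdge {n} H b a c
hasEdge-swap₁ {n} H a b c = 𝟙-injective (trans (hasEdge-sum H a b c)
  (trans (sumOn-cong (triples n) H λ t → cong 𝟙 (incident-swap₁ a b c t)) (sym (hasEdge-sum H b a c))))

hasEdge-swap₂ : ∀ {n} (H : Graph3 n) a b c → hasEdge {n} H a b c ≡ hasEdge {n} H a c b
hasEdge-swap₂ {n} H a b c = 𝟙-injective (trans (hasEdge-sum H a b c)
  (trans (sumOn-cong (triples n) H λ t → cong 𝟙 (incident-swap₂ a b c t)) (sym (hasEdge-sum H a c b))))

orderings : ∀ {n} → (Fin n → Fin n → Fin n → ℕ) → Triple n → ℕ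
orderings {n} g t = ∑³ (allFin n) λ a b c → 𝟙 (incident a b c t) * g a b c

-- Double counting: the sum over ordered triples of vertices is exchanged with the sum over bits.
∑-hasEdge : ∀ {n} (H : Graph3 n) g → ∑³ (allFin n) (λ a b c → 𝟙 (hasEdge {n} H a b c) * g a b c) ≡ sumOn (triples n) H (orderings g)
∑-hasEdge {n} H g = trans (∑³-cong (allFin n) λ a b c → trans (cong (_* g a b c) (hasEdge-sum H a b c))
    (trans (*-comm _ (g a b c)) (trans (sym (sumOn-* (triples n) H (g a b c) _)) (sumOn-cong (triples n) H λ t → *-comm (g a b c) _))))
  (trans (∑-cong (allFin n) λ a → trans (∑-cong (allFin n) λ b → sumOn-∑ (triples n) H (allFin n) _) (sumOn-∑ (triples n) H (allFin n) _))
  (sumOn-∑ (triples n) H (allFin n) _))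

∈³⇒ : ∀ {n} {a b c : Fin n} t → a ≢ b → a ≢ c → b ≢ c → inTriple a t ≡ true → inTriple b t ≡ true → inTriple c t ≡ true →
  incident a b c t ≡ true
∈³⇒ t ab ac bc p q r rewrite ⇒distinct3 ab ac bc | p | q | r = refl

∈-fst : ∀ {n} (i j k : Fin n) → inTriple i (i , j , k) ≡ true
∈-fst i j k rewrite =ᶠ-refl i = refl

∈-snd : ∀ {n} (i j k : Fin n) → inTriple j (i , j , k) ≡ true
∈-snd i j k rewrite =ᶠ-refl j with j =ᶠ i
... | true  = refl
... | false = refl

∈-thd : ∀ {n} (i j k : Fin n) → inTriple k (i , j , k) ≡ true
∈-thd i j k rewrite =ᶠ-refl k with k =ᶠ i | k =ᶠ j
... | true  | _     = refl
... | false | true  = refl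
... | false | false = refl

module _ {n} (g : Fin n → Fin n → Fin n → ℕ) where

  private
    F : Triple n → Fin n → Fin n → Fin n → ℕ
    F t a b c = 𝟙 (incident a b c t) * g a b c

  orderings≥1 : ∀ t → Sorted t → g (proj₁ t) (proj₁ (proj₂ t)) (proj₂ (proj₂ t)) ≤ orderings g t
  orderings≥1 t@(i , j , k) (i<j , j<k) = ≤-trans (≤-reflexive (sym F≡))
    (≤-trans (∑-∈ (F t i j) (∈-allFin k)) (≤-trans (∑-∈ (λ b → ∑ (allFin n) (F t i b)) (∈-allFin j)) (∑-∈ (λ a → ∑² (allFin n) (F t a)) (∈-allFin i))))
    where
    F≡ : F t i j k ≡ g i j k
    F≡ rewrite ∈³⇒ {a = i} {j} {k} t (λ e → <⇒≢ i<j (cong toℕ e)) (λ e → <⇒≢ (<-trans i<j j<k) (cong toℕ e))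
      (λ e → <⇒≢ j<k (cong toℕ e)) (∈-fst i j k) (∈-snd i j k) (∈-thd i j k) = +-identityʳ _

-- All six orderings are exhibited, as this factor has to be exact: it turns 4n³/9 ordered triples
-- into 2n³/27 edges.
6≤orderings : ∀ {n} (t : Triple n) → Sorted t → 6 ≤ orderings (λ _ _ _ → 1) t
6≤orderings {n} t@(i , j , k) (i<j , j<k) =
  ≤-trans (+-mono-≤ (two i≢j i≢k j≢k i∈ j∈ k∈) (+-mono-≤ (two (≢-sym i≢j) j≢k i≢k j∈ i∈ k∈) (two (≢-sym i≢k) (≢-sym j≢k) i≢j k∈ i∈ j∈)))
    (∑-≤three (λ a → ∑² (allFin n) (F a)) i≢j i≢k j≢k)
  where
  F : Fin n → Fin n → Fin n → ℕ
  F a b c = 𝟙 (incident a b c t) * 1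
  i∈ = ∈-fst i j k
  j∈ = ∈-snd i j k
  k∈ = ∈-thd i j k
  i≢j : i ≢ j
  i≢j e = <⇒≢ i<j (cong toℕ e)
  j≢k : j ≢ k
  j≢k e = <⇒≢ j<k (cong toℕ e)
  i≢k : i ≢ k
  i≢k e = <⇒≢ (<-trans i<j j<k) (cong toℕ e)
  one : ∀ {a b c} → a ≢ b → a ≢ c → b ≢ c → inTriple a t ≡ true → inTriple b t ≡ true → inTriple c t ≡ true → 1 ≤ ∑ (allFin n) (F a b)
  one {a} {b} {c} ab ac bc p q r = ≤-trans (≤-reflexive (cong (λ z → 𝟙 z * 1) (sym (∈³⇒ t ab ac bc p q r)))) (∑-∈ (F a b) (∈-allFin c))
  two : ∀ {a b c} → a ≢ b → a ≢ c → b ≢ c → inTriple a t ≡ true → inTriple b t ≡ true → inTriple c t ≡ true → 2 ≤ ∑² (allFin n) (F a)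
  two {a} ab ac bc p q r = ≤-trans (+-mono-≤ (one ab ac bc p q r) (one ac ab (≢-sym bc) p r q)) (∑-≤two (λ b → ∑ (allFin n) (F a b)) bc)

-- Each coordinate has at most three choices. The crude 3³ affects only the constants `R` and
-- `geometric`.
orderings≤27 : ∀ {n} g (t : Triple n) → (∀ a b c → g a b c ≤ 1) → orderings g t ≤ 27
orderings≤27 {n} g t@(i , j , k) g≤1 = begin
  orderings g t ≤⟨ ∑³-mono (allFin n) (λ a b c → ≤-trans (*-monoʳ-≤ (𝟙 (incident a b c t)) (g≤1 a b c))
                     (≤-trans (≤-reflexive (*-identityʳ _)) (drop (distinct3 a b c) (inTriple a t) (inTriple b t) (inTriple c t)))) ⟩
  ∑³ (allFin n) (λ a b c → 𝟙 (inTriple a t) * (𝟙 (inTriple b t) * 𝟙 (inTriple c t))) ≡⟨ ∑³-product (allFin n) _ _ _ ⟩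
  S * (S * S) ≤⟨ *-mono-≤ S≤3 (*-mono-≤ S≤3 S≤3) ⟩
  27 ∎
  where
  open ≤-Reasoning
  S = ∑ (allFin n) λ a → 𝟙 (inTriple a t)
  drop : ∀ d p q r → 𝟙 (d ∧ p ∧ q ∧ r) ≤ 𝟙 p * (𝟙 q * 𝟙 r)
  drop false p     q     r     = z≤n
  drop true  false q     r     = z≤n
  drop true  true  false r     = z≤n
  drop true  true  true  false = z≤n
  drop true  true  true  true  = ≤-refl
  S≤3 : S ≤ 3
  S≤3 = ≤-trans (∑-mono (allFin n) λ a → ≤-trans (𝟙-∨ (a =ᶠ i) _) (+-monoʳ-≤ (𝟙 (a =ᶠ i)) (𝟙-∨ (a =ᶠ j) _)))
    (≤-trans (≤-reflexive (trans (∑-+ (allFin n) _ _) (cong (∑ (allFin n) (λ a → 𝟙 (a =ᶠ i)) +_) (∑-+ (allFin n) _ _))))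
    (+-mono-≤ (∑-Fin-≡ᵇ n (toℕ i)) (+-mono-≤ (∑-Fin-≡ᵇ n (toℕ j)) (∑-Fin-≡ᵇ n (toℕ k)))))

-- Counting small subsets

∑-cartesianProduct : ∀ {A B : Set} (xs : List A) (ys : List B) f →
  ∑ (cartesianProduct xs ys) f ≡ ∑ xs (λ x → ∑ ys (λ y → f (x , y)))
∑-cartesianProduct []       ys f = refl
∑-cartesianProduct (x ∷ xs) ys f = trans (∑-++ (map (x ,_) ys) _ f) (cong₂ _+_ (∑-map ys (x ,_) f) (∑-cartesianProduct xs ys f))

∑-allVecs : ∀ m (f : Vec Bool (suc m) → ℕ) → ∑ (allVecs (suc m)) f ≡ ∑ (allVecs m) (λ v → f (false ∷ v)) + ∑ (allVecs m) (λ v → f (true ∷ v))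
∑-allVecs m f = trans (∑-concatMap (allVecs m) _ f) (trans (∑-cong (allVecs m) λ v → cong (f (false ∷ v) +_) (+-identityʳ _)) (∑-+ (allVecs m) _ _))

∈-allVecs : ∀ {m} (v : Vec Bool m) → v ∈ allVecs m
∈-allVecs [] = here refl
∈-allVecs (b ∷ v) = ∈-concatMap⁺ _ (Any.map (λ { refl → pick b }) (∈-allVecs v))
  where
  pick : ∀ {m} {v : Vec Bool m} b → _∈_ {A = Vec Bool (suc m)} (b ∷ v) ((false ∷ v) ∷ (true ∷ v) ∷ [])
  pick false = here refl
  pick true  = there (here refl)

count-⊆ : ∀ {m} (v w : Vec Bool m) → v ⊆ᵇ w ≡ true → count v ≤ count w
count-⊆ []          []         e = z≤n
count-⊆ (true ∷ v)  (true ∷ w) e = s≤s (count-⊆ v w e)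
count-⊆ (false ∷ v) (b ∷ w)    e = ≤-trans (count-⊆ v w e) (m≤n+m _ (𝟙 b))

∩-⊆ʳ : ∀ {m} (v w : Vec Bool m) → (v ∩ w) ⊆ᵇ w ≡ true
∩-⊆ʳ []          []          = refl
∩-⊆ʳ (true ∷ v)  (true ∷ w)  = ∩-⊆ʳ v w
∩-⊆ʳ (true ∷ v)  (false ∷ w) = ∩-⊆ʳ v w
∩-⊆ʳ (false ∷ v) (b ∷ w)     = ∩-⊆ʳ v w

∩-⊆ˡ : ∀ {m} (v w : Vec Bool m) → (v ∩ w) ⊆ᵇ v ≡ true
∩-⊆ˡ []          []          = refl
∩-⊆ˡ (true ∷ v)  (true ∷ w)  = ∩-⊆ˡ v w
∩-⊆ˡ (true ∷ v)  (false ∷ w) = ∩-⊆ˡ v w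
∩-⊆ˡ (false ∷ v) (b ∷ w)     = ∩-⊆ˡ v w

count-∩-∩ : ∀ {m} (v w u : Vec Bool m) → count (v ∩ (w ∩ u)) ≤ count (v ∩ u)
count-∩-∩ []          []          []          = z≤n
count-∩-∩ (true ∷ v)  (true ∷ w)  (b ∷ u)     = +-monoʳ-≤ (𝟙 b) (count-∩-∩ v w u)
count-∩-∩ (true ∷ v)  (false ∷ w) (b ∷ u)     = ≤-trans (count-∩-∩ v w u) (m≤n+m _ (𝟙 b))
count-∩-∩ (false ∷ v) (c ∷ w)     (b ∷ u)     = count-∩-∩ v w u

-- This is (C ∖ A) ∪ S, the next container when S = H ∩ A.
update : ∀ {m} → Vec Bool m → Vec Bool m → Vec Bool m → Vec Bool m
update []      []      []      = []
update (c ∷ C) (a ∷ A) (s ∷ S) = ((c ∧ not a) ∨ s) ∷ update C A S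

⊆-update : ∀ {m} (H C A : Vec Bool m) → H ⊆ᵇ C ≡ true → H ⊆ᵇ update C A (H ∩ A) ≡ true
⊆-update []          []         []          e = refl
⊆-update (true ∷ H)  (true ∷ C) (true ∷ A)  e = ⊆-update H C A e
⊆-update (true ∷ H)  (true ∷ C) (false ∷ A) e = ⊆-update H C A e
⊆-update (false ∷ H) (c ∷ C)    (a ∷ A)     e = ⊆-update H C A e

count-update : ∀ {m} (C A S : Vec Bool m) → A ⊆ᵇ C ≡ true → count (update C A S) + count A ≤ count C + count S
count-update []          []          []          e = z≤n
count-update (true ∷ C)  (true ∷ A)  (true ∷ S)  e =
  s≤s (subst₂ _≤_ (sym (+-suc _ _)) (sym (+-suc _ _)) (s≤s (count-update C A S e)))
count-update (true ∷ C)  (true ∷ A)  (false ∷ S) e =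
  ≤-trans (≤-reflexive (+-suc _ _)) (s≤s (count-update C A S e))
count-update (true ∷ C)  (false ∷ A) (true ∷ S)  e =
  s≤s (≤-trans (count-update C A S e) (+-monoʳ-≤ (count C) (n≤1+n _)))
count-update (true ∷ C)  (false ∷ A) (false ∷ S) e = s≤s (count-update C A S e)
count-update (false ∷ C) (false ∷ A) (true ∷ S)  e =
  ≤-trans (s≤s (count-update C A S e)) (≤-reflexive (sym (+-suc _ _)))
count-update (false ∷ C) (false ∷ A) (false ∷ S) e = count-update C A S e

∑-⊆ : ∀ {m} (A : Vec Bool m) → ∑ (allVecs m) (λ v → 𝟙 (v ⊆ᵇ A)) ≤ 2 ^ count A
∑-⊆ [] = ≤-refl
∑-⊆ {suc m} (true ∷ A) = ≤-trans (≤-reflexive (∑-allVecs m _))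
  (≤-trans (+-mono-≤ (∑-⊆ A) (∑-⊆ A)) (≤-reflexive (cong (2 ^ count A +_) (sym (+-identityʳ _)))))
∑-⊆ {suc m} (false ∷ A) = ≤-trans (≤-reflexive (trans (∑-allVecs m _) (cong (∑ (allVecs m) (λ v → 𝟙 (v ⊆ᵇ A)) +_) (∑-zero (allVecs m)))))
  (≤-trans (≤-reflexive (+-identityʳ _)) (∑-⊆ A))

smallSubsets : ∀ {m} → Vec Bool m → ℕ → ℕ
smallSubsets {m} A s = ∑ (allVecs m) λ v → 𝟙 (v ⊆ᵇ A) * 𝟙 (count v ≤ᵇ s)

-- Weigh a subset v by k^(-count v): all subsets of A together weigh (1 + 1/k)^|A|, and each of size
-- at most s weighs at least k^(-s). The induction is Pascal's rule with denominators cleared.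
smallSubsets-bound : ∀ {m} (A : Vec Bool m) s k .{{_ : NonZero k}} → smallSubsets A s * k ^ count A ≤ suc k ^ count A * k ^ s
smallSubsets-bound [] s k = ≤-trans (m^n>0 k s) (≤-reflexive (sym (*-identityˡ (k ^ s))))
smallSubsets-bound {suc m} (false ∷ A) s k = subst (λ z → z * k ^ count A ≤ suc k ^ count A * k ^ s)
  (sym (trans (∑-allVecs m _) (trans (cong (smallSubsets A s +_) (∑-zero (allVecs m))) (+-identityʳ _)))) (smallSubsets-bound A s k)
smallSubsets-bound {suc m} (true ∷ A) zero k = subst (λ z → z * k ^ suc (count A) ≤ suc k ^ suc (count A) * 1)
  (sym (trans (∑-allVecs m _) (trans (cong (smallSubsets A 0 +_)
     (trans (∑-cong (allVecs m) λ v → *-zeroʳ (𝟙 (v ⊆ᵇ A))) (∑-zero (allVecs m)))) (+-identityʳ _))))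
  (begin
    smallSubsets A 0 * (k * p)  ≡⟨ lem (smallSubsets A 0) k p ⟩
    k * (smallSubsets A 0 * p)  ≤⟨ *-mono-≤ (n≤1+n k) (smallSubsets-bound A 0 k) ⟩
    suc k * (suc k ^ count A * 1) ≡⟨ sym (*-assoc (suc k) (suc k ^ count A) 1) ⟩
    suc k * suc k ^ count A * 1 ∎)
  where
  open ≤-Reasoning
  p = k ^ count A
  lem : ∀ x k p → x * (k * p) ≡ k * (x * p)
  lem = solve-∀
smallSubsets-bound {suc m} (true ∷ A) (suc s) k = subst (λ z → z * k ^ suc (count A) ≤ suc k ^ suc (count A) * k ^ suc s)
  (sym (trans (∑-allVecs m _) (cong (smallSubsets A (suc s) +_) (∑-cong (allVecs m) λ v → cong (𝟙 (v ⊆ᵇ A) *_) (cong 𝟙 (suc≤ᵇ (count v) s))))))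
  (begin
    (x + y) * (k * p)              ≡⟨ lem₁ x y k p ⟩
    k * (x * p) + k * (y * p)      ≤⟨ +-mono-≤ (*-monoʳ-≤ k (smallSubsets-bound A (suc s) k)) (*-monoʳ-≤ k (smallSubsets-bound A s k)) ⟩
    k * (q * (k * r)) + k * (q * r) ≡⟨ lem₂ k q r ⟩
    suc k * q * (k * r)            ∎)
  where
  open ≤-Reasoning
  x = smallSubsets A (suc s)
  y = smallSubsets A s
  p = k ^ count A
  q = suc k ^ count A
  r = k ^ s
  suc≤ᵇ : ∀ a b → (suc a ≤ᵇ suc b) ≡ (a ≤ᵇ b)
  suc≤ᵇ zero    b = refl
  suc≤ᵇ (suc a) b = refl
  lem₁ : ∀ x y k p → (x + y) * (k * p) ≡ k * (x * p) + k * (y * p)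
  lem₁ = solve-∀
  lem₂ : ∀ k q r → k * (q * (k * r)) + k * (q * r) ≡ suc k * q * (k * r)
  lem₂ = solve-∀

-- (1 + 1/k)^ρ (1 - ρ/k) ≤ 1, with d = k - ρ; the induction lowers ρ and raises d.
bernoulli : ∀ k ρ d → k ≡ ρ + d → suc k ^ ρ * d ≤ k ^ ρ * k
bernoulli k zero    d e = ≤-reflexive (cong (1 *_) (sym e))
bernoulli k (suc ρ) d e = begin
  suc k * suc k ^ ρ * d       ≡⟨ lem₁ k (suc k ^ ρ) d ⟩
  suc k ^ ρ * (suc k * d)     ≤⟨ *-monoʳ-≤ (suc k ^ ρ) (≤-trans (m≤m+n _ (suc ρ)) (≤-reflexive (trans (cong (λ z → suc z * d + suc ρ) e) (trans (lem₂ ρ d) (cong (_* suc d) (sym e)))))) ⟩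
  suc k ^ ρ * (k * suc d)     ≡⟨ lem₁′ k (suc k ^ ρ) (suc d) ⟩
  k * (suc k ^ ρ * suc d)     ≤⟨ *-monoʳ-≤ k (bernoulli k ρ (suc d) (trans e (sym (+-suc ρ d)))) ⟩
  k * (k ^ ρ * k)             ≡⟨ sym (*-assoc k (k ^ ρ) k) ⟩
  k * k ^ ρ * k               ∎
  where
  open ≤-Reasoning
  lem₁ : ∀ k q d → suc k * q * d ≡ q * (suc k * d)
  lem₁ = solve-∀
  lem₁′ : ∀ k q d → q * (k * d) ≡ k * (q * d)
  lem₁′ = solve-∀
  lem₂ : ∀ ρ d → suc (suc (ρ + d)) * d + suc ρ ≡ suc (ρ + d) * suc d
  lem₂ = solve-∀

[1+k]^ρ≤2k^ρ : ∀ k ρ .{{_ : NonZero k}} → 2 * ρ ≤ k → suc k ^ ρ ≤ 2 * k ^ ρ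
[1+k]^ρ≤2k^ρ k ρ 2ρ≤k = *-cancelʳ-≤ _ _ k (begin
  suc k ^ ρ * k               ≤⟨ *-monoʳ-≤ (suc k ^ ρ) k≤2d ⟩
  suc k ^ ρ * (2 * d)         ≡⟨ lem (suc k ^ ρ) d ⟩
  2 * (suc k ^ ρ * d)         ≤⟨ *-monoʳ-≤ 2 (bernoulli k ρ d (sym (m+[n∸m]≡n ρ≤k))) ⟩
  2 * (k ^ ρ * k)             ≡⟨ sym (*-assoc 2 (k ^ ρ) k) ⟩
  2 * k ^ ρ * k               ∎)
  where
  open ≤-Reasoning
  d = k ∸ ρ
  ρ≤k : ρ ≤ k
  ρ≤k = ≤-trans (m≤m+n ρ _) 2ρ≤k
  lem : ∀ q d → q * (2 * d) ≡ 2 * (q * d)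
  lem = solve-∀
  k≤2d : k ≤ 2 * d
  k≤2d = +-cancelˡ-≤ (2 * ρ) _ _ (begin
    2 * ρ + k       ≤⟨ +-monoˡ-≤ k 2ρ≤k ⟩
    k + k           ≡⟨ cong (λ z → z + z) (sym (m+[n∸m]≡n ρ≤k)) ⟩
    ρ + d + (ρ + d) ≡⟨ lem₂ ρ d ⟩
    2 * ρ + 2 * d   ∎)
    where
    lem₂ : ∀ ρ d → ρ + d + (ρ + d) ≡ 2 * ρ + 2 * d
    lem₂ = solve-∀

^-distribʳ-* : ∀ k x y → (x * y) ^ k ≡ x ^ k * y ^ k
^-distribʳ-* zero    x y = refl
^-distribʳ-* (suc k) x y = trans (cong (x * y *_) (^-distribʳ-* k x y)) (lem x y (x ^ k) (y ^ k))
  where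
  lem : ∀ x y p q → x * y * (p * q) ≡ x * p * (y * q)
  lem = solve-∀

n<2^n : ∀ n → n < 2 ^ n
n<2^n zero    = s≤s z≤n
n<2^n (suc n) = ≤-trans (+-mono-≤ (m^n>0 2 n) (n<2^n n)) (≤-reflexive (cong (2 ^ n +_) (sym (+-identityʳ _))))

-- smallSubsets-bound is applied with k = 2^rate ≥ 2·block, which makes
-- (1 + 1/k)^block ≤ 2, and K is large enough for k^(a/K) ≤ 2^(a/block).
module _ (Q : ℕ) .{{_ : NonZero Q}} where

  block rate K : ℕ
  block    = 16 * Q
  rate = 2 * block
  K    = block * rate

  instance
    block≢0 : NonZero block
    block≢0 = m*n≢0 16 Q
    rate≢0 : NonZero rate
    rate≢0 = m*n≢0 2 block
    K≢0 : NonZero K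
    K≢0 = m*n≢0 block rate
    4Q≢0 : NonZero (4 * Q)
    4Q≢0 = m*n≢0 4 Q

  smallSubsets≤ : ∀ {m} (A : Vec Bool m) → block ≤ count A → smallSubsets A (count A / K) ≤ 2 ^ (count A / (4 * Q))
  smallSubsets≤ A block≤a = *-cancelʳ-≤ _ _ (k ^ a) {{m^n≢0 k a}} (begin
    smallSubsets A s * k ^ a            ≤⟨ smallSubsets-bound A s k ⟩
    suc k ^ a * k ^ s                   ≤⟨ *-monoˡ-≤ (k ^ s) expand ⟩
    2 ^ suc y * k ^ a * k ^ s           ≡⟨ cong (2 ^ suc y * k ^ a *_) (^-*-assoc 2 rate s) ⟩
    2 ^ suc y * k ^ a * 2 ^ (rate * s)  ≡⟨ lem (2 ^ suc y) (k ^ a) (2 ^ (rate * s)) ⟩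
    2 ^ suc y * 2 ^ (rate * s) * k ^ a  ≡⟨ cong (_* k ^ a) (sym (^-distribˡ-+-* 2 (suc y) (rate * s))) ⟩
    2 ^ (suc y + rate * s) * k ^ a      ≤⟨ *-monoˡ-≤ (k ^ a) (^-monoʳ-≤ 2 exponent) ⟩
    2 ^ (a / (4 * Q)) * k ^ a           ∎)
    where
    open ≤-Reasoning
    a = count A
    s = a / K
    k = 2 ^ rate
    instance
      k≢0 : NonZero k
      k≢0 = m^n≢0 2 rate
    y = a / block
    lem : ∀ x y z → x * y * z ≡ x * z * y
    lem = solve-∀
    2block≤k : 2 * block ≤ k
    2block≤k = <⇒≤ (n<2^n rate)
    ρ = a % block
    expand : suc k ^ a ≤ 2 ^ suc y * k ^ a
    expand = begin
      suc k ^ a                       ≡⟨ cong (suc k ^_) split ⟩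
      suc k ^ (ρ + block * y)             ≡⟨ trans (^-distribˡ-+-* (suc k) ρ (block * y)) (cong (suc k ^ ρ *_) (sym (^-*-assoc (suc k) block y))) ⟩
      suc k ^ ρ * (suc k ^ block) ^ y     ≤⟨ *-mono-≤ ([1+k]^ρ≤2k^ρ k ρ (≤-trans (*-monoʳ-≤ 2 (<⇒≤ (m%n<n a block))) 2block≤k))
                                          (^-monoˡ-≤ y ([1+k]^ρ≤2k^ρ k block 2block≤k)) ⟩
      2 * k ^ ρ * (2 * k ^ block) ^ y     ≡⟨ cong (2 * k ^ ρ *_) (trans (^-distribʳ-* y 2 (k ^ block)) (cong (2 ^ y *_) (^-*-assoc k block y))) ⟩
      2 * k ^ ρ * (2 ^ y * k ^ (block * y)) ≡⟨ lem₂ (k ^ ρ) (2 ^ y) (k ^ (block * y)) ⟩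
      2 * 2 ^ y * (k ^ ρ * k ^ (block * y)) ≡⟨ cong (2 * 2 ^ y *_) (trans (sym (^-distribˡ-+-* k ρ (block * y))) (cong (k ^_) (sym split))) ⟩
      2 ^ suc y * k ^ a               ∎
      where
      split : a ≡ ρ + block * y
      split = trans (m≡m%n+[m/n]*n a block) (cong (ρ +_) (*-comm y block))
      lem₂ : ∀ p t q → 2 * p * (t * q) ≡ 2 * t * (p * q)
      lem₂ = solve-∀
    rs≤y : rate * s ≤ y
    rs≤y = ≤-trans (≤-reflexive (sym (m*n/n≡m (rate * s) block))) (/-monoˡ-≤ block (≤-trans (≤-reflexive (lem₃ block rate s)) (m/n*n≤m a K)))
      where
      lem₃ : ∀ l r s → r * s * l ≡ s * (l * r)
      lem₃ = solve-∀
    1≤y : 1 ≤ y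
    1≤y = ≤-trans (≤-reflexive (sym (n/n≡1 block))) (/-monoˡ-≤ block block≤a)
    -- `block` is four times 4Q; of the four copies of y gained here the exponent uses three, one of
    -- them to cover the 1 in `suc y`.
    4y≤ : 4 * y ≤ a / (4 * Q)
    4y≤ = ≤-trans (≤-reflexive (sym (m*n/n≡m (4 * y) (4 * Q)))) (/-monoˡ-≤ (4 * Q) (≤-trans (≤-reflexive (lem₄ y Q)) (m/n*n≤m a block)))
      where
      lem₄ : ∀ y Q → 4 * y * (4 * Q) ≡ y * (16 * Q)
      lem₄ = solve-∀
    exponent : suc y + rate * s ≤ a / (4 * Q)
    exponent = ≤-trans (+-mono-≤ (+-monoˡ-≤ y 1≤y) rs≤y) (≤-trans (≤-trans (m≤m+n _ y) (≤-reflexive (lem₅ y))) 4y≤)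
      where
      lem₅ : ∀ y → y + y + y + y ≡ 4 * y
      lem₅ = solve-∀

-- Containers

Rel₃ : ℕ → Set
Rel₃ n = Fin n → Fin n → Fin n → Bool

∑⁵-t5 : ∀ {n} (f g h k : Rel₃ n) → ℕ
∑⁵-t5 {n} f g h k = ∑⁵ (allFin n) λ a b c d e → 𝟙 (f a b c) * 𝟙 (g a b d) * 𝟙 (h a b e) * 𝟙 (k c d e)

data Level : Set where
  l₁ l₂ l₃ l₄ : Level

-- A copy of T₅ (edges 123, 124, 125, 345) with one edge xyz unspecified and the
-- two vertices u, v outside it fixed; C replaces the edges not yet known to be
-- in the graph G.
others : ∀ {n} → Level → Rel₃ n → Rel₃ n → Fin n → Fin n → Rel₃ n
others l₁ C G u v x y z = C u v x ∧ C u v y ∧ C u v z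
others l₂ C G u v x y z = C x y u ∧ C x y v ∧ G u v z
others l₃ C G u v x y z = C x y u ∧ G x y v ∧ G u z v
others l₄ C G u v x y z = G x y u ∧ G x y v ∧ G z u v

-- F = C counts copies before xyz is required to lie in H, and F = H those after. By `weight-l₁` to
-- `weight-l₄`, each level ends where the next one begins.
weight : ∀ {n} → Level → Rel₃ n → Rel₃ n → Rel₃ n → ℕ
weight {n} l F C G = ∑² (allFin n) λ u v → ∑³ (allFin n) λ x y z → 𝟙 (F x y z) * 𝟙 (others l C G u v x y z)

module Levels (n : ℕ) where

  private
    vs = allFin n

    𝟙-∧³ : ∀ a b c → 𝟙 (a ∧ b ∧ c) ≡ 𝟙 a * (𝟙 b * 𝟙 c)
    𝟙-∧³ a b c = trans (𝟙-∧ a (b ∧ c)) (cong (𝟙 a *_) (𝟙-∧ b c))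

    ∑²-swap : (f : Fin n → Fin n → Fin n → Fin n → ℕ) → ∑² vs (λ a b → ∑² vs (f a b)) ≡ ∑² vs (λ c d → ∑² vs (λ a b → f a b c d))
    ∑²-swap f = trans (∑-cong vs λ a → trans (∑-swap vs vs _) (∑-cong vs λ c → ∑-swap vs vs _))
      (trans (∑-swap vs vs _) (∑-cong vs λ c → ∑-swap vs vs _))

  weight-l₁ : ∀ F C G → weight l₁ F C G ≡ ∑⁵-t5 C C C F
  weight-l₁ F C G = ∑⁵-cong vs λ a b c d e → trans (cong (𝟙 (F c d e) *_) (𝟙-∧³ (C a b c) (C a b d) (C a b e))) (lem (𝟙 (F c d e)) (𝟙 (C a b c)) (𝟙 (C a b d)) (𝟙 (C a b e)))
    where
    lem : ∀ f a b c → f * (a * (b * c)) ≡ a * b * c * f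
    lem = solve-∀

  weight-l₂ : ∀ F C G → weight l₂ F C G ≡ ∑⁵-t5 C C F G
  weight-l₂ F C G = trans (∑²-swap _) (∑⁵-cong vs λ a b c d e →
    trans (cong (𝟙 (F a b e) *_) (𝟙-∧³ (C a b c) (C a b d) (G c d e))) (lem (𝟙 (F a b e)) (𝟙 (C a b c)) (𝟙 (C a b d)) (𝟙 (G c d e))))
    where
    lem : ∀ f a b c → f * (a * (b * c)) ≡ a * b * f * c
    lem = solve-∀

  weight-l₃ : ∀ F C G → weight l₃ F C G ≡ ∑⁵-t5 C F G G
  weight-l₃ F C G = trans (∑²-swap _) (trans (∑³-cong vs λ a b c → ∑-swap vs vs _) (∑⁵-cong vs λ a b c d e →
    trans (cong (𝟙 (F a b d) *_) (𝟙-∧³ (C a b c) (G a b e) (G c d e))) (lem (𝟙 (F a b d)) (𝟙 (C a b c)) (𝟙 (G a b e)) (𝟙 (G c d e)))))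
    where
    lem : ∀ f a b c → f * (a * (b * c)) ≡ a * f * b * c
    lem = solve-∀

  weight-l₄ : ∀ F C G → weight l₄ F C G ≡ ∑⁵-t5 F G G G
  weight-l₄ F C G = trans (∑²-swap _) (trans (∑²-cong vs λ a b → trans (∑-cong vs λ d → ∑-swap vs vs _) (∑-swap vs vs _)) (∑⁵-cong vs λ a b c d e →
    trans (cong (𝟙 (F a b c) *_) (𝟙-∧³ (G a b d) (G a b e) (G c d e))) (lem (𝟙 (F a b c)) (𝟙 (G a b d)) (𝟙 (G a b e)) (𝟙 (G c d e)))))
    where
    lem : ∀ f a b c → f * (a * (b * c)) ≡ f * a * b * c
    lem = solve-∀

  ⟦_⟧ : Graph3 n → Rel₃ n
  ⟦ H ⟧ = hasEdge {n} H

  private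
    ts = triples n

  touches : Fin n → Fin n → Triple n → Bool
  touches u v t = inTriple u t ∨ inTriple v t

  star : Fin n → Fin n → Graph3 n
  star u v = mask ts (touches u v)

  -- The set A of the container step. Its last argument will be H ∩ `star u v` and not H, because A
  -- has to be recoverable from C and the recorded data.
  completions : Level → Fin n → Fin n → Graph3 n → Graph3 n → Graph3 n
  completions l u v C G = C ∩ mask ts (λ t → 0 <ᵇ orderings (λ x y z → 𝟙 (others l ⟦ C ⟧ ⟦ G ⟧ u v x y z)) t)

  private
    hasEdge-star : ∀ H u v a b c → (∀ t → incident a b c t ≡ true → touches u v t ≡ true) → ⟦ H ∩ star u v ⟧ a b c ≡ ⟦ H ⟧ a b c
    hasEdge-star H u v a b c inc = 𝟙-injective (trans (hasEdge-sum {n} (H ∩ star u v) a b c) (trans (sumOn-∩-mask ts H (touches u v) _)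
      (trans (sumOn-cong ts H absorb) (sym (hasEdge-sum {n} H a b c)))))
      where
      absorb : ∀ t → 𝟙 (touches u v t) * 𝟙 (incident a b c t) ≡ 𝟙 (incident a b c t)
      absorb t with incident a b c t in e
      ... | false = *-zeroʳ (𝟙 (touches u v t))
      ... | true rewrite inc t e = refl

    inc : ∀ (a b c : Fin n) (t : Triple n) → incident a b c t ≡ true → inTriple a t ≡ true × inTriple b t ≡ true × inTriple c t ≡ true
    inc a b c t e with ∧-true {distinct3 a b c} {inTriple a t ∧ inTriple b t ∧ inTriple c t} e
    ... | _ , e₁ with ∧-true {inTriple a t} {inTriple b t ∧ inTriple c t} e₁
    ...   | a∈ , e₂ with ∧-true {inTriple b t} {inTriple c t} e₂
    ...     | b∈ , c∈ = a∈ , b∈ , c∈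

    inc₁ : ∀ (a b c : Fin n) (t : Triple n) → incident a b c t ≡ true → inTriple a t ≡ true
    inc₁ a b c t e = proj₁ (inc a b c t e)

    inc₂ : ∀ (a b c : Fin n) (t : Triple n) → incident a b c t ≡ true → inTriple b t ≡ true
    inc₂ a b c t e = proj₁ (proj₂ (inc a b c t e))

    inc₃ : ∀ (a b c : Fin n) (t : Triple n) → incident a b c t ≡ true → inTriple c t ≡ true
    inc₃ a b c t e = proj₂ (proj₂ (inc a b c t e))

    touchesˡ : ∀ (u v : Fin n) (t : Triple n) → inTriple u t ≡ true → touches u v t ≡ true
    touchesˡ u v t e = cong (_∨ inTriple v t) e

    touchesʳ : ∀ (u v : Fin n) (t : Triple n) → inTriple v t ≡ true → touches u v t ≡ true
    touchesʳ u v t e with inTriple u t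
    ... | true  = refl
    ... | false = e

    -- Every edge of T₅ other than xyz meets the two vertices outside xyz, so all edges of H that
    -- `others` consults lie in the star of u and v.
    others-star : ∀ l C H u v x y z → others l C ⟦ H ∩ star u v ⟧ u v x y z ≡ others l C ⟦ H ⟧ u v x y z
    others-star l₁ C H u v x y z = refl
    others-star l₂ C H u v x y z = cong (λ b → C x y u ∧ C x y v ∧ b)
      (hasEdge-star H u v u v z λ t e → touchesˡ u v t (inc₁ u v z t e))
    others-star l₃ C H u v x y z = cong₂ (λ a b → C x y u ∧ a ∧ b)
      (hasEdge-star H u v x y v λ t e → touchesʳ u v t (inc₃ x y v t e))
      (hasEdge-star H u v u z v λ t e → touchesˡ u v t (inc₁ u z v t e))
    others-star l₄ C H u v x y z = cong₂ _∧_
      (hasEdge-star H u v x y u λ t e → touchesˡ u v t (inc₃ x y u t e)) (cong₂ _∧_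
      (hasEdge-star H u v x y v λ t e → touchesʳ u v t (inc₃ x y v t e))
      (hasEdge-star H u v z u v λ t e → touchesˡ u v t (inc₂ z u v t e)))

    0<ᵇ-𝟙 : ∀ m → 𝟙 (0 <ᵇ m) ≤ m
    0<ᵇ-𝟙 zero    = z≤n
    0<ᵇ-𝟙 (suc m) = s≤s z≤n

    ≤0<ᵇ : ∀ m {k} → m ≤ k → m ≤ 𝟙 (0 <ᵇ m) * k
    ≤0<ᵇ zero    l = z≤n
    ≤0<ᵇ (suc m) l = ≤-trans l (≤-reflexive (sym (+-identityʳ _)))

  -- An edge of C with a completing order belongs to A, and it accounts for at most 27 ordered
  -- triples.
  completions-lower : ∀ l u v C H → let A = completions l u v C (H ∩ star u v) in
    ∑³ vs (λ x y z → 𝟙 (⟦ C ⟧ x y z) * 𝟙 (others l ⟦ C ⟧ ⟦ H ⟧ u v x y z)) ≤ 27 * count A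
  completions-lower l u v C H = begin
    ∑³ vs (λ x y z → 𝟙 (⟦ C ⟧ x y z) * 𝟙 (others l ⟦ C ⟧ ⟦ H ⟧ u v x y z))
      ≡⟨ ∑³-cong vs (λ x y z → cong (λ b → 𝟙 (⟦ C ⟧ x y z) * 𝟙 b) (sym (others-star l ⟦ C ⟧ H u v x y z))) ⟩
    ∑³ vs (λ x y z → 𝟙 (⟦ C ⟧ x y z) * g x y z)    ≡⟨ ∑-hasEdge {n} C g ⟩
    sumOn ts C (orderings g)                      ≤⟨ sumOn-mono∈ ts C (λ t _ → ≤0<ᵇ (orderings g t) (orderings≤27 {n} g t λ _ _ _ → 𝟙≤1 _)) ⟩
    sumOn ts C (λ t → 𝟙 (0 <ᵇ orderings g t) * 27) ≡⟨ sym (sumOn-∩-mask ts C (λ t → 0 <ᵇ orderings g t) _) ⟩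
    sumOn ts A (λ _ → 27)                         ≡⟨ trans (sumOn-* ts A 27 (λ _ → 1)) (cong (27 *_) (sym (count-sumOn ts A))) ⟩
    27 * count A                                  ∎
    where
    open ≤-Reasoning
    A = completions l u v C (H ∩ star u v)
    g : Fin n → Fin n → Fin n → ℕ
    g x y z = 𝟙 (others l ⟦ C ⟧ ⟦ H ∩ star u v ⟧ u v x y z)

  -- Every edge of H ∩ A has at least one completing order and is thus counted on the right.
  completions-upper : ∀ l u v C H → let A = completions l u v C (H ∩ star u v) in
    count (H ∩ A) ≤ ∑³ vs (λ x y z → 𝟙 (⟦ H ⟧ x y z) * 𝟙 (others l ⟦ C ⟧ ⟦ H ⟧ u v x y z))
  completions-upper l u v C H = begin
    count (H ∩ (C ∩ M))                            ≤⟨ count-∩-∩ H C M ⟩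
    count (H ∩ M)                                  ≡⟨ count-sumOn ts (H ∩ M) ⟩
    sumOn ts (H ∩ M) (λ _ → 1)                     ≡⟨ sumOn-∩-mask ts H _ _ ⟩
    sumOn ts H (λ t → 𝟙 (0 <ᵇ orderings g t) * 1)  ≤⟨ sumOn-mono∈ ts H (λ t _ → ≤-trans (≤-reflexive (*-identityʳ _)) (0<ᵇ-𝟙 (orderings g t))) ⟩
    sumOn ts H (orderings g)                       ≡⟨ sym (∑-hasEdge {n} H g) ⟩
    ∑³ vs (λ x y z → 𝟙 (⟦ H ⟧ x y z) * g x y z)
      ≡⟨ ∑³-cong vs (λ x y z → cong (λ b → 𝟙 (⟦ H ⟧ x y z) * 𝟙 b) (others-star l ⟦ C ⟧ H u v x y z)) ⟩
    ∑³ vs (λ x y z → 𝟙 (⟦ H ⟧ x y z) * 𝟙 (others l ⟦ C ⟧ ⟦ H ⟧ u v x y z)) ∎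
    where
    open ≤-Reasoning
    g : Fin n → Fin n → Fin n → ℕ
    g x y z = 𝟙 (others l ⟦ C ⟧ ⟦ H ∩ star u v ⟧ u v x y z)
    M = mask ts (λ t → 0 <ᵇ orderings g t)

  count-star : ∀ u v → count (star u v) ≤ 6 * (n * n)
  count-star u v = begin
    count (star u v)                       ≡⟨ count-mask ts (touches u v) ⟩
    ∑ ts (λ t → 𝟙 (touches u v t))         ≤⟨ ∑-mono ts (λ t → 𝟙-∨ (inTriple u t) _) ⟩
    ∑ ts (λ t → 𝟙 (inTriple u t) + 𝟙 (inTriple v t)) ≡⟨ ∑-+ ts _ _ ⟩
    ∑ ts (λ t → 𝟙 (inTriple u t)) + ∑ ts (λ t → 𝟙 (inTriple v t)) ≤⟨ +-mono-≤ (one u) (one v) ⟩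
    3 * (n * n) + 3 * (n * n)              ≡⟨ lem (n * n) ⟩
    6 * (n * n)                            ∎
    where
    open ≤-Reasoning
    lem : ∀ s → 3 * s + 3 * s ≡ 6 * s
    lem = solve-∀
    lem₂ : ∀ n → n * (n * 1) + (n * (n * 1) + n * (n * 1)) ≡ 3 * (n * n)
    lem₂ = solve-∀
    const≤ : ∀ k {f : Fin n → ℕ} → (∀ i → f i ≤ k) → ∑ vs f ≤ n * k
    const≤ k l = ≤-trans (∑-≤const vs k l) (≤-reflexive (cong (_* k) (length-allFin n)))
    eq≤1 : ∀ u → ∑ vs (λ i → 𝟙 (u =ᶠ i)) ≤ 1
    eq≤1 u = ≤-trans (≤-reflexive (∑-cong vs λ i → cong 𝟙 (=ᶠ-sym u i))) (∑-Fin-≡ᵇ n (toℕ u))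
    one : ∀ u → ∑ ts (λ t → 𝟙 (inTriple u t)) ≤ 3 * (n * n)
    one u = begin
      ∑ ts (λ t → 𝟙 (inTriple u t)) ≤⟨ ∑-triples≤ (λ t → 𝟙 (inTriple u t)) ⟩
      ∑³ vs (λ i j k → 𝟙 (inTriple u (i , j , k)))
        ≤⟨ ∑³-mono vs (λ i j k → ≤-trans (𝟙-∨ (u =ᶠ i) _) (+-monoʳ-≤ (𝟙 (u =ᶠ i)) (𝟙-∨ (u =ᶠ j) _))) ⟩
      ∑³ vs (λ i j k → 𝟙 (u =ᶠ i) + (𝟙 (u =ᶠ j) + 𝟙 (u =ᶠ k)))
        ≡⟨ trans (∑³-+ vs _ _) (cong (∑³ vs (λ i j k → 𝟙 (u =ᶠ i)) +_) (∑³-+ vs _ _)) ⟩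
      ∑³ vs (λ i j k → 𝟙 (u =ᶠ i)) + (∑³ vs (λ i j k → 𝟙 (u =ᶠ j)) + ∑³ vs (λ i j k → 𝟙 (u =ᶠ k)))
        ≤⟨ +-mono-≤ (first u) (+-mono-≤ (const≤ (n * 1) λ i → second u) (const≤ (n * 1) λ i → const≤ 1 λ j → eq≤1 u)) ⟩
      n * (n * 1) + (n * (n * 1) + n * (n * 1)) ≡⟨ lem₂ n ⟩
      3 * (n * n) ∎
      where
      second : ∀ u → ∑² vs (λ j k → 𝟙 (u =ᶠ j)) ≤ n * 1
      second u = ≤-trans (≤-reflexive (trans (∑-cong vs λ j → trans (∑-const vs (𝟙 (u =ᶠ j))) (cong (_* 𝟙 (u =ᶠ j)) (length-allFin n))) (∑-*ˡ vs n _)))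
        (*-monoʳ-≤ n (eq≤1 u))
      first : ∀ u → ∑³ vs (λ i j k → 𝟙 (u =ᶠ i)) ≤ n * (n * 1)
      first u = ≤-trans (≤-reflexive (trans (∑-cong vs λ i → trans (∑²-const vs (𝟙 (u =ᶠ i))) (cong (λ l → l * l * 𝟙 (u =ᶠ i)) (length-allFin n))) (∑-*ˡ vs (n * n) _)))
        (≤-trans (*-monoʳ-≤ (n * n) (eq≤1 u)) (≤-reflexive (*-assoc n n 1)))

  triples≤n³ : length ts ≤ n * n * n
  triples≤n³ = ≤-trans (≤-reflexive (length-∑ ts)) (≤-trans (∑-triples≤ {n} (λ _ → 1))
    (≤-reflexive (trans (∑³-const vs 1) (trans (*-identityʳ _) (cong (λ l → l * l * l) (length-allFin n))))))

  6count≤E : ∀ C → 6 * count C ≤ ∑³ vs (λ a b c → 𝟙 (⟦ C ⟧ a b c))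
  6count≤E C = begin
    6 * count C                    ≡⟨ cong (6 *_) (count-sumOn ts C) ⟩
    6 * sumOn ts C (λ _ → 1)       ≡⟨ sym (sumOn-* ts C 6 (λ _ → 1)) ⟩
    sumOn ts C (λ _ → 6)           ≤⟨ sumOn-mono∈ ts C (λ t i → 6≤orderings {n} t (∈-triples i)) ⟩
    sumOn ts C (orderings λ _ _ _ → 1) ≡⟨ sym (∑-hasEdge {n} C (λ _ _ _ → 1)) ⟩
    ∑³ vs (λ a b c → 𝟙 (⟦ C ⟧ a b c) * 1) ≡⟨ ∑³-cong vs (λ a b c → *-identityʳ _) ⟩
    ∑³ vs (λ a b c → 𝟙 (⟦ C ⟧ a b c)) ∎
    where open ≤-Reasoning

  -- The partition given by x is one candidate for the minimum, H is contained in C, and every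
  -- inconsistent edge has at least one ordering.
  D≤inconsistent : ∀ H C (x : Fin n → Bool) → H ⊆ᵇ C ≡ true →
    D {n} H ≤ ∑³ vs (λ a b c → 𝟙 (⟦ C ⟧ a b c) * 𝟙 (inconsistent (x a) (x b) (x c)))
  D≤inconsistent H C x H⊆C = begin
    D {n} H                                   ≤⟨ fold≤ (allVecs n) (∈-allVecs X) ⟩
    inconsistentCount {n} H X                 ≡⟨ length-filter _ (edges {n} H) ⟩
    ∑ (edges {n} H) (λ t → 𝟙 (not (consistent X t))) ≡⟨ ∑-edges ts H _ ⟩
    sumOn ts H (λ t → 𝟙 (not (consistent X t))) ≤⟨ sumOn-⊆ ts H C _ H⊆C ⟩
    sumOn ts C (λ t → 𝟙 (not (consistent X t))) ≤⟨ sumOn-mono∈ ts C (λ t i → le t (∈-triples i)) ⟩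
    sumOn ts C (orderings λ a b c → 𝟙 (inconsistent (x a) (x b) (x c))) ≡⟨ sym (∑-hasEdge {n} C (λ a b c → 𝟙 (inconsistent (x a) (x b) (x c)))) ⟩
    ∑³ vs (λ a b c → 𝟙 (⟦ C ⟧ a b c) * 𝟙 (inconsistent (x a) (x b) (x c))) ∎
    where
    open ≤-Reasoning
    X : Vec Bool n
    X = tabulate x
    fold≤ : ∀ Xs → X ∈ Xs → foldr (λ Y m → inconsistentCount {n} H Y ⊓ m) (length (edges {n} H)) Xs ≤ inconsistentCount {n} H X
    fold≤ (Y ∷ Xs) (here refl) = m⊓n≤m _ _
    fold≤ (Y ∷ Xs) (there i)   = ≤-trans (m⊓n≤n (inconsistentCount {n} H Y) _) (fold≤ Xs i)
    le : ∀ t → Sorted t → 𝟙 (not (consistent X t)) ≤ orderings (λ a b c → 𝟙 (inconsistent (x a) (x b) (x c))) t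
    le (i , j , k) s = ≤-trans (≤-reflexive eq) (orderings≥1 (λ a b c → 𝟙 (inconsistent (x a) (x b) (x c))) (i , j , k) s)
      where
      eq : 𝟙 (not (consistent X (i , j , k))) ≡ 𝟙 (inconsistent (x i) (x j) (x k))
      eq rewrite lookup∘tabulate x i | lookup∘tabulate x j | lookup∘tabulate x k = refl

  t5 : Graph3 n → ℕ
  t5 C = ∑⁵-t5 ⟦ C ⟧ ⟦ C ⟧ ⟦ C ⟧ ⟦ C ⟧

  -- `hasEdge` forces distinct entries, so the four edges already make the five vertices distinct
  -- and any nonzero term is a genuine copy.
  T5-free : ∀ H → containsT5 {n} H ≡ false → t5 H ≡ 0
  T5-free H free = n≤0⇒n≡0 (≤-trans (∑⁵-mono vs none) (≤-reflexive zeros))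
    where
    zeros : ∑⁵ vs (λ _ _ _ _ _ → 0) ≡ 0
    zeros = trans (∑³-cong vs λ _ _ _ → trans (∑²-const vs 0) (*-zeroʳ (length vs * length vs))) (trans (∑³-const vs 0) (*-zeroʳ (length vs * length vs * length vs)))
    ends : ∀ a b c → ⟦ H ⟧ a b c ≡ true → distinct3 a b c ≡ true
    ends a b c e = proj₁ (∧-true {distinct3 a b c} e)
    ≠ : ∀ {a b : Fin n} → a ≢ b → not (a =ᶠ b) ≡ true
    ≠ ne rewrite ≢⇒=ᶠ ne = refl
    none : ∀ a b c d e → 𝟙 (⟦ H ⟧ a b c) * 𝟙 (⟦ H ⟧ a b d) * 𝟙 (⟦ H ⟧ a b e) * 𝟙 (⟦ H ⟧ c d e) ≤ 0
    none a b c d e with ⟦ H ⟧ a b c in p | ⟦ H ⟧ a b d in q | ⟦ H ⟧ a b e in r | ⟦ H ⟧ c d e in s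
    ... | false | _     | _     | _     = z≤n
    ... | true  | false | _     | _     = z≤n
    ... | true  | true  | false | _     = z≤n
    ... | true  | true  | true  | false = z≤n
    ... | true  | true  | true  | true  = ⊥-elim (absurd (trans (sym free)
      (any-true _ vs (∈-allFin a) (any-true _ vs (∈-allFin b) (any-true _ vs (∈-allFin c)
      (any-true _ vs (∈-allFin d) (any-true _ vs (∈-allFin e) copy)))))))
      where
      absurd : false ≡ true → ⊥
      absurd ()
      abc = ends a b c p
      abd = distinct3⇒ a b d (ends a b d q)
      abe = distinct3⇒ a b e (ends a b e r)
      cde = distinct3⇒ c d e (ends c d e s)
      ade = ⇒distinct3 (proj₁ (proj₂ abd)) (proj₁ (proj₂ abe)) (proj₂ (proj₂ cde))
      bde = ⇒distinct3 (proj₂ (proj₂ abd)) (proj₂ (proj₂ abe)) (proj₂ (proj₂ cde))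
      copy : distinct3 a b c ∧ distinct3 a d e ∧ distinct3 b d e ∧ not (c =ᶠ d) ∧ not (c =ᶠ e)
        ∧ ⟦ H ⟧ a b c ∧ ⟦ H ⟧ a b d ∧ ⟦ H ⟧ a b e ∧ ⟦ H ⟧ c d e ≡ true
      copy = all abc ade bde (≠ (proj₁ cde)) (≠ (proj₁ (proj₂ cde))) p q r s
        where
        all : ∀ {a b c d e f g h i} → a ≡ true → b ≡ true → c ≡ true → d ≡ true → e ≡ true → f ≡ true → g ≡ true → h ≡ true → i ≡ true →
          a ∧ b ∧ c ∧ d ∧ e ∧ f ∧ g ∧ h ∧ i ≡ true
        all refl refl refl refl refl refl refl refl refl = refl

levels : List Level
levels = l₁ ∷ l₂ ∷ l₃ ∷ l₄ ∷ []

∈-levels : ∀ l → l ∈ levels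
∈-levels l₁ = here refl
∈-levels l₂ = there (here refl)
∈-levels l₃ = there (there (here refl))
∈-levels l₄ = there (there (there (here refl)))

-- The value reached from 0 by iterating t ↦ 27 + Rt four times, once per level.
geometric : ℕ → ℕ
geometric R = 27 * (1 + R + R * R + R * R * R)

module Choice (n K Θ : ℕ) .{{_ : NonZero Θ}} where

  open Levels n

  private
    vs = allFin n
    n³ = n * n * n
    n⁵ = n * n * (n * n * n)

  R G : ℕ
  R = 27 * K
  G = Θ * Θ * geometric R

  instance
    G≢0 : NonZero G
    G≢0 = m*n≢0 (Θ * Θ) (geometric R) {{m*n≢0 Θ Θ}}

  -- A is large enough to pay for recording the star of u and v, and H contains at most a 1/K
  -- fraction of it.
  Good : Graph3 n → Graph3 n → Level → Fin n → Fin n → Set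
  Good C H l u v = n³ ≤ G * count A × K * count (H ∩ A) ≤ count A
    where A = completions l u v C (H ∩ star u v)

  private
    good? : ∀ C H l u v → Good C H l u v ⊎ ¬ Good C H l u v
    good? C H l u v = fromDec ((n³ ≤? _) ×-dec (_ ≤? _))
      where
      fromDec : ∀ {B : Set} → Dec B → B ⊎ ¬ B
      fromDec (yes p) = inj₁ p
      fromDec (no ¬p) = inj₂ ¬p

    -- Whichever condition fails, the outcome is weakened to the same linear bound, which can be
    -- summed over u and v.
    bad-ratio : ∀ a s → ¬ (n³ ≤ G * a × K * s ≤ a) → G * (27 * a) ≤ 27 * n³ + R * (G * s)
    bad-ratio a s bad with n³ ≤? G * a | K * s ≤? a
    ... | yes p | yes q = ⊥-elim (bad (p , q))
    ... | no ¬p | _     = ≤-trans (≤-trans (≤-reflexive (lem₁ G a)) (*-monoʳ-≤ 27 (<⇒≤ (≰⇒> ¬p)))) (m≤m+n _ _)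
      where
      lem₁ : ∀ G a → G * (27 * a) ≡ 27 * (G * a)
      lem₁ = solve-∀
    ... | _     | no ¬q = ≤-trans (*-monoʳ-≤ G (*-monoʳ-≤ 27 (<⇒≤ (≰⇒> ¬q)))) (≤-trans (≤-reflexive (lem₂ G K s)) (m≤n+m _ (27 * n³)))
      where
      lem₂ : ∀ G k s → G * (27 * (k * s)) ≡ 27 * k * (G * s)
      lem₂ = solve-∀

  level-bound : ∀ C H l → (∀ u v → ¬ Good C H l u v) →
    G * weight l ⟦ C ⟧ ⟦ C ⟧ ⟦ H ⟧ ≤ 27 * n⁵ + R * (G * weight l ⟦ H ⟧ ⟦ C ⟧ ⟦ H ⟧)
  level-bound C H l bad = begin
    G * weight l ⟦ C ⟧ ⟦ C ⟧ ⟦ H ⟧ ≡⟨ sym (∑²-*ˡ vs G _) ⟩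
    ∑² vs (λ u v → G * ∑³ vs (λ x y z → 𝟙 (⟦ C ⟧ x y z) * 𝟙 (others l ⟦ C ⟧ ⟦ H ⟧ u v x y z)))
      ≤⟨ ∑²-mono vs (λ u v → ≤-trans (*-monoʳ-≤ G (completions-lower l u v C H)) (one u v)) ⟩
    ∑² vs (λ u v → 27 * n³ + R * (G * ∑³ vs (λ x y z → 𝟙 (⟦ H ⟧ x y z) * 𝟙 (others l ⟦ C ⟧ ⟦ H ⟧ u v x y z))))
      ≡⟨ trans (∑²-+ vs _ _) (cong₂ _+_ (trans (∑²-const vs (27 * n³)) (trans (cong (λ m → m * m * (27 * n³)) (length-allFin n)) (lem n)))
           (trans (∑²-*ˡ vs R _) (cong (R *_) (∑²-*ˡ vs G _)))) ⟩
    27 * n⁵ + R * (G * weight l ⟦ H ⟧ ⟦ C ⟧ ⟦ H ⟧) ∎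
    where
    open ≤-Reasoning
    lem : ∀ n → n * n * (27 * (n * n * n)) ≡ 27 * (n * n * (n * n * n))
    lem = solve-∀
    one : ∀ u v → let A = completions l u v C (H ∩ star u v) in
      G * (27 * count A) ≤ 27 * n³ + R * (G * ∑³ vs (λ x y z → 𝟙 (⟦ H ⟧ x y z) * 𝟙 (others l ⟦ C ⟧ ⟦ H ⟧ u v x y z)))
    one u v = ≤-trans (bad-ratio _ _ (bad u v)) (+-monoʳ-≤ (27 * n³) (*-monoʳ-≤ R (*-monoʳ-≤ G (completions-upper l u v C H))))

  -- Interpolating between the copies of T₅ in C and those in H, one edge at a time.
  good-level : ∀ C H → t5 H ≡ 0 → n⁵ < Θ * Θ * t5 C → Σ Level λ l → Σ (Fin n) λ u → Σ (Fin n) λ v → Good C H l u v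
  -- With a constant function, `argmax` is a plain search through a finite list.
  good-level C H free many with argmax (λ _ → 0) {P = λ o → Good C H (proj₁ o) (proj₁ (proj₂ o)) (proj₂ (proj₂ o))}
      (λ o → good? C H (proj₁ o) (proj₁ (proj₂ o)) (proj₂ (proj₂ o))) (cartesianProduct levels (cartesianProduct vs vs))
  ... | inj₂ ((l , u , v) , good , _) = l , u , v , good
  ... | inj₁ none = ⊥-elim (<-irrefl refl (begin-strict
    G * n⁵                   <⟨ *-monoʳ-< G many ⟩
    G * (Θ * Θ * t5 C)   ≡⟨ lem₁ G (Θ * Θ) (t5 C) ⟩
    Θ * Θ * (G * t5 C)   ≤⟨ *-monoʳ-≤ (Θ * Θ) chain ⟩
    Θ * Θ * (geometric R * n⁵) ≡⟨ sym (*-assoc (Θ * Θ) (geometric R) n⁵) ⟩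
    G * n⁵                   ∎))
    where
    open ≤-Reasoning
    lem₁ : ∀ G s t → G * (s * t) ≡ s * (G * t)
    lem₁ = solve-∀
    lem₂ : ∀ R m G → 27 * m + R * (27 * m + R * (27 * m + R * (27 * m + R * (G * 0)))) ≡ 27 * (1 + R + R * R + R * R * R) * m
    lem₂ = solve-∀
    none′ : ∀ l u v → ¬ Good C H l u v
    none′ l u v = none (l , u , v) (∈-cartesianProduct⁺ (∈-levels l) (∈-cartesianProduct⁺ (∈-allFin u) (∈-allFin v)))
    c = ⟦ C ⟧
    h = ⟦ H ⟧
    step : ∀ l s t → weight l c c h ≡ s → weight l h c h ≡ t → G * s ≤ 27 * n⁵ + R * (G * t)
    step l s t refl refl = level-bound C H l (none′ l)
    descend : ∀ {x y z} → x ≤ 27 * n⁵ + R * y → y ≤ z → x ≤ 27 * n⁵ + R * z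
    descend p q = ≤-trans p (+-monoʳ-≤ (27 * n⁵) (*-monoʳ-≤ R q))
    chain : G * t5 C ≤ geometric R * n⁵
    chain = ≤-trans
      (descend (step l₁ _ _ (weight-l₁ c c h) (weight-l₁ h c h))
      (descend (step l₂ _ _ (weight-l₂ c c h) (weight-l₂ h c h))
      (descend (step l₃ _ _ (weight-l₃ c c h) (weight-l₃ h c h))
      (step l₄ _ 0 (weight-l₄ c c h) (trans (weight-l₄ h c h) free)))))
      (≤-reflexive (lem₂ R n⁵ G))

𝟙-≤ : ∀ b {y} → (b ≡ true → 1 ≤ y) → 𝟙 b ≤ y
𝟙-≤ true  f = f refl
𝟙-≤ false f = z≤n

𝟙*-≤ : ∀ b {x y} → (b ≡ true → x ≤ y) → 𝟙 b * x ≤ y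
𝟙*-≤ true  f = ≤-trans (≤-reflexive (*-identityˡ _)) (f refl)
𝟙*-≤ false f = z≤n

∧-intro : ∀ {a b} → a ≡ true → b ≡ true → a ∧ b ≡ true
∧-intro refl refl = refl

module Containers (n Q Θ L : ℕ) .{{_ : NonZero Q}} .{{_ : NonZero Θ}} .{{_ : NonZero n}} (P : Graph3 n → Bool) where

  open Levels n
  open Choice n (K Q) Θ

  private
    vs = allFin n
    n³ = n * n * n
    n⁵ = n * n * (n * n * n)
    Gs = allVecs (length (triples n))

  family : Graph3 n → ℕ
  family C = ∑ Gs λ H → 𝟙 (P H ∧ (H ⊆ᵇ C))

  valid : Graph3 n → Graph3 n → Bool
  valid A S = (S ⊆ᵇ A) ∧ (n³ ≤ᵇ G * count A) ∧ (K Q * count S ≤ᵇ count A)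

  Fingerprint : Set
  Fingerprint = Level × Fin n × Fin n × Graph3 n

  fingerprints : List Fingerprint
  fingerprints = cartesianProduct levels (cartesianProduct vs (cartesianProduct vs Gs))

  inStar : Fingerprint → Bool
  inStar (l , u , v , I) = I ⊆ᵇ star u v

  removed : Graph3 n → Fingerprint → Graph3 n
  removed C (l , u , v , I) = completions l u v C I

  -- A union bound over the possible S = H ∩ A for one fingerprint; `valid` restricts S to what
  -- `Good` guarantees, so that A is large and S is small.
  refined : Graph3 n → Fingerprint → ℕ
  refined C o = ∑ Gs λ S → 𝟙 (valid (removed C o) S) * family (update C (removed C o) S)

  -- Binary logarithm of a bound on the number of fingerprints: 2 for the four levels, n for each of
  -- u and v because n ≤ 2ⁿ, and 6n² for a subset of the star.
  bits : ℕ
  bits = 2 + n + n + 6 * (n * n)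

  ∑-fingerprints : ∑ fingerprints (λ o → 𝟙 (inStar o)) ≤ 2 ^ bits
  ∑-fingerprints = begin
    ∑ fingerprints (λ o → 𝟙 (inStar o))
      ≡⟨ trans (∑-cartesianProduct levels (cartesianProduct vs (cartesianProduct vs Gs)) (λ o → 𝟙 (inStar o)))
           (∑-cong levels λ l → trans (∑-cartesianProduct vs (cartesianProduct vs Gs) (λ o → 𝟙 (inStar (l , o))))
           (∑-cong vs λ u → ∑-cartesianProduct vs Gs (λ o → 𝟙 (inStar (l , u , o))))) ⟩
    ∑ levels (λ _ → ∑² vs λ u v → ∑ Gs λ I → 𝟙 (I ⊆ᵇ star u v))
      ≤⟨ ∑-mono levels (λ _ → ∑²-mono vs λ u v → ≤-trans (∑-⊆ (star u v)) (^-monoʳ-≤ 2 (count-star u v))) ⟩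
    ∑ levels (λ _ → ∑² vs λ _ _ → 2 ^ (6 * (n * n)))
      ≡⟨ trans (∑-const levels (∑² vs λ _ _ → 2 ^ (6 * (n * n)))) (cong (4 *_) (trans (∑²-const vs (2 ^ (6 * (n * n)))) (cong (λ m → m * m * 2 ^ (6 * (n * n))) (length-allFin n)))) ⟩
    4 * (n * n * 2 ^ (6 * (n * n)))
      ≤⟨ *-monoʳ-≤ 4 (*-monoˡ-≤ (2 ^ (6 * (n * n))) (*-mono-≤ (<⇒≤ (n<2^n n)) (<⇒≤ (n<2^n n)))) ⟩
    4 * (2 ^ n * 2 ^ n * 2 ^ (6 * (n * n)))
      ≡⟨ sym (trans (^-distribˡ-+-* 2 (2 + n + n) (6 * (n * n))) (trans (cong (_* 2 ^ (6 * (n * n))) (^-distribˡ-+-* 2 (2 + n) n))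
           (lem (2 ^ n) (2 ^ (6 * (n * n)))))) ⟩
    2 ^ bits ∎
    where
    open ≤-Reasoning
    lem : ∀ x y → 2 * (2 * x) * x * y ≡ 4 * (x * x * y)
    lem = solve-∀

  module _ (free : ∀ H → P H ≡ true → t5 H ≡ 0)
           (family-sparse : ∀ C → Θ * Θ * t5 C ≤ n⁵ → family C ≤ 2 ^ L)
           (n≥ : 40 * Q * G ≤ n) where

    -- `good-level` supplies a fingerprint for each H counted on the left, and H survives in the
    -- updated set, so it is counted on the right at least once.
    family-≤ : ∀ C → n⁵ < Θ * Θ * t5 C → family C ≤ ∑ fingerprints (λ o → 𝟙 (inStar o) * refined C o)
    family-≤ C many = begin
      family C ≤⟨ ∑-mono Gs covered ⟩
      ∑ Gs (λ H → ∑ fingerprints λ o → ∑ Gs λ S → term H o S) ≡⟨ ∑-swap Gs fingerprints _ ⟩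
      ∑ fingerprints (λ o → ∑ Gs λ H → ∑ Gs λ S → term H o S)
        ≡⟨ ∑-cong fingerprints (λ o → trans (∑-swap Gs Gs _) (trans (∑-cong Gs λ S → collect o S) (∑-*ˡ Gs (𝟙 (inStar o)) _))) ⟩
      ∑ fingerprints (λ o → 𝟙 (inStar o) * refined C o) ∎
      where
      open ≤-Reasoning
      term : Graph3 n → Fingerprint → Graph3 n → ℕ
      term H o S = 𝟙 (inStar o) * (𝟙 (valid (removed C o) S) * 𝟙 (P H ∧ (H ⊆ᵇ update C (removed C o) S)))
      collect : ∀ o S → ∑ Gs (λ H → term H o S) ≡ 𝟙 (inStar o) * (𝟙 (valid (removed C o) S) * family (update C (removed C o) S))
      collect o S = trans (∑-*ˡ Gs (𝟙 (inStar o)) _) (cong (𝟙 (inStar o) *_) (∑-*ˡ Gs (𝟙 (valid (removed C o) S)) _))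
      covered : ∀ H → 𝟙 (P H ∧ (H ⊆ᵇ C)) ≤ ∑ fingerprints λ o → ∑ Gs λ S → term H o S
      covered H = 𝟙-≤ (P H ∧ (H ⊆ᵇ C)) λ eq → found H (proj₁ (∧-true {P H} eq)) (proj₂ (∧-true {P H} eq))
        (good-level C H (free H (proj₁ (∧-true {P H} eq))) many)
        where
        found : ∀ H → P H ≡ true → H ⊆ᵇ C ≡ true → (Σ Level λ l → Σ (Fin n) λ u → Σ (Fin n) λ v → Good C H l u v) →
          1 ≤ ∑ fingerprints λ o → ∑ Gs λ S → term H o S
        found H PH H⊆C (l , u , v , n³≤ , K≤) = ≤-trans (≤-reflexive (sym term≡1)) (≤-trans (∑-∈ (term H o) (∈-allVecs S))
                  (∑-∈ (λ o → ∑ Gs (term H o)) (∈-cartesianProduct⁺ (∈-levels l) (∈-cartesianProduct⁺ (∈-allFin u)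
                    (∈-cartesianProduct⁺ (∈-allFin v) (∈-allVecs I))))))
          where
          I = H ∩ star u v
          o : Fingerprint
          o = l , u , v , I
          A = removed C o
          S = H ∩ A
          term≡1 : term H o S ≡ 1
          term≡1 = cong₂ (λ a b → 𝟙 a * b) (∩-⊆ʳ H (star u v)) (cong₂ (λ a b → 𝟙 a * 𝟙 b)
            (∧-intro (∩-⊆ʳ H A) (∧-intro (T→≡ (≤⇒≤ᵇ n³≤)) (T→≡ (≤⇒≤ᵇ K≤)))) (∧-intro PH (⊆-update H C A H⊆C)))

    bits≤ : bits ≤ 10 * (n * n)
    bits≤ = ≤-trans (+-monoˡ-≤ (6 * (n * n)) (+-mono-≤ (+-mono-≤ (*-monoʳ-≤ 2 (*-mono-≤ 1≤n 1≤n)) n≤n²) n≤n²)) (≤-reflexive (lem (n * n)))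
      where
      1≤n : 1 ≤ n
      1≤n = >-nonZero⁻¹ n
      n≤n² : n ≤ n * n
      n≤n² = m≤m*n n n
      lem : ∀ s → 2 * s + s + s + 6 * s ≡ 10 * s
      lem = solve-∀

    -- With a = |A|, the fingerprint and the choice of S cost at most a/(4Q) bits each. As |S| ≤
    -- a/2, the size of C drops by at least a/2, and this frees a/(2Q) in the exponent.
    refined-≤ : ∀ C o → (∀ C′ → count C′ < count C → family C′ ≤ 2 ^ (L + count C′ / Q)) →
      refined C o * 2 ^ bits ≤ 2 ^ (L + count C / Q)
    refined-≤ C o IH = cases (n³ ≤? G * count (removed C o))
      where
      open ≤-Reasoning
      A = removed C o
      a = count A
      valid⇒ : ∀ S → valid A S ≡ true → S ⊆ᵇ A ≡ true × n³ ≤ G * a × K Q * count S ≤ a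
      valid⇒ S e = proj₁ (∧-true {S ⊆ᵇ A} e) , ≤ᵇ⇒≤ n³ (G * a) (≡→T (proj₁ sizes)) , ≤ᵇ⇒≤ (K Q * count S) a (≡→T (proj₂ sizes))
        where sizes = ∧-true {n³ ≤ᵇ G * a} {K Q * count S ≤ᵇ a} (proj₂ (∧-true {S ⊆ᵇ A} e))
      cases : Dec (n³ ≤ G * a) → refined C o * 2 ^ bits ≤ 2 ^ (L + count C / Q)
      cases (no small) = ≤-trans (*-monoˡ-≤ (2 ^ bits) (≤-trans (∑-mono Gs λ S → 𝟙*-≤ (valid A S) λ e →
        ⊥-elim (small (proj₁ (proj₂ (valid⇒ S e))))) (≤-reflexive (∑-zero Gs)))) z≤n
      cases (yes big) = begin
        refined C o * 2 ^ bits
          ≤⟨ *-monoˡ-≤ (2 ^ bits) (∑-mono Gs λ S → 𝟙*-≤ (valid A S) (term≤ S)) ⟩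
        ∑ Gs (λ S → 𝟙 (S ⊆ᵇ A) * 𝟙 (count S ≤ᵇ a / K Q) * Z) * 2 ^ bits
          ≡⟨ cong (_* 2 ^ bits) (∑-*ʳ Gs Z _) ⟩
        smallSubsets A (a / K Q) * Z * 2 ^ bits
          ≤⟨ *-mono-≤ (*-monoˡ-≤ Z (smallSubsets≤ Q A block≤a)) (^-monoʳ-≤ 2 bits≤q) ⟩
        2 ^ q * Z * 2 ^ q     ≡⟨ lem (2 ^ q) Z ⟩
        Z * (2 ^ q * 2 ^ q)   ≡⟨ cong (Z *_) (sym (^-distribˡ-+-* 2 q q)) ⟩
        Z * 2 ^ (q + q)       ≡⟨ sym (^-distribˡ-+-* 2 (L + (count C / Q ∸ (q + q))) (q + q)) ⟩
        2 ^ (L + (count C / Q ∸ (q + q)) + (q + q))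
          ≡⟨ cong (2 ^_) (trans (+-assoc L _ _) (cong (L +_) (m∸n+n≡m 2q≤c/Q))) ⟩
        2 ^ (L + count C / Q) ∎
        where
        instance
          4Q≢0′ : NonZero (4 * Q)
          4Q≢0′ = m*n≢0 4 Q
          K≢0′ : NonZero (K Q)
          K≢0′ = K≢0 Q
        q = a / (4 * Q)
        Z = 2 ^ (L + (count C / Q ∸ (q + q)))
        lem : ∀ x z → x * z * x ≡ z * (x * x)
        lem = solve-∀
        A⊆C : A ⊆ᵇ C ≡ true
        A⊆C = ∩-⊆ˡ C _
        a≤c : a ≤ count C
        a≤c = count-⊆ A C A⊆C
        -- Here n ≥ 40QG is used on a ≥ n³/G; it brings the 10n² bits of a fingerprint below a/(4Q).
        40Qn²≤a : 40 * Q * (n * n) ≤ a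
        40Qn²≤a = *-cancelˡ-≤ G (≤-trans (≤-trans (≤-reflexive (lem₁ G Q (n * n))) (*-monoˡ-≤ (n * n) n≥))
          (≤-trans (≤-reflexive (lem₂ n)) big))
          where
          lem₁ : ∀ G Q s → G * (40 * Q * s) ≡ 40 * Q * G * s
          lem₁ = solve-∀
          lem₂ : ∀ n → n * (n * n) ≡ n * n * n
          lem₂ = solve-∀
        block≤a : block Q ≤ a
        block≤a = ≤-trans (≤-trans (*-monoˡ-≤ Q {16} {40} (m≤m+n 16 24)) (m≤m*n (40 * Q) (n * n) {{m*n≢0 n n}})) 40Qn²≤a
        0<a : 0 < a
        0<a = ≤-trans (>-nonZero⁻¹ (block Q) {{block≢0 Q}}) block≤a
        bits≤q : bits ≤ q
        bits≤q = ≤-trans bits≤ (≤-trans (≤-reflexive (sym (m*n/n≡m (10 * (n * n)) (4 * Q))))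
          (/-monoˡ-≤ (4 * Q) (≤-trans (≤-reflexive (lem₁ Q (n * n))) 40Qn²≤a)))
          where
          lem₁ : ∀ Q s → 10 * s * (4 * Q) ≡ 40 * Q * s
          lem₁ = solve-∀
        -- The balance with floors: a drop of a/2 in size lowers the quotient by Q by at least
        -- 2⌊a/(4Q)⌋.
        quotient : ∀ {m c} → 2 * m + a ≤ 2 * c → m / Q + (q + q) ≤ c / Q
        quotient {m} {c} le = begin
          m / Q + (q + q)             ≡⟨ cong (m / Q +_) (sym (m*n/n≡m (q + q) Q)) ⟩
          m / Q + (q + q) * Q / Q     ≡⟨ sym (+-distrib-/-∣ʳ m (n∣m*n (q + q))) ⟩
          (m + (q + q) * Q) / Q       ≤⟨ /-monoˡ-≤ Q (*-cancelˡ-≤ 2 (begin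
              2 * (m + (q + q) * Q)     ≡⟨ lem₁ m q Q ⟩
              2 * m + q * (4 * Q)       ≤⟨ +-monoʳ-≤ (2 * m) (m/n*n≤m a (4 * Q)) ⟩
              2 * m + a                 ≤⟨ le ⟩
              2 * c                     ∎)) ⟩
          c / Q ∎
          where
          lem₁ : ∀ m q Q → 2 * (m + (q + q) * Q) ≡ 2 * m + q * (4 * Q)
          lem₁ = solve-∀
        2q≤c/Q : q + q ≤ count C / Q
        2q≤c/Q = subst (λ z → z + (q + q) ≤ count C / Q) (0/n≡0 Q) (quotient {0} {count C} (≤-trans a≤c (m≤m+n _ _)))
        term≤ : ∀ S → valid A S ≡ true → family (update C A S) ≤ 𝟙 (S ⊆ᵇ A) * 𝟙 (count S ≤ᵇ a / K Q) * Z
        term≤ S e = begin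
          family (update C A S)                 ≤⟨ IH (update C A S) smaller ⟩
          2 ^ (L + count (update C A S) / Q)    ≤⟨ ^-monoʳ-≤ 2 (+-monoʳ-≤ L (m+n≤o⇒m≤o∸n _ (quotient {c′} {count C} drop))) ⟩
          Z                                     ≡⟨ sym (*-identityˡ Z) ⟩
          1 * 1 * Z                             ≡⟨ cong₂ (λ a b → 𝟙 a * 𝟙 b * Z) (sym (proj₁ (valid⇒ S e))) (sym s≤ᵇ) ⟩
          𝟙 (S ⊆ᵇ A) * 𝟙 (count S ≤ᵇ a / K Q) * Z ∎
          where
          s  = count S
          c′ = count (update C A S)
          Ks≤a : K Q * s ≤ a
          Ks≤a = proj₂ (proj₂ (valid⇒ S e))
          s≤ᵇ : (s ≤ᵇ a / K Q) ≡ true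
          s≤ᵇ = T→≡ (≤⇒≤ᵇ (≤-trans (≤-reflexive (sym (m*n/n≡m s (K Q)))) (/-monoˡ-≤ (K Q) (≤-trans (≤-reflexive (*-comm s (K Q))) Ks≤a))))
          2s≤a : 2 * s ≤ a
          2s≤a = ≤-trans (*-monoˡ-≤ s 2≤K) Ks≤a
            where
            2≤K : 2 ≤ K Q
            2≤K = ≤-trans (*-monoʳ-≤ 2 (>-nonZero⁻¹ (block Q) {{block≢0 Q}})) (m≤n*m (rate Q) (block Q) {{block≢0 Q}})
          balance : c′ + a ≤ count C + s
          balance = count-update C A S A⊆C
          drop : 2 * c′ + a ≤ 2 * count C
          drop = +-cancelʳ-≤ a _ _ (begin
            2 * c′ + a + a         ≡⟨ lem₁ c′ a ⟩
            2 * (c′ + a)           ≤⟨ *-monoʳ-≤ 2 balance ⟩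
            2 * (count C + s)      ≡⟨ *-distribˡ-+ 2 (count C) s ⟩
            2 * count C + 2 * s    ≤⟨ +-monoʳ-≤ (2 * count C) 2s≤a ⟩
            2 * count C + a        ∎)
            where
            lem₁ : ∀ c a → 2 * c + a + a ≡ 2 * (c + a)
            lem₁ = solve-∀
          smaller : c′ < count C
          smaller = *-cancelˡ-< 2 c′ (count C) (≤-trans (≤-trans (≤-reflexive (+-comm 1 _)) (+-monoʳ-≤ (2 * c′) 0<a)) drop)

    -- Either C has few copies of T₅ and the hypothesis on sparse copies applies, or C is replaced
    -- by strictly smaller sets; the fuel tracks its size.
    family-bound : ∀ fuel C → count C < fuel → family C ≤ 2 ^ (L + count C / Q)
    family-bound (suc fuel) C (s≤s c≤) = cases (Θ * Θ * t5 C ≤? n⁵)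
      where
      open ≤-Reasoning
      Y = 2 ^ (L + count C / Q)
      cases : Dec (Θ * Θ * t5 C ≤ n⁵) → family C ≤ Y
      cases (yes few) = ≤-trans (family-sparse C few) (^-monoʳ-≤ 2 (m≤m+n L _))
      cases (no many) = *-cancelʳ-≤ _ _ (2 ^ bits) {{m^n≢0 2 bits}} (begin
        family C * 2 ^ bits ≤⟨ *-monoˡ-≤ (2 ^ bits) (family-≤ C (≰⇒> many)) ⟩
        ∑ fingerprints (λ o → 𝟙 (inStar o) * refined C o) * 2 ^ bits ≡⟨ sym (∑-*ʳ fingerprints (2 ^ bits) _) ⟩
        ∑ fingerprints (λ o → 𝟙 (inStar o) * refined C o * 2 ^ bits)
          ≤⟨ ∑-mono fingerprints (λ o → ≤-trans (≤-reflexive (*-assoc (𝟙 (inStar o)) _ _))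
               (*-monoʳ-≤ (𝟙 (inStar o)) (refined-≤ C o λ C′ lt → family-bound fuel C′ (≤-trans lt c≤)))) ⟩
        ∑ fingerprints (λ o → 𝟙 (inStar o) * Y)   ≡⟨ ∑-*ʳ fingerprints Y _ ⟩
        ∑ fingerprints (λ o → 𝟙 (inStar o)) * Y   ≤⟨ *-monoˡ-≤ Y ∑-fingerprints ⟩
        2 ^ bits * Y                              ≡⟨ *-comm (2 ^ bits) Y ⟩
        Y * 2 ^ bits                              ∎)

⊆-mask : ∀ {A : Set} (ts : List A) v → v ⊆ᵇ mask ts (λ _ → true) ≡ true
⊆-mask []       []          = refl
⊆-mask (t ∷ ts) (true ∷ v)  = ⊆-mask ts v
⊆-mask (t ∷ ts) (false ∷ v) = ⊆-mask ts v

not-true : ∀ {b} → not b ≡ true → b ≡ false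
not-true {false} _ = refl

-- Choice of parameters and the final count

module Parameters (b : ℕ) .{{_ : NonZero b}} where

  -- `D₀` and `τ` are dictated by `stable`, and `Θ` is the sum of the lower bounds required there.
  -- `Q` is 2 · 54τ, so the container cost n³/Q is half of the saving n³/(54τ) in `L`.
  D₀ τ Θ Q : ℕ
  D₀ = 4 * b * (1 + errQ)
  τ  = D₀ * (36 * b)
  Θ  = 18 * τ * (1 + 18 * τ * errP) + (4 * (D₀ * errP) + (4 * b + 5))
  Q  = 108 * τ

  instance
    D₀≢0 : NonZero D₀
    D₀≢0 = m*n≢0 (4 * b) (1 + errQ) {{m*n≢0 4 b}}
    τ≢0 : NonZero τ
    τ≢0 = m*n≢0 D₀ (36 * b) {{D₀≢0}} {{m*n≢0 36 b}}
    Q≢0 : NonZero Q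
    Q≢0 = m*n≢0 108 τ {{_}} {{τ≢0}}

  5≤Θ : 5 ≤ Θ
  5≤Θ = ≤-trans (m≤n+m 5 (4 * b)) (≤-trans (m≤n+m _ (4 * (D₀ * errP))) (m≤n+m _ (18 * τ * (1 + 18 * τ * errP))))

  instance
    Θ≢0 : NonZero Θ
    Θ≢0 = >-nonZero (≤-trans (s≤s z≤n) 5≤Θ)

  -- Size bound for a container C that is not dense enough for `stable`: in that case 9 · 6|C| ≤ 4n³
  -- - n³/τ.
  L : ℕ → ℕ
  L n = (τ * (4 * (n * n * n)) ∸ n * n * n) / (54 * τ)
    where instance
      54τ≢0 : NonZero (54 * τ)
      54τ≢0 = m*n≢0 54 τ {{_}} {{τ≢0}}

module Leaf (b : ℕ) .{{_ : NonZero b}} (n : ℕ) .{{_ : NonZero n}} where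

  open Parameters b
  open Levels n

  private
    vs = allFin n
    n³ = n * n * n
    n⁵ = n * n * (n * n * n)

  nearlySemiBipartite : ∀ C → 24 * τ ≤ n → Θ * Θ * t5 C ≤ n⁵ →
    τ * (4 * n³) ≤ τ * (9 * ∑³ vs λ x y z → 𝟙 (⟦ C ⟧ x y z)) + n³ →
    Σ (Fin n → Bool) λ x → b * ∑³ vs (λ u v w → 𝟙 (⟦ C ⟧ u v w) * 𝟙 (inconsistent (x u) (x v) (x w))) ≤ n³
  nearlySemiBipartite C = go n (length-allFin n)
    where
    -- The number of vertices enters `stable` as the length of the vertex list.
    go : ∀ m → length vs ≡ m → .{{_ : NonZero m}} → 24 * τ ≤ m → Θ * Θ * t5 C ≤ m * m * (m * m * m) →
      τ * (4 * (m * m * m)) ≤ τ * (9 * ∑³ vs λ x y z → 𝟙 (⟦ C ⟧ x y z)) + m * m * m →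
      Σ (Fin n → Bool) λ x → b * ∑³ vs (λ u v w → 𝟙 (⟦ C ⟧ u v w) * 𝟙 (inconsistent (x u) (x v) (x w))) ≤ m * m * m
    go .(length vs) refl = Robust.stable ⟦ C ⟧ (hasEdge-swap₁ C) (hasEdge-swap₂ C) vs b D₀ Θ ≤-refl
      (m≤m+n _ _) (≤-trans (m≤m+n _ _) (m≤n+m _ (18 * τ * (1 + 18 * τ * errP))))
      (≤-trans (m≤m+n (4 * b) 5) (≤-trans (m≤n+m _ (4 * (D₀ * errP))) (m≤n+m _ (18 * τ * (1 + 18 * τ * errP))))) 5≤Θ

module Bound (a b : ℕ) .{{_ : NonZero a}} .{{_ : NonZero b}} (n : ℕ) .{{_ : NonZero n}} where

  open Parameters b
  open Levels n
  open Leaf b n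

  private
    vs = allFin n
    ts = triples n
    n³ = n * n * n
    n⁵ = n * n * (n * n * n)
    Gs = allVecs (length ts)

  isBad : Graph3 n → Bool
  isBad H = not (containsT5 {n} H) ∧ (a * n³ <ᵇ b * D {n} H)

  open Containers n Q Θ (L n) isBad

  -- If C is nearly extremal, stability gives D_H ≤ n³/b ≤ (a/b)n³ for all H ⊆ C, so C contains no
  -- bad H. Otherwise |C| is at most `L n`, and all subsets of C are counted.
  family-sparse : 24 * τ ≤ n → ∀ C → Θ * Θ * t5 C ≤ n⁵ → family C ≤ 2 ^ L n
  family-sparse n≥ C few = cases (τ * (4 * n³) ≤? τ * (9 * e) + n³)
    where
    open ≤-Reasoning
    e = ∑³ vs λ x y z → 𝟙 (⟦ C ⟧ x y z)
    cases : Dec (τ * (4 * n³) ≤ τ * (9 * e) + n³) → family C ≤ 2 ^ L n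
    cases (yes dense) = ≤-trans (≤-trans (∑-mono Gs λ H → 𝟙-≤ (isBad H ∧ (H ⊆ᵇ C)) λ eq → ⊥-elim (close H eq)) (≤-reflexive (∑-zero Gs))) z≤n
      where
      x = nearlySemiBipartite C n≥ few dense
      close : ∀ H → isBad H ∧ (H ⊆ᵇ C) ≡ true → ⊥
      close H eq = <⇒≱ far (begin
        b * D {n} H ≤⟨ *-monoʳ-≤ b (D≤inconsistent H C (proj₁ x) (proj₂ (∧-true {isBad H} eq))) ⟩
        b * ∑³ vs (λ u v w → 𝟙 (⟦ C ⟧ u v w) * 𝟙 (inconsistent (proj₁ x u) (proj₁ x v) (proj₁ x w))) ≤⟨ proj₂ x ⟩
        n³          ≤⟨ m≤n*m n³ a ⟩
        a * n³      ∎)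
        where
        far : a * n³ < b * D {n} H
        far = <ᵇ⇒< (a * n³) (b * D {n} H) (≡→T (proj₂ (∧-true {not (containsT5 {n} H)} (proj₁ (∧-true {isBad H} eq)))))
    cases (no sparse) = ≤-trans (∑-mono Gs λ H → 𝟙-≤ (isBad H ∧ (H ⊆ᵇ C)) λ eq → ≤-reflexive (cong 𝟙 (sym (proj₂ (∧-true {isBad H} eq)))))
      (≤-trans (∑-⊆ C) (^-monoʳ-≤ 2 count≤L))
      where
      instance
        54τ≢0 : NonZero (54 * τ)
        54τ≢0 = m*n≢0 54 τ {{_}} {{τ≢0}}
      lem : ∀ t c → c * (54 * t) ≡ t * (9 * (6 * c))
      lem = solve-∀
      count≤L : count C ≤ L n
      count≤L = ≤-trans (≤-reflexive (sym (m*n/n≡m (count C) (54 * τ)))) (/-monoˡ-≤ (54 * τ) (m+n≤o⇒m≤o∸n _ (begin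
        count C * (54 * τ) + n³       ≡⟨ cong (_+ n³) (lem τ (count C)) ⟩
        τ * (9 * (6 * count C)) + n³  ≤⟨ +-monoˡ-≤ n³ (*-monoʳ-≤ τ (*-monoʳ-≤ 9 (6count≤E C))) ⟩
        τ * (9 * e) + n³              ≤⟨ <⇒≤ (≰⇒> sparse) ⟩
        τ * (4 * n³)                  ∎)))

  -- The recursion starts from the complete 3-graph, which contains every H.
  badCount≤ : 24 * τ ≤ n → 40 * Q * Choice.G n (K Q) Θ ≤ n → badCount n a b ≤ 2 ^ (L n + n³ / Q)
  badCount≤ n≥₁ n≥₂ = begin
    badCount n a b                     ≡⟨ length-filter isBad Gs ⟩
    ∑ Gs (λ H → 𝟙 (isBad H))           ≤⟨ ∑-mono Gs (λ H → 𝟙-≤ (isBad H) λ eq → ≤-reflexive (cong 𝟙 (sym (∧-intro eq (⊆-mask ts H))))) ⟩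
    family full                        ≤⟨ family-bound (λ H e → T5-free H (not-true (proj₁ (∧-true {not (containsT5 {n} H)} e)))) (family-sparse n≥₁) n≥₂ (suc (count full)) full ≤-refl ⟩
    2 ^ (L n + count full / Q)         ≤⟨ ^-monoʳ-≤ 2 (+-monoʳ-≤ (L n) (/-monoˡ-≤ Q full≤n³)) ⟩
    2 ^ (L n + n³ / Q)                 ∎
    where
    open ≤-Reasoning
    full : Graph3 n
    full = mask ts λ _ → true
    full≤n³ : count full ≤ n³
    full≤n³ = ≤-trans (≤-reflexive (trans (count-mask ts _) (sym (length-∑ ts)))) triples≤n³

  -- Since 1/(54τ) - 1/(108τ) = (2/27)/(8τ), the exponent is at most (2n³/27)(1 - 1/(8τ)). Taking 1
  -- + 8τ as denominator of ν makes the inequality strict.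
  exponent : 27 * (1 + 8 * τ) * (L n + n³ / Q) < 8 * τ * (2 * n³)
  exponent = *-cancelˡ-< (4 * τ) _ _ (begin-strict
    4 * τ * (27 * q * (L n + n³ / Q))              ≡⟨ lem₁ τ q (L n) (n³ / Q) ⟩
    q * (2 * (L n * (54 * τ)) + n³ / Q * (108 * τ)) ≤⟨ *-monoʳ-≤ q (+-mono-≤ (*-monoʳ-≤ 2 (m/n*n≤m _ (54 * τ))) (m/n*n≤m n³ Q)) ⟩
    q * (2 * (τ * (4 * n³) ∸ n³) + n³)             <⟨ final ⟩
    4 * τ * (8 * τ * (2 * n³)) ∎)
    where
    open ≤-Reasoning
    instance
      54τ≢0 : NonZero (54 * τ)
      54τ≢0 = m*n≢0 54 τ {{_}} {{τ≢0}}
    q = 1 + 8 * τ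
    lem₁ : ∀ t q l m → 4 * t * (27 * q * (l + m)) ≡ q * (2 * (l * (54 * t)) + m * (108 * t))
    lem₁ = solve-∀
    lem₂ : ∀ s m → 2 * s + m + m ≡ 2 * (s + m)
    lem₂ = solve-∀
    lem₃ : ∀ t m → (1 + 8 * t) * (2 * (t * (4 * m))) ≡ 4 * t * (8 * t * (2 * m)) + 8 * t * m
    lem₃ = solve-∀
    lem₄ : ∀ t m → (1 + 8 * t) * m ≡ 8 * t * m + m
    lem₄ = solve-∀
    n³≤4τn³ : n³ ≤ τ * (4 * n³)
    n³≤4τn³ = ≤-trans (m≤n*m n³ 4) (m≤n*m (4 * n³) τ)
    final : q * (2 * (τ * (4 * n³) ∸ n³) + n³) < 4 * τ * (8 * τ * (2 * n³))
    final = +-cancelʳ-< (q * n³) _ _ (begin-strict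
      q * (2 * (τ * (4 * n³) ∸ n³) + n³) + q * n³ ≡⟨ sym (*-distribˡ-+ q _ n³) ⟩
      q * (2 * (τ * (4 * n³) ∸ n³) + n³ + n³)     ≡⟨ cong (q *_) (trans (lem₂ (τ * (4 * n³) ∸ n³) n³) (cong (2 *_) (m∸n+n≡m n³≤4τn³))) ⟩
      q * (2 * (τ * (4 * n³)))                    ≡⟨ lem₃ τ n³ ⟩
      4 * τ * (8 * τ * (2 * n³)) + 8 * τ * n³     <⟨ +-monoʳ-< (4 * τ * (8 * τ * (2 * n³))) (m<m+n (8 * τ * n³) (>-nonZero⁻¹ n³ {{m*n≢0 (n * n) n {{m*n≢0 n n}}}})) ⟩
      4 * τ * (8 * τ * (2 * n³)) + (8 * τ * n³ + n³) ≡⟨ cong (4 * τ * (8 * τ * (2 * n³)) +_) (sym (lem₄ τ n³)) ⟩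
      4 * τ * (8 * τ * (2 * n³)) + q * n³         ∎)

-- ν = p/q = 1/(1 + 8τ). The power 27q clears the denominators of (1 - p/q) · 2n³/27, and the two
-- truncated differences cover both signs of q - p. As a ≥ 1, it suffices to aim for n³/b
-- inconsistent edges.
theorem2 : (a b : ℕ) → 0 < a → 0 < b →
    Σ ℕ λ p → Σ ℕ λ q → 0 < p × 0 < q × Σ ℕ λ n₀ → (n : ℕ) → n₀ < n →
      badCount n a b ^ (27 * q) * 2 ^ ((p ∸ q) * (2 * (n * n * n)))
        < 2 ^ ((q ∸ p) * (2 * (n * n * n)))
theorem2 a b 0<a 0<b = 1 , 1 + 8 * τ , s≤s z≤n , s≤s z≤n , n₀ , bound
  where
  instance
    a≢0 : NonZero a
    a≢0 = >-nonZero 0<a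
    b≢0 : NonZero b
    b≢0 = >-nonZero 0<b
  open Parameters b
  n₀ : ℕ
  -- `G` has the same value for every n, so it is taken at 0, before n is known.
  n₀ = 24 * τ + 40 * Q * Choice.G 0 (K Q) Θ
  bound : (n : ℕ) → n₀ < n → badCount n a b ^ (27 * (1 + 8 * τ)) * 2 ^ ((1 ∸ (1 + 8 * τ)) * (2 * (n * n * n)))
    < 2 ^ ((1 + 8 * τ ∸ 1) * (2 * (n * n * n)))
  bound n n₀<n = begin-strict
    badCount n a b ^ (27 * q) * 2 ^ ((1 ∸ q) * (2 * n³))
      ≡⟨ trans (cong (λ z → badCount n a b ^ (27 * q) * 2 ^ (z * (2 * n³))) (0∸n≡0 (8 * τ))) (*-identityʳ _) ⟩
    badCount n a b ^ (27 * q)         ≤⟨ ^-monoˡ-≤ (27 * q) (badCount≤ (≤-trans (m≤m+n _ _) (<⇒≤ n₀<n)) (≤-trans (m≤n+m _ (24 * τ)) (<⇒≤ n₀<n))) ⟩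
    (2 ^ (L n + n³ / Q)) ^ (27 * q)   ≡⟨ ^-*-assoc 2 (L n + n³ / Q) (27 * q) ⟩
    2 ^ ((L n + n³ / Q) * (27 * q))   ≡⟨ cong (2 ^_) (*-comm (L n + n³ / Q) (27 * q)) ⟩
    2 ^ (27 * q * (L n + n³ / Q))     <⟨ ^-monoʳ-< 2 (s≤s (s≤s z≤n)) exponent ⟩
    2 ^ (8 * τ * (2 * n³))            ∎
    where
    open ≤-Reasoning
    n³ = n * n * n
    q  = 1 + 8 * τ
    instance
      n≢0 : NonZero n
      n≢0 = >-nonZero (≤-<-trans z≤n n₀<n)
    open Bound a b n
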